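{- Let $A,B$ and $S$ be non-empty subsets of a finite Abelian group $G$ with $|A|+|B|=|G|+L_S$. Assume that $0\in A\cap B\cap S$, that $0$ is an $A\wedge^S B$-exception, and that $|A\wedge^S B|=|G|-2|S|$. Then the following hold. (i) Let $S=S_1\cup S_2\cup\cdots\cup S_t$ be the decomposition of $S$ modulo $2\cdot G$. Then $|S_i|=L_S/L(G)$ and $|A\wedge^{S_i}B|=|G|-2|S_i|$ for each $i\in\{1,\ldots,t\}$. Moreover, the set of $A\wedge^S B$-exceptions is partitioned as $G\setminus(A\wedge^S B)=\bigcup_{i=1}^t\big(G\setminus(A\wedge^{S_i}B)\big)$. Without loss of generality, number the parts so that $0\in S_1$. (ii) $S_1$ is a subgroup of $G$. Let $\pi:G\to G/S_1$ be the natural projection, $A'=\pi(A)$ and $B'=\pi(B)$. (iii) There exists $b\in A'\cap B'$ such that $H=\langle 2b\rangle$ is a subgroup of $G/S_1$ of odd order $d$ greater than $1$, and (iv) there exist distinct elements $x_1,\ldots,x_k,x_{k+1},\ldots,x_l,x_{l+1},\ldots,x_m$ of $(G/S_1)\setminus(K(G/S_1)+H)$, where $m=(|G/S_1|/d-L(G/S_1))/2$ and $0\le k\le l\le m$, such that $$(G/S_1)\setminus (K(G/S_1)+H)=\bigcup_{i=1}^m\big((x_i+H)\cup(-x_i+H)\big),$$ $$A'=\big(\{0,b,3b,\ldots,(d-2)b\}+K(G/S_1)\big)\cup Q,\qquad B'=\big(\{0,b,3b,\ldots,(d-2)b\}+K(G/S_1)\big)\cup R,$$ where $Q=\{x_1,\ldots,x_k,\pm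 x_{k+1},\ldots,\pm x_l\}+H$ and $R=\{x_1,\ldots,x_k,\pm x_{l+1},\ldots,\pm x_m\}+H$. Moreover, if (for such $b$ and $x_1,\ldots,x_m$) we suppose that $(d+1)/2>L(G/S_1)$, then: (v) putting $Y=\{y\in G:\ 2y\in S_1\}$, there is a decomposition $Y=\bigcup_{i=1}^r(y_i+S_1)$ of $Y$ into pairwise distinct cosets modulo $S_1$, with $r\ge t$, such that $S_i=y_i+S_1$ for each $i=1,\ldots,t$; in particular $2\cdot S\subset S_1$; (vi) the set of $A\wedge^S B$-exceptions is $\{0,2b^*\}+S$, where $b^*\in\pi^{ -1}(b)$; and (vii) $\big(\{0,2b\}+\{\pi(y_1),\pi(y_2),\ldots,\pi(y_t)\}\big)\cap(Q+R)=\emptyset$.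
   Context: Groups are written additively. For subsets $A,B,S$ of a finite Abelian group $G$: $A+B=\{a+b: a\in A, b\in B\}$ and $A\wedge^S B=\{a+b:\ a\in A,\ b\in B,\ a-b\notin S\}$. An $A\wedge^S B$-exception is an element of $(A+B)\setminus (A\wedge^S B)$. For $z\in G$, $L_S(z)=|\{(x,y)\in G\times G:\ x+y=z,\ x-y\in S\}|$, and $L_S=\max_{z\in G}L_S(z)$. For any finite Abelian group $\Gamma$, $K(\Gamma)=\{g\in \Gamma: 2g=0\}$ and $L(\Gamma)=|K(\Gamma)|$. For $T\subset G$, $2\cdot T=\{2t:t\in T\}$; in particular $2\cdot G$ is the subgroup of doubles. The decomposition of $S$ modulo $2\cdot G$ is the partition of $S$ into its non-empty intersections with the cosets of $2\cdot G$. The set $\{0,b,3b,\ldots,(d-2)b\}$ consists of $0$ and the odd multiples $jb$ with $1\le j\le d-2$, $j$ odd. -}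

module Defs where

open import Algebra.Bundles using (AbelianGroup)
import Algebra.Construct.DirectProduct as DirectProduct
import Algebra.Properties.AbelianGroup as AbelianGroupProperties
import Algebra.Properties.CommutativeSemigroup as CommutativeSemigroupProperties
import Algebra.Properties.Monoid.Mult as Mult
open import Data.Fin.Base using (Fin; toℕ)
import Data.Fin.Properties as Fin
open import Data.Integer.Base using (ℤ; +_; -[1+_])
open import Data.List.Base using (List; length; filter; deduplicate; cartesianProduct; map)
open import Data.List.Extrema.Nat using (max)
open import Data.List.Membership.Setoid.Properties using (index-injective)
open import Data.List.Relation.Unary.Any as Any using (any?; index)
open import Data.List.Relation.Unary.Enumerates.Setoid using (IsEnumeration)
open import Data.List.Relation.Unary.Enumerates.Setoid.Properties using (cartesianProduct⁺)
open import Data.Nat.Base as ℕ using (ℕ; zero; suc)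
open import Data.Nat.Divisibility using (_∤_; _∣?_)
open import Data.Nat.DivMod using (m≡m%n+[m/n]*n; m%n<n)
import Data.Nat.Properties as ℕ
open import Data.Product.Base using (∃; ∃₂; _×_; _,_)
open import Data.Sum.Base using (_⊎_; inj₁; inj₂)
open import Data.Unit.Base using (⊤; tt)
open import Function.Bundles using (Func)
open import Level using (Level; _⊔_; 0ℓ) renaming (suc to lsuc)
open import Relation.Binary.Definitions using (_Respects_)
import Relation.Binary.Definitions as Binary
open import Relation.Binary.PropositionalEquality as ≡ using (_≡_; _≢_)
import Relation.Binary.Reasoning.Setoid as SetoidReasoning
open import Relation.Nullary using (Dec; yes; ¬_)
open import Relation.Nullary.Decidable using (map′; _×-dec_; _⊎-dec_; ¬?)
open import Relation.Unary using (Pred; Decidable)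

private
  variable
    c ℓ c′ ℓ′ p q r : Level

-- The enumeration may list an element more than once, so the same list serves
-- for a quotient of the group; the order is the number of distinct entries.
record FiniteAbelianGroup c ℓ : Set (lsuc (c ⊔ ℓ)) where
  field
    abelianGroup : AbelianGroup c ℓ

  open AbelianGroup abelianGroup public
    renaming
      ( _∙_ to _+_ ; ε to 0# ; _⁻¹ to -_
      ; ∙-cong to +-cong ; ∙-congˡ to +-congˡ ; ∙-congʳ to +-congʳ
      ; assoc to +-assoc ; comm to +-comm
      ; identity to +-identity ; identityˡ to +-identityˡ ; identityʳ to +-identityʳ
      ; inverse to -‿inverse ; inverseˡ to -‿inverseˡ ; inverseʳ to -‿inverseʳ
      ; ⁻¹-cong to -‿cong
      )
    using
      ( Carrier ; _≈_ ; _≉_ ; _-_ ; setoid ; refl ; sym ; trans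
      ; monoid ; commutativeMonoid ; commutativeSemigroup )

  field
    _≟_      : Binary.Decidable _≈_
    elements : List Carrier
    complete : IsEnumeration setoid elements

  open Mult monoid public using () renaming (_×_ to _·_)

  _·ᶻ_ : ℤ → Carrier → Carrier
  (+ n)    ·ᶻ g = n · g
  -[1+ n ] ·ᶻ g = - (suc n · g)

module _ (G : FiniteAbelianGroup c ℓ) where
  open FiniteAbelianGroup G
  open Mult monoid using (×-congˡ; ×-homo-+; ×-assocˡ)
  open AbelianGroupProperties abelianGroup using (∙-cancelˡ; inverseˡ-unique)

  search : {P : Pred Carrier p} → Decidable P → P Respects _≈_ → Dec (∃ P)
  search P? resp = map′ Any.satisfied
    (λ (x , Px) → Any.map (λ x≈y → resp x≈y Px) (complete x)) (any? P? elements)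

  private
    N : ℕ
    N = length elements

    period : ∀ g → ∃ λ k → suc k ℕ.≤ N × suc k · g ≈ 0#
    period g with Fin.pigeonhole (ℕ.n<1+n N) (λ i → index (complete (toℕ i · g)))
    ... | i , j , i<j , eq with ℕ.m≤n⇒∃[o]m+o≡n i<j
    ... | k , 1+i+k≡j = k , k<N , sym (∙-cancelˡ (toℕ i · g) _ _ (begin
        toℕ i · g + 0#          ≈⟨ +-identityʳ _ ⟩
        toℕ i · g               ≈⟨ index-injective setoid (complete _) (complete _) eq ⟩
        toℕ j · g               ≈⟨ ×-congˡ (≡.sym i+1+k≡j) ⟩
        (toℕ i ℕ.+ suc k) · g   ≈⟨ ×-homo-+ g (toℕ i) (suc k) ⟩
        toℕ i · g + suc k · g   ∎))
      where
      open SetoidReasoning setoid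
      i+1+k≡j : toℕ i ℕ.+ suc k ≡ toℕ j
      i+1+k≡j = ≡.trans (ℕ.+-suc (toℕ i) k) 1+i+k≡j
      k<N : suc k ℕ.≤ N
      k<N = ℕ.≤-trans (ℕ.m≤n+m (suc k) (toℕ i))
              (ℕ.≤-trans (ℕ.≤-reflexive i+1+k≡j) (Fin.toℕ≤pred[n] j))

    ·-zeroʳ : ∀ n → n · 0# ≈ 0#
    ·-zeroʳ zero    = refl
    ·-zeroʳ (suc n) = trans (+-identityˡ _) (·-zeroʳ n)

    reduce : ∀ g k → suc k · g ≈ 0# → ∀ n → n · g ≈ (n ℕ.% suc k) · g
    reduce g k kg≈0 n = begin
      n · g                                  ≈⟨ ×-congˡ (m≡m%n+[m/n]*n n (suc k)) ⟩
      (n % ℕ.+ n / ℕ.* suc k) · g            ≈⟨ ×-homo-+ g (n %) (n / ℕ.* suc k) ⟩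
      (n %) · g + (n / ℕ.* suc k) · g        ≈⟨ +-congˡ (×-assocˡ g (n /) (suc k)) ⟨
      (n %) · g + (n /) · (suc k · g)        ≈⟨ +-congˡ (Mult.×-congʳ monoid (n /) kg≈0) ⟩
      (n %) · g + (n /) · 0#                 ≈⟨ +-congˡ (·-zeroʳ (n /)) ⟩
      (n %) · g + 0#                         ≈⟨ +-identityʳ _ ⟩
      (n %) · g                              ∎
      where
      open SetoidReasoning setoid
      infix 9 _% _/
      _% _/ : ℕ → ℕ
      a % = a ℕ.% suc k
      a / = a ℕ./ suc k

    negate : ∀ g k → suc k · g ≈ 0# → ∀ n → - (n · g) ≈ (n ℕ.* k) · g
    negate g k kg≈0 n = sym (inverseˡ-unique _ _ (begin
      (n ℕ.* k) · g + n · g   ≈⟨ ×-homo-+ g (n ℕ.* k) n ⟨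
      (n ℕ.* k ℕ.+ n) · g     ≈⟨ ×-congˡ (≡.trans (ℕ.+-comm (n ℕ.* k) n) (≡.sym (ℕ.*-suc n k))) ⟩
      (n ℕ.* suc k) · g       ≈⟨ ×-assocˡ g n (suc k) ⟨
      n · (suc k · g)         ≈⟨ Mult.×-congʳ monoid n kg≈0 ⟩
      n · 0#                  ≈⟨ ·-zeroʳ n ⟩
      0#                      ∎))
      where open SetoidReasoning setoid

  multiple? : ∀ g x → Dec (∃ λ n → n ·ᶻ g ≈ x)
  multiple? g x = map′ (λ (n , _ , eq) → + n , eq) bound
                       (ℕ.anyUpTo? (λ n → (n · g) ≟ x) N)
    where
    boundℕ : ∀ n → n · g ≈ x → ∃ λ m → m ℕ.< N × m · g ≈ x
    boundℕ n eq with k , k<N , kg≈0 ← period g =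
      n ℕ.% suc k , ℕ.<-≤-trans (m%n<n n (suc k)) k<N , trans (sym (reduce g k kg≈0 n)) eq
    bound : (∃ λ n → n ·ᶻ g ≈ x) → ∃ λ m → m ℕ.< N × m · g ≈ x
    bound (+ n , eq) = boundℕ n eq
    bound (-[1+ n ] , eq) with k , _ , kg≈0 ← period g =
      boundℕ (suc n ℕ.* k) (trans (sym (negate g k kg≈0 (suc n))) eq)

open FiniteAbelianGroup public using (Carrier; 0#)

_×ᴳ_ : FiniteAbelianGroup c ℓ → FiniteAbelianGroup c′ ℓ′ → FiniteAbelianGroup (c ⊔ c′) (ℓ ⊔ ℓ′)
G ×ᴳ G′ = record
  { abelianGroup = DirectProduct.abelianGroup G.abelianGroup G′.abelianGroup
  ; _≟_          = λ (x , x′) (y , y′) → (x G.≟ y) ×-dec (x′ G′.≟ y′)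
  ; elements     = cartesianProduct G.elements G′.elements
  ; complete     = cartesianProduct⁺ G.setoid G′.setoid G.complete G′.complete
  }
  where
  module G  = FiniteAbelianGroup G
  module G′ = FiniteAbelianGroup G′

-- Every subset of a finite set is classically decidable.
record Subset (G : FiniteAbelianGroup c ℓ) p : Set (c ⊔ ℓ ⊔ lsuc p) where
  open FiniteAbelianGroup G using (_≈_)
  field
    Mem  : Pred (Carrier G) p
    resp : Mem Respects _≈_
    dec  : Decidable Mem

module _ {G : FiniteAbelianGroup c ℓ} where
  infix  4 _∈_ _∉_ _⊆_ _≐_
  infixr 7 _∩_
  infixr 6 _∪_
  infixl 6 _∖_
  infixl 8 _⊕_
  infix  8 _∧[_]_

  open FiniteAbelianGroup G using (_≈_; _+_; _-_; _≟_; elements; sym; trans)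
  private module G = FiniteAbelianGroup G

  _∈_ _∉_ : Carrier G → Subset G p → Set p
  x ∈ A = Subset.Mem A x
  x ∉ A = ¬ (x ∈ A)

  Nonempty : Subset G p → Set (c ⊔ p)
  Nonempty A = ∃ λ x → x ∈ A

  _⊆_ _≐_ : Subset G p → Subset G q → Set (c ⊔ p ⊔ q)
  A ⊆ B = ∀ x → x ∈ A → x ∈ B
  A ≐ B = A ⊆ B × B ⊆ A

  Disjoint : Subset G p → Subset G q → Set (c ⊔ p ⊔ q)
  Disjoint A B = ∀ x → x ∈ A → x ∉ B

  ∣_∣ : Subset G p → ℕ
  ∣ A ∣ = length (deduplicate _≟_ (filter (Subset.dec A) elements))

  full : Subset G 0ℓ
  full = record { Mem = λ _ → ⊤ ; resp = λ _ _ → tt ; dec = λ _ → yes tt }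

  ∁ : Subset G p → Subset G p
  ∁ A = record
    { Mem  = λ x → x ∉ A
    ; resp = λ x≈y x∉A y∈A → x∉A (Subset.resp A (sym x≈y) y∈A)
    ; dec  = λ x → ¬? (Subset.dec A x)
    }

  _∩_ _∪_ : Subset G p → Subset G q → Subset G (p ⊔ q)
  A ∩ B = record
    { Mem  = λ x → x ∈ A × x ∈ B
    ; resp = λ x≈y (x∈A , x∈B) → Subset.resp A x≈y x∈A , Subset.resp B x≈y x∈B
    ; dec  = λ x → Subset.dec A x ×-dec Subset.dec B x
    }
  A ∪ B = record
    { Mem  = λ x → x ∈ A ⊎ x ∈ B
    ; resp = λ { x≈y (inj₁ x∈A) → inj₁ (Subset.resp A x≈y x∈A)
               ; x≈y (inj₂ x∈B) → inj₂ (Subset.resp B x≈y x∈B) }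
    ; dec  = λ x → Subset.dec A x ⊎-dec Subset.dec B x
    }

  _∖_ : Subset G p → Subset G q → Subset G (p ⊔ q)
  A ∖ B = A ∩ ∁ B

  ⋃ : ∀ {n} → (Fin n → Subset G p) → Subset G p
  ⋃ A = record
    { Mem  = λ x → ∃ λ i → x ∈ A i
    ; resp = λ x≈y (i , x∈Aᵢ) → i , Subset.resp (A i) x≈y x∈Aᵢ
    ; dec  = λ x → Fin.any? (λ i → Subset.dec (A i) x)
    }

  ｛_｝ : Carrier G → Subset G ℓ
  ｛ x ｝ = record { Mem = x ≈_ ; resp = λ y≈z x≈y → trans x≈y y≈z ; dec = x ≟_ }

  -- { x i : i ∈ Fin n, P i }
  select : ∀ {n} {P : Pred (Fin n) p} → (Fin n → Carrier G) → Decidable P → Subset G (ℓ ⊔ p)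
  select {P = P} x P? = record
    { Mem  = λ y → ∃ λ i → P i × x i ≈ y
    ; resp = λ y≈z (i , Pi , xᵢ≈y) → i , Pi , trans xᵢ≈y y≈z
    ; dec  = λ y → Fin.any? (λ i → P? i ×-dec (x i ≟ y))
    }

  range : ∀ {n} → (Fin n → Carrier G) → Subset G ℓ
  range x = ⋃ λ i → ｛ x i ｝

  _⊕_ : Subset G p → Subset G q → Subset G (c ⊔ ℓ ⊔ p ⊔ q)
  A ⊕ B = record
    { Mem  = λ z → ∃₂ λ a b → a ∈ A × b ∈ B × a + b ≈ z
    ; resp = λ z≈w (a , b , a∈A , b∈B , eq) → a , b , a∈A , b∈B , trans eq z≈w
    ; dec  = λ z → search G
        (λ a → search G (λ b → Subset.dec A a ×-dec Subset.dec B b ×-dec ((a + b) ≟ z))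
          (λ b≈b′ (a∈A , b∈B , eq) →
            a∈A , Subset.resp B b≈b′ b∈B , trans (G.+-congˡ (sym b≈b′)) eq))
        (λ a≈a′ (b , a∈A , b∈B , eq) →
          b , Subset.resp A a≈a′ a∈A , b∈B , trans (G.+-congʳ (sym a≈a′)) eq)
    }

  _∧[_]_ : Subset G p → Subset G q → Subset G r → Subset G (c ⊔ ℓ ⊔ p ⊔ q ⊔ r)
  A ∧[ S ] B = record
    { Mem  = λ z → ∃₂ λ a b → a ∈ A × b ∈ B × a - b ∉ S × a + b ≈ z
    ; resp = λ z≈w (a , b , a∈A , b∈B , a-b∉S , eq) → a , b , a∈A , b∈B , a-b∉S , trans eq z≈w
    ; dec  = λ z → search G
        (λ a → search G
          (λ b → Subset.dec A a ×-dec Subset.dec B b ×-dec Subset.dec (∁ S) (a - b)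
                   ×-dec ((a + b) ≟ z))
          (λ b≈b′ (a∈A , b∈B , a-b∉S , eq) →
            a∈A , Subset.resp B b≈b′ b∈B
            , Subset.resp (∁ S) (G.+-congˡ (G.-‿cong b≈b′)) a-b∉S
            , trans (G.+-congˡ (sym b≈b′)) eq))
        (λ a≈a′ (b , a∈A , b∈B , a-b∉S , eq) →
          b , Subset.resp A a≈a′ a∈A , b∈B
          , Subset.resp (∁ S) (G.+-congʳ a≈a′) a-b∉S
          , trans (G.+-congʳ (sym a≈a′)) eq)
    }

  exceptions : Subset G p → Subset G q → Subset G r → Subset G (c ⊔ ℓ ⊔ p ⊔ q ⊔ r)
  exceptions A B S = (A ⊕ B) ∖ (A ∧[ S ] B)

module _ {G : FiniteAbelianGroup c ℓ} where
  open FiniteAbelianGroup G using (_≈_; _+_; -_; _-_; _·_; _·ᶻ_; _≟_; elements; trans; sym)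
  private module G = FiniteAbelianGroup G

  L[_]_ : Subset G p → Carrier G → ℕ
  L[ S ] z = ∣ solutions ∣
    where
    solutions : Subset (G ×ᴳ G) _
    solutions = record
      { Mem  = λ (x , y) → x + y ≈ z × x - y ∈ S
      ; resp = λ (x≈x′ , y≈y′) (eq , x-y∈S) →
          trans (sym (G.+-cong x≈x′ y≈y′)) eq
          , Subset.resp S (G.+-cong x≈x′ (G.-‿cong y≈y′)) x-y∈S
      ; dec  = λ (x , y) → ((x + y) ≟ z) ×-dec Subset.dec S (x - y)
      }

  maxL : Subset G p → ℕ
  maxL S = max 0 (map (L[ S ]_) elements)

  record IsSubgroup (H : Subset G p) : Set (c ⊔ p) where
    field
      0∈       : 0# G ∈ H
      +-closed : ∀ {x y} → x ∈ H → y ∈ H → x + y ∈ H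
      -‿closed : ∀ {x} → x ∈ H → - x ∈ H

  ⟨_⟩ : Carrier G → Subset G ℓ
  ⟨ g ⟩ = record
    { Mem  = λ x → ∃ λ n → n ·ᶻ g ≈ x
    ; resp = λ x≈y (n , eq) → n , trans eq x≈y
    ; dec  = multiple? G g
    }

  -- Used for odd d > 1 only, where d ∸ 2 is not truncated; 2 ∤ j excludes j = 0.
  oddMultiples : Carrier G → ℕ → Subset G ℓ
  oddMultiples b d = record
    { Mem  = λ x → ∃ λ j → j ℕ.≤ d ℕ.∸ 2 × 2 ∤ j × j · b ≈ x
    ; resp = λ x≈y (j , j≤d-2 , odd , eq) → j , j≤d-2 , odd , trans eq x≈y
    ; dec  = λ x → map′ (λ (j , j<d-1 , rest) → j , ℕ.s≤s⁻¹ j<d-1 , rest)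
                        (λ (j , j≤d-2 , rest) → j , ℕ.s≤s j≤d-2 , rest)
        (ℕ.anyUpTo? (λ j → ¬? (2 ∣? j) ×-dec ((j · b) ≟ x)) (suc (d ℕ.∸ 2)))
    }

order : FiniteAbelianGroup c ℓ → ℕ
order G = ∣ full {G = G} ∣

K : (G : FiniteAbelianGroup c ℓ) → Subset G ℓ
K G = record
  { Mem  = λ g → g + g ≈ 0# G
  ; resp = λ g≈h eq → trans (sym (+-cong g≈h g≈h)) eq
  ; dec  = λ g → (g + g) ≟ 0# G
  }
  where open FiniteAbelianGroup G hiding (0#; Carrier)

module _ {G : FiniteAbelianGroup c ℓ} {G′ : FiniteAbelianGroup c′ ℓ′} where
  private
    module G  = FiniteAbelianGroup G
    module G′ = FiniteAbelianGroup G′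

  image : Func G.setoid G′.setoid → Subset G p → Subset G′ (c ⊔ ℓ′ ⊔ p)
  image f A = record
    { Mem  = λ y → ∃ λ x → x ∈ A × to x G′.≈ y
    ; resp = λ y≈z (x , x∈A , eq) → x , x∈A , G′.trans eq y≈z
    ; dec  = λ y → search G (λ x → Subset.dec A x ×-dec (to x G′.≟ y))
        (λ x≈x′ (x∈A , eq) → Subset.resp A x≈x′ x∈A , G′.trans (cong (G.sym x≈x′)) eq)
    }
    where open Func f

  preimage : Func G.setoid G′.setoid → Subset G′ p → Subset G p
  preimage f A = record
    { Mem  = λ x → to x ∈ A
    ; resp = λ x≈y → Subset.resp A (cong x≈y)
    ; dec  = λ x → Subset.dec A (to x)
    }
    where open Func f

double : (G : FiniteAbelianGroup c ℓ) →
         Func (FiniteAbelianGroup.setoid G) (FiniteAbelianGroup.setoid G)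
double G = record { to = λ x → x + x ; cong = λ x≈y → +-cong x≈y x≈y }
  where open FiniteAbelianGroup G

2·_ : {G : FiniteAbelianGroup c ℓ} → Subset G p → Subset G (c ⊔ ℓ ⊔ p)
2·_ {G = G} T = image (double G) T

-- The quotient keeps the carrier of G; its equality is congruence modulo H.
_⧸_ : (G : FiniteAbelianGroup c ℓ) {H : Subset G p} → IsSubgroup H → FiniteAbelianGroup c p
_⧸_ {c = c} {p = p} G {H} H≤G = record
  { abelianGroup = record
    { _≈_ = _~_
    ; _∙_ = _+_
    ; ε   = 0# G
    ; _⁻¹ = -_
    ; isAbelianGroup = record
      { isGroup = record
        { isMonoid = record
          { isSemigroup = record
            { isMagma = record
              { isEquivalence = record
                { refl  = ≈⇒~ refl
                ; sym   = λ {x} {y} x~y → Subset.resp H (⁻¹-anti-homo‿- x y) (-‿closed x~y)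
                ; trans = λ {x} {y} {z} x~y y~z →
                    Subset.resp H (telescope x y z) (+-closed x~y y~z)
                }
              ; ∙-cong = λ {x} {x′} {y} {y′} x~x′ y~y′ → Subset.resp H
                  (trans (interchange x (- x′) y (- y′)) (+-congˡ (⁻¹-∙-comm x′ y′)))
                  (+-closed x~x′ y~y′)
              }
            ; assoc = λ x y z → ≈⇒~ (+-assoc x y z)
            }
          ; identity = (λ x → ≈⇒~ (+-identityˡ x)) , (λ x → ≈⇒~ (+-identityʳ x))
          }
        ; inverse = (λ x → ≈⇒~ (-‿inverseˡ x)) , (λ x → ≈⇒~ (-‿inverseʳ x))
        ; ⁻¹-cong = λ {x} {y} x~y → Subset.resp H (sym (⁻¹-∙-comm x (- y))) (-‿closed x~y)
        }
      ; comm = λ x y → ≈⇒~ (+-comm x y)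
      }
    }
  ; _≟_      = λ x y → Subset.dec H (x - y)
  ; elements = elements
  ; complete = λ x → Any.map ≈⇒~ (complete x)
  }
  where
  open FiniteAbelianGroup G hiding (0#; Carrier)
  open IsSubgroup H≤G
  open AbelianGroupProperties abelianGroup using (x≈y⇒x∙y⁻¹≈ε; ⁻¹-anti-homo‿-; ⁻¹-∙-comm)
  open CommutativeSemigroupProperties commutativeSemigroup using (interchange)

  _~_ : Carrier G → Carrier G → Set p
  x ~ y = x - y ∈ H

  ≈⇒~ : ∀ {x y} → x ≈ y → x ~ y
  ≈⇒~ x≈y = Subset.resp H (sym (x≈y⇒x∙y⁻¹≈ε x≈y)) 0∈

  telescope : ∀ x y z → (x - y) + (y - z) ≈ x - z
  telescope x y z = begin
    (x - y) + (y - z)      ≈⟨ +-assoc x (- y) (y - z) ⟩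
    x + (- y + (y - z))    ≈⟨ +-congˡ (+-assoc (- y) y (- z)) ⟨
    x + ((- y + y) - z)    ≈⟨ +-congˡ (+-congʳ (-‿inverseˡ y)) ⟩
    x + (0# G - z)         ≈⟨ +-congˡ (+-identityˡ (- z)) ⟩
    x - z                  ∎
    where open SetoidReasoning setoid

module _ {G : FiniteAbelianGroup c ℓ} {H : Subset G p} (H≤G : IsSubgroup H) where
  open FiniteAbelianGroup G hiding (0#; Carrier)

  π : Func setoid (FiniteAbelianGroup.setoid (G ⧸ H≤G))
  π = record { to = λ x → x ; cong = λ x≈y →
    Subset.resp H (sym (AbelianGroupProperties.x≈y⇒x∙y⁻¹≈ε abelianGroup x≈y)) (IsSubgroup.0∈ H≤G) }

module _ {G : FiniteAbelianGroup c ℓ} where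

  record IsDecompositionMod2G {t} (S : Subset G p) (Sᵢ : Fin t → Subset G q) : Set (c ⊔ ℓ ⊔ p ⊔ q) where
    coset : Carrier G → Subset G (c ⊔ ℓ)
    coset g = ｛ g ｝ ⊕ (2· full)
    field
      nonempty     : ∀ i → Nonempty (Sᵢ i)
      intersection : ∀ i → ∃ λ g → Sᵢ i ≐ S ∩ coset g
      exhaustive   : ∀ g → Nonempty (S ∩ coset g) → ∃ λ i → Sᵢ i ≐ S ∩ coset g
      distinct     : ∀ i j → i ≢ j → ¬ (Sᵢ i ≐ Sᵢ j)

-- x i, for i in Fin m, is the element usually written x_{i+1}.
record PairStructure (Γ : FiniteAbelianGroup c ℓ) (A′ : Subset Γ p) (B′ : Subset Γ q)
                     : Set (c ⊔ ℓ ⊔ p ⊔ q) where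
  open FiniteAbelianGroup Γ using (_+_; -_; _≈_)
  field
    b    : Carrier Γ
    b∈A′ : b ∈ A′
    b∈B′ : b ∈ B′

  H : Subset Γ ℓ
  H = ⟨ b + b ⟩

  d : ℕ
  d = ∣ H ∣

  field
    d-odd : 2 ∤ d
    1<d   : 1 ℕ.< d
    k l m : ℕ
    k≤l   : k ℕ.≤ l
    l≤m   : l ℕ.≤ m
    -- m = (|Γ| / d - |K Γ|) / 2
    m-eq  : d ℕ.* (2 ℕ.* m ℕ.+ ∣ K Γ ∣) ≡ order Γ
    x     : Fin m → Carrier Γ
    x-distinct : ∀ i j → x i ≈ x j → i ≡ j
    x∉K+H      : ∀ i → x i ∉ K Γ ⊕ H
    cover      : ∁ (K Γ ⊕ H) ≐ ⋃ λ i → (｛ x i ｝ ⊕ H) ∪ (｛ - x i ｝ ⊕ H)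

  Q : Subset Γ (c ⊔ ℓ)
  Q = (select x (λ i → toℕ i ℕ.<? k)
       ∪ select x (λ i → (k ℕ.≤? toℕ i) ×-dec (toℕ i ℕ.<? l))
       ∪ select (λ i → - x i) (λ i → (k ℕ.≤? toℕ i) ×-dec (toℕ i ℕ.<? l))) ⊕ H

  R : Subset Γ (c ⊔ ℓ)
  R = (select x (λ i → toℕ i ℕ.<? k)
       ∪ select x (λ i → l ℕ.≤? toℕ i)
       ∪ select (λ i → - x i) (λ i → l ℕ.≤? toℕ i)) ⊕ H

  E : Subset Γ (c ⊔ ℓ)
  E = (｛ 0# Γ ｝ ∪ oddMultiples b d) ⊕ K Γ

  field
    A′-eq : A′ ≐ E ∪ Q
    B′-eq : B′ ≐ E ∪ R

{-# OPTIONS --safe #-}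
-- If z is not in A ∧[ S ] B, counting forces A ∪ (z - B) = G, and A ∩ (z - B) is
-- D_z = { x : 2x - z ∈ S }, of size L_S; call such z missing.  Fix a missing z₀ and one
-- class Sᵢ modulo 2·G, put D = D_{z₀}, and let X be the set of w with z₀ + 2w missing for
-- Sᵢ.  Chasing translates through these conditions shows that if d ∈ D, v, w ∈ X and
-- neither d + v nor d + w is in D, then d + w - v ∈ D.  Hence |X| ≤ 2|D|, that is, Sᵢ has
-- at most 2|Sᵢ| missing sums, and equality makes D a coset of a subgroup contained in X.
-- The hypothesis on |A ∧[ S ] B| forces equality in every class.
--
-- For the class of 0, A and B are then unions of cosets of S₁ and D/S₁ = K(G/S₁).  A second
-- missing sum 2b in G/S₁ forces A to agree at x and x + 2b away from K and K - b.  Walking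
-- along multiples of b gives A on K + ⟨2b⟩, where the order d of 2b must be odd; elsewhere A
-- is a union of ⟨2b⟩-cosets and B is the complement of -A.  If (d+1)/2 > |K|, any missing
-- sum z lies in K + ⟨2b⟩ (otherwise |D_z| ≥ (d+1)/2 > |K| = |D_z|), and a comparison of
-- intervals of multiples of 2b leaves only z ∈ K and z ∈ 2b + K, with D_z = K or b + K.
module Submission where

open import Algebra.Bundles using (AbelianGroup)
import Algebra.Properties.AbelianGroup as AbelianGroupProperties
import Algebra.Properties.CommutativeMonoid.Mult as CommutativeMonoidMult
import Algebra.Properties.CommutativeSemigroup as CommutativeSemigroupProperties
import Algebra.Properties.Monoid.Mult as MonoidMult
open import Data.Fin.Base as Fin using (Fin; zero; suc; toℕ; _↑ˡ_; _↑ʳ_; inject≤; splitAt)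
import Data.Fin.Properties as Fin
import Data.Integer.Base as ℤ using (+_; -[1+_])
open import Data.List.Base as List using (List; []; _∷_; length; filter; deduplicate)
open import Data.List.Extrema.Nat using (xs≤max)
import Data.List.Membership.Setoid.Properties as Membership
open import Data.List.Relation.Unary.All as All using (All; []; _∷_)
import Data.List.Relation.Unary.All.Properties as All
open import Data.List.Relation.Unary.AllPairs using ([]; _∷_)
import Data.List.Relation.Unary.Any as Any
import Data.List.Relation.Unary.Any.Properties as Any
open import Data.List.Relation.Unary.Unique.DecSetoid.Properties using (deduplicate-!)
open import Data.Nat.Base as ℕ using (ℕ; zero; suc)
open import Data.Nat.Divisibility using (_∣_; _∤_; divides; ∣m+n∣m⇒∣n)
open import Data.Nat.DivMod using (m≡m%n+[m/n]*n; m%n<n; m*n/n≡m)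
open import Data.Nat.Induction using (<-rec)
import Data.Nat.Properties as ℕ
import Data.Nat.Solver as ℕSolver
open import Data.Product.Base using (∃; ∃₂; Σ; _×_; _,_; proj₁; proj₂)
open import Data.Sum.Base using (_⊎_; inj₁; inj₂; [_,_]′)
open import Data.Unit.Base using (tt)
open import Data.Vec.Base as Vec using (Vec; []; _∷_; lookup; zipWith; replicate; _[_]≔_)
open import Data.Vec.N-ary using (N-ary; _$ⁿ_)
open import Function.Base using (_∘_; id)
open import Function.Bundles using (Func; _⟨$⟩_)
open import Level using (Level; _⊔_)
open import Relation.Binary.Bundles using (DecSetoid; Setoid)
open import Relation.Binary.Core using (Rel)
import Relation.Binary.Definitions as Binary
open import Relation.Binary.PropositionalEquality as ≡ using (_≡_; _≢_)
import Relation.Binary.Reasoning.Setoid as SetoidReasoning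
open import Relation.Binary.Structures using (IsEquivalence)
open import Relation.Nullary using (¬_; Dec; yes; no; contradiction)
open import Relation.Nullary.Decidable using (decidable-stable; _×-dec_; _⊎-dec_)
open import Relation.Unary using (Pred)
open import Defs

-- The parameter w, and not z = z₀ + 2w, is the right variable: in terms of w, the sets N = z₀ - B
-- and D are the same for every missing sum, and only translates by w and 2w of one fixed
-- configuration are compared. This is why everything is counted on preimages under doubling. Each
-- count then carries the factor |K(G)|, which cancels, but only if doubling reaches every element
-- concerned; hence the classes modulo `2·G`, to which a missing z is assigned through the value 2x
-- - z at any x in D_z.
--
-- The 2 in the bound comes from cutting X along D - d: each of the two pieces injects into D. When
-- the bound is attained, both pieces are full. The inner one makes D a coset; the outer one is not
-- empty and supplies b, so the second missing sum 2b comes out of the equality case itself.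
--
-- In the last stage, write d = 2e + 1 for the odd order of 2b. Among the numbers below d, the sums
-- of two numbers from 1 to e are all except 0 and 1. This is why exactly two kinds of missing sums
-- survive.

private
  variable
    c c′ ℓ ℓ′ p q r s : Level
    m n : ℕ

-- Deciding identities in Abelian groups.

data Expr (n : ℕ) : Set where
  var : Fin n → Expr n
  𝟎   : Expr n
  _⊞_ : Expr n → Expr n → Expr n
  ⊟_  : Expr n → Expr n

infixl 6 _⊞_ _⊟⊟_
infix  8 ⊟_
infix  4 _⊜_

_⊟⊟_ : ∀ {n} → Expr n → Expr n → Expr n
e ⊟⊟ f = e ⊞ ⊟ f

_⊜_ : ∀ {n} → Expr n → Expr n → Expr n × Expr n
_⊜_ = _,_

positive negative : ∀ {n} → Expr n → Vec ℕ n
positive (var i) = replicate _ 0 [ i ]≔ 1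
positive 𝟎       = replicate _ 0
positive (e ⊞ f) = zipWith ℕ._+_ (positive e) (positive f)
positive (⊟ e)   = negative e
negative (var i) = replicate _ 0
negative 𝟎       = replicate _ 0
negative (e ⊞ f) = zipWith ℕ._+_ (negative e) (negative f)
negative (⊟ e)   = positive e

close : ∀ {n a} {A : Set a} → N-ary n (Expr n) A → A
close f = f $ⁿ Vec.map var (Vec.allFin _)

-- Expressions are compared by moving their negative parts to the other side,
-- which leaves an identity in a commutative monoid.
module AbelianGroupSolver {c ℓ} (G : AbelianGroup c ℓ) where
  open AbelianGroup G hiding (Carrier) renaming
    ( _∙_ to _+_ ; ε to 0ᴳ ; _⁻¹ to -_ ; ∙-cong to +-cong ; ∙-congˡ to +-congˡ
    ; ∙-congʳ to +-congʳ ; identityˡ to +-identityˡ ; identityʳ to +-identityʳ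
    ; inverseˡ to -‿inverseˡ )
  open AbelianGroup G using () renaming (Carrier to Elt)
  open MonoidMult monoid renaming (_×_ to _·_)
  open CommutativeSemigroupProperties commutativeSemigroup using (interchange; x∙yz≈xz∙y)
  open AbelianGroupProperties G using (∙-cancelʳ)
  open SetoidReasoning setoid

  ⟦_⟧ : ∀ {n} → Expr n → Vec Elt n → Elt
  ⟦ var i ⟧ ρ = lookup ρ i
  ⟦ 𝟎 ⟧     ρ = 0ᴳ
  ⟦ e ⊞ f ⟧ ρ = ⟦ e ⟧ ρ + ⟦ f ⟧ ρ
  ⟦ ⊟ e ⟧   ρ = - ⟦ e ⟧ ρ

  combination : ∀ {n} → Vec ℕ n → Vec Elt n → Elt
  combination []       []      = 0ᴳ
  combination (k ∷ ks) (x ∷ ρ) = k · x + combination ks ρ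

  combination-0 : ∀ {n} (ρ : Vec Elt n) → combination (replicate n 0) ρ ≈ 0ᴳ
  combination-0 []      = refl
  combination-0 (x ∷ ρ) = trans (+-identityˡ _) (combination-0 ρ)

  combination-var : ∀ {n} (i : Fin n) ρ → combination (replicate n 0 [ i ]≔ 1) ρ ≈ lookup ρ i
  combination-var zero    (x ∷ ρ) = trans (+-congˡ (combination-0 ρ))
    (trans (+-identityʳ _) (+-identityʳ x))
  combination-var (suc i) (x ∷ ρ) = trans (+-identityˡ _) (combination-var i ρ)

  combination-+ : ∀ {n} (ks ls : Vec ℕ n) ρ →
    combination (zipWith ℕ._+_ ks ls) ρ ≈ combination ks ρ + combination ls ρ
  combination-+ []       []       []      = sym (+-identityˡ 0ᴳ)
  combination-+ (k ∷ ks) (l ∷ ls) (x ∷ ρ) = trans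
    (+-cong (×-homo-+ x k l) (combination-+ ks ls ρ))
    (interchange (k · x) (l · x) (combination ks ρ) (combination ls ρ))

  -- Both parts have to be carried together, because `⊟_` exchanges them. Adding the negative part
  -- leaves only natural multiples, so no integer coefficients occur.
  sound : ∀ {n} (e : Expr n) ρ → ⟦ e ⟧ ρ + combination (negative e) ρ ≈ combination (positive e) ρ
  sound (var i) ρ = trans (+-congˡ (combination-0 ρ))
    (trans (+-identityʳ _) (sym (combination-var i ρ)))
  sound 𝟎       ρ = +-identityˡ _
  sound (e ⊞ f) ρ = begin
    (⟦ e ⟧ ρ + ⟦ f ⟧ ρ) + combination (negative (e ⊞ f)) ρ
      ≈⟨ +-congˡ (combination-+ (negative e) (negative f) ρ) ⟩
    (⟦ e ⟧ ρ + ⟦ f ⟧ ρ) + (combination (negative e) ρ + combination (negative f) ρ)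
      ≈⟨ interchange _ _ _ _ ⟩
    (⟦ e ⟧ ρ + combination (negative e) ρ) + (⟦ f ⟧ ρ + combination (negative f) ρ)
      ≈⟨ +-cong (sound e ρ) (sound f ρ) ⟩
    combination (positive e) ρ + combination (positive f) ρ
      ≈⟨ combination-+ (positive e) (positive f) ρ ⟨
    combination (positive (e ⊞ f)) ρ ∎
  sound (⊟ e)   ρ = begin
    - ⟦ e ⟧ ρ + combination (positive e) ρ                   ≈⟨ +-congˡ (sound e ρ) ⟨
    - ⟦ e ⟧ ρ + (⟦ e ⟧ ρ + combination (negative e) ρ)       ≈⟨ assoc _ _ _ ⟨
    (- ⟦ e ⟧ ρ + ⟦ e ⟧ ρ) + combination (negative e) ρ       ≈⟨ +-congʳ (-‿inverseˡ _) ⟩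
    0ᴳ + combination (negative e) ρ                          ≈⟨ +-identityˡ _ ⟩
    combination (negative e) ρ                               ∎

  solve-pair : ∀ {n} (ρ : Vec Elt n) (e f : Expr n) →
    zipWith ℕ._+_ (positive e) (negative f) ≡ zipWith ℕ._+_ (positive f) (negative e) →
    ⟦ e ⟧ ρ ≈ ⟦ f ⟧ ρ
  solve-pair ρ e f eq = ∙-cancelʳ (neg e + neg f) _ _ (begin
    ⟦ e ⟧ ρ + (neg e + neg f)    ≈⟨ assoc _ _ _ ⟨
    (⟦ e ⟧ ρ + neg e) + neg f    ≈⟨ +-congʳ (sound e ρ) ⟩
    pos e + neg f                ≈⟨ combination-+ (positive e) (negative f) ρ ⟨
    combination (zipWith ℕ._+_ (positive e) (negative f)) ρ
                             ≡⟨ ≡.cong (λ ks → combination ks ρ) eq ⟩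
    combination (zipWith ℕ._+_ (positive f) (negative e)) ρ
                             ≈⟨ combination-+ (positive f) (negative e) ρ ⟩
    pos f + neg e                ≈⟨ +-congʳ (sound f ρ) ⟨
    (⟦ f ⟧ ρ + neg f) + neg e    ≈⟨ x∙yz≈xz∙y _ _ _ ⟨
    ⟦ f ⟧ ρ + (neg e + neg f)    ∎)
    where
    pos neg : Expr _ → Elt
    pos e = combination (positive e) ρ
    neg e = combination (negative e) ρ

  -- The hypothesis compares closed vectors of numerals, so each use discharges it by `≡.refl`.
  -- Compound terms such as `i · b` enter as atoms of the environment.
  solve : ∀ {n} (ρ : Vec Elt n) (f : N-ary n (Expr n) (Expr n × Expr n)) →
    zipWith ℕ._+_ (positive (proj₁ (close f))) (negative (proj₂ (close f)))
      ≡ zipWith ℕ._+_ (positive (proj₂ (close f))) (negative (proj₁ (close f))) →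
    ⟦ proj₁ (close f) ⟧ ρ ≈ ⟦ proj₂ (close f) ⟧ ρ
  solve ρ f = solve-pair ρ (proj₁ (close f)) (proj₂ (close f))

-- Transversals and cardinalities.

module _ {G : FiniteAbelianGroup c ℓ} where
  open FiniteAbelianGroup G using (_≈_; _≟_; elements; complete; setoid; sym; trans)

  -- A transversal of `A`. Three relations are used later: equality, for cardinalities; congruence
  -- modulo `S₁`, for the cosets in `Y`; and congruence up to sign modulo `H`, for the pairs.
  record Representatives (_~_ : Rel (Carrier G) r) (A : Subset G p) (n : ℕ) : Set (c ⊔ p ⊔ r) where
    field
      at           : Fin n → Carrier G
      at∈          : ∀ i → at i ∈ A
      at-injective : ∀ {i j} → at i ~ at j → i ≡ j
      at-onto      : ∀ {x} → x ∈ A → ∃ λ i → x ~ at i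

  -- The index bound has the shape of the definition of `∣_∣`, so `enumeration` is the case of `_≈_`
  -- by computation.
  representatives : ∀ {_~_ : Rel (Carrier G) r} → IsEquivalence _~_ →
    (_~?_ : Binary.Decidable _~_) → (∀ {x y} → x ≈ y → x ~ y) → ∀ (A : Subset G p) →
    Representatives _~_ A (length (deduplicate _~?_ (filter (Subset.dec A) elements)))
  representatives {_~_ = _~_} equiv _~?_ ≈⇒~ A = record
    { at           = List.lookup xs
    ; at∈          = lookup∈ (All.deduplicate⁺ _~?_ (All.all-filter (Subset.dec A) elements))
    ; at-injective = λ {i} {j} → lookup-injective (deduplicate-! ~-decSetoid (filter (Subset.dec A) elements)) i j
    ; at-onto      = λ x∈A → let x∈xs = listed x∈A in Any.index x∈xs , Any.lookup-index x∈xs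
    }
    where
    ~-decSetoid : DecSetoid _ _
    ~-decSetoid = record
      { isDecEquivalence = record { isEquivalence = equiv ; _≟_ = _~?_ } }
    open DecSetoid ~-decSetoid using () renaming (setoid to ~-setoid; sym to ~-sym; trans to ~-trans)
    open import Data.List.Relation.Unary.Unique.DecSetoid ~-decSetoid using (Unique)

    xs : List (Carrier G)
    xs = deduplicate _~?_ (filter (Subset.dec A) elements)

    lookup∈ : ∀ {ys} → All (_∈ A) ys → ∀ i → List.lookup ys i ∈ A
    lookup∈ (y∈A ∷ _)  zero    = y∈A
    lookup∈ (_ ∷ ys∈A) (suc i) = lookup∈ ys∈A i

    lookup≁ : ∀ {y ys} → All (λ z → ¬ (y ~ z)) ys → ∀ i → ¬ (y ~ List.lookup ys i)
    lookup≁ (y≁z ∷ _)  zero    = y≁z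
    lookup≁ (_ ∷ y≁zs) (suc i) = lookup≁ y≁zs i

    lookup-injective : ∀ {ys} → Unique ys → ∀ i j → List.lookup ys i ~ List.lookup ys j → i ≡ j
    lookup-injective (_ ∷ _)     zero    zero    _  = ≡.refl
    lookup-injective (y≁ys ∷ _)  zero    (suc j) eq = contradiction eq (lookup≁ y≁ys j)
    lookup-injective (y≁ys ∷ _)  (suc i) zero    eq = contradiction (~-sym eq) (lookup≁ y≁ys i)
    lookup-injective (_ ∷ ys!)   (suc i) (suc j) eq = ≡.cong suc (lookup-injective ys! i j eq)

    listed : ∀ {x} → x ∈ A → Any.Any (x ~_) xs
    listed {x} x∈A = Membership.∈-deduplicate⁺ ~-setoid _~?_
      (λ y~z w~z → ~-trans w~z (~-sym y~z))
      (Any.map ≈⇒~ (Membership.∈-filter⁺ setoid (Subset.dec A) (Subset.resp A) (complete x) x∈A))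

  enumeration : ∀ (A : Subset G p) → Representatives _≈_ A ∣ A ∣
  enumeration = representatives (Setoid.isEquivalence setoid) _≟_ id

open Representatives

module _ {G : FiniteAbelianGroup c ℓ} {A : Subset G p} where
  open FiniteAbelianGroup G using (_≈_; setoid; sym; trans)

  injective⇒≤ : Representatives _≈_ A n → (f : Fin m → Carrier G) → (∀ i → f i ∈ A) →
    (∀ {i j} → f i ≈ f j → i ≡ j) → m ℕ.≤ n
  injective⇒≤ {n = n} {m = m} as f f∈A f-injective = Fin.injective⇒≤ λ {i} {j} gi≡gj →
    f-injective (trans (f≈ i) (trans (Setoid.reflexive setoid (≡.cong (at as) gi≡gj)) (sym (f≈ j))))
    where
    g : Fin m → Fin n
    g i = proj₁ (at-onto as (f∈A i))
    f≈ : ∀ i → f i ≈ at as (g i)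
    f≈ i = proj₂ (at-onto as (f∈A i))

  card-≥ : (f : Fin n → Carrier G) → (∀ i → f i ∈ A) → (∀ {i j} → f i ≈ f j → i ≡ j) → n ℕ.≤ ∣ A ∣
  card-≥ = injective⇒≤ (enumeration A)

module _ {G : FiniteAbelianGroup c ℓ} {G′ : FiniteAbelianGroup c′ ℓ′} where
  private
    module G  = FiniteAbelianGroup G
    module G′ = FiniteAbelianGroup G′

  injection⇒≤ : {A : Subset G p} {B : Subset G′ q} →
    Representatives G._≈_ A m → Representatives G′._≈_ B n →
    (f : Carrier G → Carrier G′) → (∀ {x} → x ∈ A → f x ∈ B) →
    (∀ {x y} → x ∈ A → y ∈ A → f x G′.≈ f y → x G.≈ y) → m ℕ.≤ n
  injection⇒≤ as bs f f∈ f-injective = injective⇒≤ bs (λ i → f (at as i)) (λ i → f∈ (at∈ as i))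
    (λ {i} {j} eq → at-injective as (f-injective (at∈ as i) (at∈ as j) eq))

  card-injection : (A : Subset G p) (B : Subset G′ q) →
    (f : Carrier G → Carrier G′) → (∀ {x} → x ∈ A → f x ∈ B) →
    (∀ {x y} → x ∈ A → y ∈ A → f x G′.≈ f y → x G.≈ y) → ∣ A ∣ ℕ.≤ ∣ B ∣
  card-injection A B = injection⇒≤ (enumeration A) (enumeration B)

module _ {G : FiniteAbelianGroup c ℓ} where
  open FiniteAbelianGroup G using (_≈_; setoid; sym; trans)

  card-mono : (A : Subset G p) (B : Subset G q) → A ⊆ B → ∣ A ∣ ℕ.≤ ∣ B ∣
  card-mono A B A⊆B = card-injection A B id (A⊆B _) (λ _ _ eq → eq)

  card-cong : (A : Subset G p) (B : Subset G q) → A ≐ B → ∣ A ∣ ≡ ∣ B ∣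
  card-cong A B (A⊆B , B⊆A) = ℕ.≤-antisym (card-mono A B A⊆B) (card-mono B A B⊆A)

  card-unique : (A : Subset G p) → Representatives _≈_ A n → ∣ A ∣ ≡ n
  card-unique A as = ℕ.≤-antisym
    (injection⇒≤ (enumeration A) as id id (λ _ _ eq → eq))
    (injection⇒≤ as (enumeration A) id id (λ _ _ eq → eq))

  nonempty⇒card>0 : (A : Subset G p) → Nonempty A → 0 ℕ.< ∣ A ∣
  nonempty⇒card>0 A (x , x∈A) = ℕ.≤-trans (ℕ.s≤s ℕ.z≤n) (Fin.toℕ<n (proj₁ (at-onto (enumeration A) x∈A)))

  card>0⇒nonempty : (A : Subset G p) → 0 ℕ.< ∣ A ∣ → Nonempty A
  card>0⇒nonempty A 0<∣A∣ = _ , at∈ (enumeration A) (Fin.fromℕ< 0<∣A∣)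

  -- The order of the indices matters later: those of `A` come first. This puts `One`, `Both` and
  -- `Neither` into consecutive blocks, and the parts of `S` before the remaining cosets in `Y`.
  disjoint-representatives : {_~_ : Rel (Carrier G) s} → Binary.Symmetric _~_ →
    {A : Subset G p} {B : Subset G q} → (∀ {x y} → x ∈ A → y ∈ B → ¬ (x ~ y)) →
    Representatives _~_ A m → Representatives _~_ B n → Representatives _~_ (A ∪ B) (m ℕ.+ n)
  disjoint-representatives {m = m} {n = n} {_~_ = _~_} ~-sym {A} {B} disjoint as bs = record
    { at           = at⊎ ∘ splitAt m
    ; at∈          = λ i → at⊎∈ (splitAt m i)
    ; at-injective = λ {i} {j} eq → ≡.trans (≡.sym (Fin.join-splitAt m n i))
        (≡.trans (≡.cong (Fin.join m n) (at⊎-injective (splitAt m i) (splitAt m j) eq))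
          (Fin.join-splitAt m n j))
    ; at-onto      = λ x∈A∪B → let i , eq = at⊎-onto x∈A∪B in
        Fin.join m n i ,
        ≡.subst (λ j → _ ~ at⊎ j) (≡.sym (Fin.splitAt-join m n i)) eq
    }
    where
    at⊎ : Fin m ⊎ Fin n → Carrier G
    at⊎ = [ at as , at bs ]′
    at⊎∈ : ∀ i → at⊎ i ∈ A ∪ B
    at⊎∈ (inj₁ i) = inj₁ (at∈ as i)
    at⊎∈ (inj₂ i) = inj₂ (at∈ bs i)
    at⊎-injective : ∀ i j → at⊎ i ~ at⊎ j → i ≡ j
    at⊎-injective (inj₁ i) (inj₁ j) eq = ≡.cong inj₁ (at-injective as eq)
    at⊎-injective (inj₂ i) (inj₂ j) eq = ≡.cong inj₂ (at-injective bs eq)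
    at⊎-injective (inj₁ i) (inj₂ j) eq = contradiction eq (disjoint (at∈ as i) (at∈ bs j))
    at⊎-injective (inj₂ i) (inj₁ j) eq = contradiction (~-sym eq) (disjoint (at∈ as j) (at∈ bs i))
    at⊎-onto : ∀ {x} → x ∈ A ∪ B → ∃ λ i → x ~ at⊎ i
    at⊎-onto (inj₁ x∈A) = let i , eq = at-onto as x∈A in inj₁ i , eq
    at⊎-onto (inj₂ x∈B) = let i , eq = at-onto bs x∈B in inj₂ i , eq

  card-disjoint-∪ : (A : Subset G p) (B : Subset G q) → Disjoint A B → ∣ A ∪ B ∣ ≡ ∣ A ∣ ℕ.+ ∣ B ∣
  card-disjoint-∪ A B disjoint =
    card-unique (A ∪ B) (disjoint-representatives sym
      (λ x∈A y∈B x≈y → disjoint _ x∈A (Subset.resp B (sym x≈y) y∈B)) (enumeration A) (enumeration B))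

  card-partition : (A : Subset G p) (B : Subset G q) (C : Subset G r) →
    Disjoint B C → A ≐ B ∪ C → ∣ A ∣ ≡ ∣ B ∣ ℕ.+ ∣ C ∣
  card-partition A B C disjoint A≐B∪C = ≡.trans (card-cong A (B ∪ C) A≐B∪C) (card-disjoint-∪ B C disjoint)

  card-split : (A : Subset G p) (B : Subset G q) → ∣ A ∣ ≡ ∣ A ∩ B ∣ ℕ.+ ∣ A ∖ B ∣
  card-split A B = card-partition A (A ∩ B) (A ∖ B) (λ _ (_ , x∈B) (_ , x∉B) → x∉B x∈B)
    ( (λ x x∈A → split x x∈A (Subset.dec B x))
    , (λ { _ (inj₁ (x∈A , _)) → x∈A ; _ (inj₂ (x∈A , _)) → x∈A }) )
    where
    split : ∀ x → x ∈ A → Dec (x ∈ B) → x ∈ (A ∩ B) ∪ (A ∖ B)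
    split x x∈A (yes x∈B) = inj₁ (x∈A , x∈B)
    split x x∈A (no x∉B)  = inj₂ (x∈A , x∉B)

  card-∁ : (A : Subset G p) → order G ≡ ∣ A ∣ ℕ.+ ∣ ∁ A ∣
  card-∁ A = ≡.trans (card-split full A)
    (≡.cong₂ ℕ._+_ (card-cong (full ∩ A) A ((λ _ → proj₂) , (λ _ → tt ,_)))
      (card-cong (full ∖ A) (∁ A) ((λ _ → proj₂) , (λ _ → tt ,_))))

  card-∪-∩ : (A : Subset G p) (B : Subset G q) → ∣ A ∪ B ∣ ℕ.+ ∣ A ∩ B ∣ ≡ ∣ A ∣ ℕ.+ ∣ B ∣
  card-∪-∩ A B = begin
    ∣ A ∪ B ∣ ℕ.+ ∣ A ∩ B ∣
      ≡⟨ ≡.cong₂ ℕ._+_ (card-partition (A ∪ B) A (B ∖ A) (λ _ x∈A (_ , x∉A) → x∉A x∈A) (to , from))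
           (card-cong (A ∩ B) (B ∩ A) ((λ _ (x∈A , x∈B) → x∈B , x∈A) , (λ _ (x∈B , x∈A) → x∈A , x∈B))) ⟩
    ∣ A ∣ ℕ.+ ∣ B ∖ A ∣ ℕ.+ ∣ B ∩ A ∣    ≡⟨ ℕ.+-assoc (∣ A ∣) _ _ ⟩
    ∣ A ∣ ℕ.+ (∣ B ∖ A ∣ ℕ.+ ∣ B ∩ A ∣)  ≡⟨ ≡.cong (∣ A ∣ ℕ.+_) (ℕ.+-comm (∣ B ∖ A ∣) _) ⟩
    ∣ A ∣ ℕ.+ (∣ B ∩ A ∣ ℕ.+ ∣ B ∖ A ∣)  ≡⟨ ≡.cong (∣ A ∣ ℕ.+_) (card-split B A) ⟨
    ∣ A ∣ ℕ.+ ∣ B ∣                      ∎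
    where
    open ≡.≡-Reasoning
    to : A ∪ B ⊆ A ∪ (B ∖ A)
    to x (inj₁ x∈A) = inj₁ x∈A
    to x (inj₂ x∈B) with Subset.dec A x
    ... | yes x∈A = inj₁ x∈A
    ... | no  x∉A = inj₂ (x∈B , x∉A)
    from : A ∪ (B ∖ A) ⊆ A ∪ B
    from x (inj₁ x∈A)       = inj₁ x∈A
    from x (inj₂ (x∈B , _)) = inj₂ x∈B

  -- An element of `B` outside `A` would make `B` strictly larger. Attained bounds are turned into
  -- equalities of sets by this lemma.
  card-≤⇒⊇ : (A : Subset G p) (B : Subset G q) → A ⊆ B → ∣ B ∣ ℕ.≤ ∣ A ∣ → B ⊆ A
  card-≤⇒⊇ A B A⊆B ∣B∣≤∣A∣ x x∈B = decidable-stable (Subset.dec A x) λ x∉A →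
    ℕ.<⇒≱ (ℕ.m<m+n (∣ A ∣) (nonempty⇒card>0 (B ∖ A) (x , x∈B , x∉A)))
      (ℕ.≤-trans (ℕ.≤-reflexive (≡.sym (≡.trans (card-split B A)
        (≡.cong (ℕ._+ ∣ B ∖ A ∣) (card-cong (B ∩ A) A ((λ _ → proj₂) , (λ x x∈A → A⊆B x x∈A , x∈A))))))) ∣B∣≤∣A∣)

  PairwiseDisjoint : (Fin n → Subset G p) → Set (c ⊔ p)
  PairwiseDisjoint U = ∀ i j → i ≢ j → Disjoint (U i) (U j)

  pairwiseDisjoint-suc : (U : Fin (suc n) → Subset G p) → PairwiseDisjoint U → PairwiseDisjoint (U ∘ suc)
  pairwiseDisjoint-suc U disjoint i j i≢j = disjoint (suc i) (suc j) (i≢j ∘ Fin.suc-injective)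

  card-⋃-zero : (U : Fin 0 → Subset G p) → ∣ ⋃ U ∣ ≡ 0
  card-⋃-zero U = ℕ.n≤0⇒n≡0 (ℕ.≮⇒≥ λ 0<∣⋃U∣ → case0 (card>0⇒nonempty (⋃ U) 0<∣⋃U∣))
    where
    case0 : ¬ Nonempty (⋃ U)
    case0 (_ , () , _)

  card-⋃-suc : (U : Fin (suc n) → Subset G p) → PairwiseDisjoint U →
    ∣ ⋃ U ∣ ≡ ∣ U zero ∣ ℕ.+ ∣ ⋃ (U ∘ suc) ∣
  card-⋃-suc U disjoint = card-partition (⋃ U) (U zero) (⋃ (U ∘ suc))
    (λ x x∈U₀ (i , x∈Uᵢ) → disjoint zero (suc i) (λ ()) x x∈U₀ x∈Uᵢ)
    ( (λ { x (zero , x∈U₀) → inj₁ x∈U₀ ; x (suc i , x∈Uᵢ) → inj₂ (i , x∈Uᵢ) })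
    , (λ { x (inj₁ x∈U₀) → zero , x∈U₀ ; x (inj₂ (i , x∈Uᵢ)) → suc i , x∈Uᵢ }) )

  card-⋃-const : (U : Fin n → Subset G p) → PairwiseDisjoint U →
    ∀ {k} → (∀ i → ∣ U i ∣ ≡ k) → ∣ ⋃ U ∣ ≡ n ℕ.* k
  card-⋃-const {n = zero}  U disjoint ∣Uᵢ∣≡k = card-⋃-zero U
  card-⋃-const {n = suc n} U disjoint ∣Uᵢ∣≡k = ≡.trans (card-⋃-suc U disjoint)
    (≡.cong₂ ℕ._+_ (∣Uᵢ∣≡k zero)
      (card-⋃-const (U ∘ suc) (pairwiseDisjoint-suc U disjoint) (∣Uᵢ∣≡k ∘ suc)))

  module _ (k : ℕ) where
    card-⋃-≤ : (U : Fin n → Subset G p) (V : Fin n → Subset G q) →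
      PairwiseDisjoint U → PairwiseDisjoint V → (∀ i → ∣ U i ∣ ℕ.≤ k ℕ.* ∣ V i ∣) →
      ∣ ⋃ U ∣ ℕ.≤ k ℕ.* ∣ ⋃ V ∣
    card-⋃-≤ {n = zero}  U V _ _ _ = ℕ.≤-trans (ℕ.≤-reflexive (card-⋃-zero U)) ℕ.z≤n
    card-⋃-≤ {n = suc n} U V disjointU disjointV U≤V = begin
      ∣ ⋃ U ∣                                        ≡⟨ card-⋃-suc U disjointU ⟩
      ∣ U zero ∣ ℕ.+ ∣ ⋃ (U ∘ suc) ∣                 ≤⟨ ℕ.+-mono-≤ (U≤V zero)
        (card-⋃-≤ (U ∘ suc) (V ∘ suc) (pairwiseDisjoint-suc U disjointU) (pairwiseDisjoint-suc V disjointV)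
          (U≤V ∘ suc)) ⟩
      k ℕ.* ∣ V zero ∣ ℕ.+ k ℕ.* ∣ ⋃ (V ∘ suc) ∣     ≡⟨ ℕ.*-distribˡ-+ k (∣ V zero ∣) _ ⟨
      k ℕ.* (∣ V zero ∣ ℕ.+ ∣ ⋃ (V ∘ suc) ∣)         ≡⟨ ≡.cong (k ℕ.*_) (card-⋃-suc V disjointV) ⟨
      k ℕ.* ∣ ⋃ V ∣                                  ∎
      where open ℕ.≤-Reasoning

    -- If a sum of termwise bounds is attained, so is every single bound. With k = 2 this passes
    -- from the size of all missing sums to the size in each class.
    card-⋃-≡ : (U : Fin n → Subset G p) (V : Fin n → Subset G q) →
      PairwiseDisjoint U → PairwiseDisjoint V → (∀ i → ∣ U i ∣ ℕ.≤ k ℕ.* ∣ V i ∣) →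
      k ℕ.* ∣ ⋃ V ∣ ℕ.≤ ∣ ⋃ U ∣ → ∀ i → ∣ U i ∣ ≡ k ℕ.* ∣ V i ∣
    card-⋃-≡ {n = suc n} U V disjointU disjointV U≤V V≤U = λ where
        zero    → ℕ.≤-antisym (U≤V zero) (ℕ.+-cancelʳ-≤ _ _ _ (ℕ.≤-trans total (ℕ.+-monoʳ-≤ _ rest≤)))
        (suc i) → card-⋃-≡ (U ∘ suc) (V ∘ suc) (pairwiseDisjoint-suc U disjointU)
          (pairwiseDisjoint-suc V disjointV) (U≤V ∘ suc)
          (ℕ.+-cancelˡ-≤ _ _ _ (ℕ.≤-trans total (ℕ.+-monoˡ-≤ _ (U≤V zero)))) i
      where
      rest≤ : ∣ ⋃ (U ∘ suc) ∣ ℕ.≤ k ℕ.* ∣ ⋃ (V ∘ suc) ∣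
      rest≤ = card-⋃-≤ (U ∘ suc) (V ∘ suc) (pairwiseDisjoint-suc U disjointU)
        (pairwiseDisjoint-suc V disjointV) (U≤V ∘ suc)
      total : k ℕ.* ∣ V zero ∣ ℕ.+ k ℕ.* ∣ ⋃ (V ∘ suc) ∣ ℕ.≤ ∣ U zero ∣ ℕ.+ ∣ ⋃ (U ∘ suc) ∣
      total = begin
        k ℕ.* ∣ V zero ∣ ℕ.+ k ℕ.* ∣ ⋃ (V ∘ suc) ∣   ≡⟨ ℕ.*-distribˡ-+ k (∣ V zero ∣) _ ⟨
        k ℕ.* (∣ V zero ∣ ℕ.+ ∣ ⋃ (V ∘ suc) ∣)       ≡⟨ ≡.cong (k ℕ.*_) (card-⋃-suc V disjointV) ⟨
        k ℕ.* ∣ ⋃ V ∣                                ≤⟨ V≤U ⟩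
        ∣ ⋃ U ∣                                      ≡⟨ card-⋃-suc U disjointU ⟩
        ∣ U zero ∣ ℕ.+ ∣ ⋃ (U ∘ suc) ∣               ∎
        where open ℕ.≤-Reasoning

module _ {G : FiniteAbelianGroup c ℓ} {G′ : FiniteAbelianGroup c′ ℓ′} where
  private
    module G  = FiniteAbelianGroup G
    module G′ = FiniteAbelianGroup G′

  card-preimage : (f : Func G.setoid G′.setoid) (T : Subset G′ p) (k : ℕ) →
    (∀ t → t ∈ T → ∣ preimage {G = G} {G′} f ｛ t ｝ ∣ ≡ k) → ∣ preimage {G = G} {G′} f T ∣ ≡ ∣ T ∣ ℕ.* k
  card-preimage f T k ∣fibre∣≡k = ≡.trans
    (card-cong (preimage {G = G} {G′} f T) (⋃ fibre)
      ((λ _ fx∈T → at-onto′ fx∈T) , (λ _ (i , eq) → Subset.resp T eq (at∈ ts i))))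
    (card-⋃-const fibre
      (λ i j i≢j x eqᵢ eqⱼ → i≢j (at-injective ts (G′.trans eqᵢ (G′.sym eqⱼ))))
      (λ i → ∣fibre∣≡k _ (at∈ ts i)))
    where
    ts : Representatives G′._≈_ T ∣ T ∣
    ts = enumeration T
    fibre : Fin (∣ T ∣) → Subset G _
    fibre i = preimage {G = G} {G′} f ｛ at ts i ｝
    at-onto′ : ∀ {y} → y ∈ T → ∃ λ i → at ts i G′.≈ y
    at-onto′ y∈T = let i , eq = at-onto ts y∈T in i , G′.sym eq

-- Doubling, halves and critical sums.

module _ {G : FiniteAbelianGroup c ℓ} where
  open FiniteAbelianGroup G
    using (_≈_; _+_; -_; _-_; _≟_; elements; complete; setoid; sym; trans; refl
          ; +-cong; +-congˡ; +-congʳ; -‿cong; abelianGroup)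
  open AbelianGroupSolver abelianGroup using (solve)

  affine : Carrier G → Func setoid setoid
  affine z = record { to = λ x → z + (x + x) ; cong = λ eq → +-congˡ (+-cong eq eq) }

  translation : Carrier G → Func setoid setoid
  translation z = record { to = z +_ ; cong = +-congˡ }

  reflection : Carrier G → Func setoid setoid
  reflection z = record { to = λ x → z - x ; cong = λ eq → +-congˡ (-‿cong eq) }

  affinePreimage : Carrier G → Subset G p → Subset G p
  affinePreimage z T = preimage {G = G} {G} (affine z) T

  -- { x : 2x - z ∈ S }
  halves : Subset G p → Carrier G → Subset G p
  halves S z = affinePreimage (- z) S

  shift reflect : Carrier G → Subset G p → Subset G p
  shift z D   = preimage {G = G} {G} (translation z) D
  reflect z B = preimage {G = G} {G} (reflection z) B

  card-reflect : (z : Carrier G) (B : Subset G p) → ∣ reflect z B ∣ ≡ ∣ B ∣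
  card-reflect z B = ℕ.≤-antisym
    (card-injection (reflect z B) B (λ x → z - x) id (λ _ _ → injective))
    (card-injection B (reflect z B) (λ x → z - x)
      (λ {x} → Subset.resp B (sym (involutive x))) (λ _ _ → injective))
    where
    involutive : ∀ x → z - (z - x) ≈ x
    involutive x = solve (z ∷ x ∷ []) (λ z x → z ⊟⊟ (z ⊟⊟ x) ⊜ x) ≡.refl
    injective : ∀ {x y} → z - x ≈ z - y → x ≈ y
    injective {x} {y} eq = trans (sym (involutive x)) (trans (+-congˡ (-‿cong eq)) (involutive y))

  card-shift : (z : Carrier G) (D : Subset G p) → ∣ shift z D ∣ ≡ ∣ D ∣
  card-shift z D = ℕ.≤-antisym
    (card-injection (shift z D) D (z +_) id
      (λ {x} {y} _ _ eq → trans (sym (cancel x)) (trans (+-congʳ eq) (cancel y))))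
    (card-injection D (shift z D) (_- z)
      (λ {x} → Subset.resp D (solve (z ∷ x ∷ []) (λ z x → x ⊜ z ⊞ (x ⊟⊟ z)) ≡.refl))
      (λ {x} {y} _ _ eq → trans (cancel′ x) (trans (+-congʳ eq) (sym (cancel′ y)))))
    where
    cancel : ∀ x → (z + x) - z ≈ x
    cancel x = solve (z ∷ x ∷ []) (λ z x → (z ⊞ x) ⊟⊟ z ⊜ x) ≡.refl
    cancel′ : ∀ x → x ≈ (x - z) + z
    cancel′ x = solve (z ∷ x ∷ []) (λ z x → x ⊜ (x ⊟⊟ z) ⊞ z) ≡.refl

  -- Each non-empty fibre of x ↦ z + 2x is a coset of `K G`. The surjectivity hypothesis is the
  -- reason for cutting `S` into classes modulo `2·G` before counting.
  card-affinePreimage : (z : Carrier G) (T : Subset G p) →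
    (∀ {t} → t ∈ T → ∃ λ x → z + (x + x) ≈ t) →
    ∣ affinePreimage z T ∣ ≡ ∣ T ∣ ℕ.* ∣ K G ∣
  card-affinePreimage z T onto = card-preimage {G = G} {G} (affine z) T (∣ K G ∣) λ t t∈T → fibre t (onto t∈T)
    where
    fibre : ∀ t → (∃ λ x → z + (x + x) ≈ t) → ∣ affinePreimage z ｛ t ｝ ∣ ≡ ∣ K G ∣
    fibre t (w , z+2w≈t) = ≡.trans
      (card-cong (affinePreimage z ｛ t ｝) (shift (- w) (K G)) (to , from))
      (card-shift (- w) (K G))
      where
      to : affinePreimage z ｛ t ｝ ⊆ shift (- w) (K G)
      to x t≈z+2x = trans
        (solve (z ∷ w ∷ x ∷ [])
          (λ z w x → (⊟ w ⊞ x) ⊞ (⊟ w ⊞ x) ⊜ (z ⊞ (x ⊞ x)) ⊟⊟ (z ⊞ (w ⊞ w))) ≡.refl)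
        (trans (+-cong (sym t≈z+2x) (-‿cong z+2w≈t))
          (solve (t ∷ []) (λ t → t ⊟⊟ t ⊜ 𝟎) ≡.refl))
      from : shift (- w) (K G) ⊆ affinePreimage z ｛ t ｝
      from x eq = sym (trans
        (solve (z ∷ w ∷ x ∷ [])
          (λ z w x → z ⊞ (x ⊞ x) ⊜ ((⊟ w ⊞ x) ⊞ (⊟ w ⊞ x)) ⊞ (z ⊞ (w ⊞ w))) ≡.refl)
        (trans (+-cong eq z+2w≈t) (solve (t ∷ []) (λ t → 𝟎 ⊞ t ⊜ t) ≡.refl)))

  -- Repeats the set counted by `L[_]_` field by field, so that the two cardinalities agree by
  -- computation.
  solutions : Subset G p → Carrier G → Subset (G ×ᴳ G) (ℓ ⊔ p)
  solutions S z = record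
    { Mem  = λ (x , y) → x + y ≈ z × x - y ∈ S
    ; resp = λ (x≈x′ , y≈y′) (eq , x-y∈S) →
        trans (sym (+-cong x≈x′ y≈y′)) eq , Subset.resp S (+-cong x≈x′ (-‿cong y≈y′)) x-y∈S
    ; dec  = λ (x , y) → ((x + y) ≟ z) ×-dec Subset.dec S (x - y)
    }

  -- A solution is determined by x: then y = z - x and x - y = 2x - z.
  L≡card-halves : (S : Subset G p) (z : Carrier G) → L[ S ] z ≡ ∣ halves S z ∣
  L≡card-halves S z = ℕ.≤-antisym
    (card-injection (solutions S z) (halves S z) proj₁
      (λ {(x , y)} (x+y≈z , x-y∈S) → Subset.resp S
        (trans (solve (x ∷ y ∷ []) (λ x y → x ⊟⊟ y ⊜ ⊟ (x ⊞ y) ⊞ (x ⊞ x)) ≡.refl)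
          (+-congʳ (-‿cong x+y≈z))) x-y∈S)
      (λ {(x , y)} {(x′ , y′)} (eq , _) (eq′ , _) x≈x′ → x≈x′ ,
        trans (solve (x ∷ y ∷ []) (λ x y → y ⊜ (x ⊞ y) ⊟⊟ x) ≡.refl)
          (trans (+-cong (trans eq (sym eq′)) (-‿cong x≈x′))
            (solve (x′ ∷ y′ ∷ []) (λ x y → (x ⊞ y) ⊟⊟ x ⊜ y) ≡.refl))))
    (card-injection (halves S z) (solutions S z) (λ x → x , z - x)
      (λ {x} 2x-z∈S → solve (x ∷ z ∷ []) (λ x z → x ⊞ (z ⊟⊟ x) ⊜ z) ≡.refl ,
        Subset.resp S (solve (x ∷ z ∷ []) (λ x z → ⊟ z ⊞ (x ⊞ x) ⊜ x ⊟⊟ (z ⊟⊟ x)) ≡.refl) 2x-z∈S)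
      (λ _ _ → proj₁))

  -- The maximum runs over the listed entries only, so z is first replaced by an equal entry of the
  -- list.
  card-halves≤maxL : (S : Subset G p) (z : Carrier G) → ∣ halves S z ∣ ℕ.≤ maxL S
  card-halves≤maxL S z = ℕ.≤-trans (ℕ.≤-reflexive same) (bound (complete z))
    where
    z₀ = Any.lookup (complete z)
    z≈z₀ : z ≈ z₀
    z≈z₀ = Any.lookup-result (complete z)
    same : ∣ halves S z ∣ ≡ L[ S ] z₀
    same = ≡.trans (card-cong (halves S z) (halves S z₀)
      ( (λ x → Subset.resp S (+-congʳ (-‿cong z≈z₀)))
      , (λ x → Subset.resp S (+-congʳ (-‿cong (sym z≈z₀)))) )) (≡.sym (L≡card-halves S z₀))
    bound : ∀ (i : Any.Any (z ≈_) elements) → L[ S ] (Any.lookup i) ℕ.≤ maxL S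
    bound i = All.lookupAny (All.map⁻ (xs≤max 0 (List.map (L[ S ]_) elements))) i .proj₁

  -- `A` and z - B cover the group and meet exactly in `D`. `D` is a bare predicate so that one
  -- condition can be read both in `G` and in a quotient, which has the same carrier but another
  -- type of subsets.
  record Critical (A : Subset G p) (B : Subset G q) (D : Pred (Carrier G) r) (z : Carrier G) :
                  Set (c ⊔ p ⊔ q ⊔ r) where
    field
      cover : ∀ x → x ∈ A ⊎ z - x ∈ B
      meet  : ∀ {x} → x ∈ A → z - x ∈ B → D x
      left  : ∀ {x} → D x → x ∈ A
      right : ∀ {x} → D x → z - x ∈ B

  module _ (A : Subset G p) (B : Subset G q) (S : Subset G r)
           (large : ∣ A ∣ ℕ.+ ∣ B ∣ ≡ order G ℕ.+ maxL S)
           {z : Carrier G} (z∉ : z ∉ A ∧[ S ] B) where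
    private
      N = reflect z B
      D = halves S z

      meet : (A ∩ N) ⊆ D
      meet x (x∈A , z-x∈B) = Subset.resp S
        (solve (x ∷ z ∷ []) (λ x z → x ⊟⊟ (z ⊟⊟ x) ⊜ ⊟ z ⊞ (x ⊞ x)) ≡.refl)
        (decidable-stable (Subset.dec S _) λ x-[z-x]∉S → z∉
          (x , z - x , x∈A , z-x∈B , x-[z-x]∉S ,
            solve (x ∷ z ∷ []) (λ x z → x ⊞ (z ⊟⊟ x) ⊜ z) ≡.refl))

      union+meet : ∣ A ∪ N ∣ ℕ.+ ∣ A ∩ N ∣ ≡ order G ℕ.+ maxL S
      union+meet = ≡.trans (card-∪-∩ A N)
        (≡.trans (≡.cong (∣ A ∣ ℕ.+_) (card-reflect z B)) large)

      union≤ : ∣ A ∪ N ∣ ℕ.≤ order G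
      union≤ = card-mono (A ∪ N) full (λ _ _ → tt)

      meet≤ : ∣ A ∩ N ∣ ℕ.≤ ∣ D ∣
      meet≤ = card-mono (A ∩ N) D meet

      maxL≤meet : maxL S ℕ.≤ ∣ A ∩ N ∣
      maxL≤meet = ℕ.+-cancelˡ-≤ (order G) _ _
        (ℕ.≤-trans (ℕ.≤-reflexive (≡.sym union+meet)) (ℕ.+-monoˡ-≤ _ union≤))

      full⊆union : full ⊆ A ∪ N
      full⊆union = card-≤⇒⊇ (A ∪ N) full (λ _ _ → tt) (ℕ.+-cancelʳ-≤ (maxL S) _ _
        (ℕ.≤-trans (ℕ.≤-reflexive (≡.sym union+meet))
          (ℕ.+-monoʳ-≤ _ (ℕ.≤-trans meet≤ (card-halves≤maxL S z)))))

      D⊆meet : D ⊆ A ∩ N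
      D⊆meet = card-≤⇒⊇ (A ∩ N) D meet (ℕ.≤-trans (card-halves≤maxL S z) maxL≤meet)

    -- By inclusion and exclusion |A ∪ N| + |A ∩ N| = |G| + L_S. Here |A ∪ N| is at most |G|, and |A
    -- ∩ N| is at most |D|, hence at most L_S. All these bounds are therefore attained.
    unrepresented⇒critical : Critical A B (_∈ halves S z) z
    unrepresented⇒critical = record
      { cover = λ x → full⊆union x tt
      ; meet  = λ x∈A z-x∈B → meet _ (x∈A , z-x∈B)
      ; left  = λ x∈D → D⊆meet _ x∈D .proj₁
      ; right = λ x∈D → D⊆meet _ x∈D .proj₂
      }

    card-halves≡maxL : ∣ halves S z ∣ ≡ maxL S
    card-halves≡maxL = ℕ.≤-antisym (card-halves≤maxL S z) (ℕ.≤-trans maxL≤meet meet≤)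

  -- With N = z₀ - B and D = halves S z₀, all z₀ + 2w for w ∈ X are critical sums.
  record CriticalShifts (A : Subset G p) (N : Subset G q) (D : Subset G r) (X : Subset G s) :
                        Set (c ⊔ p ⊔ q ⊔ r ⊔ s) where
    field
      0∈X   : 0# G ∈ X
      cover : ∀ {w} x → w ∈ X → x + (w + w) ∈ A ⊎ x ∈ N
      meet  : ∀ {w x} → w ∈ X → x + (w + w) ∈ A → x ∈ N → x + w ∈ D
      left  : ∀ {w x} → w ∈ X → x ∈ D → x + w ∈ A
      right : ∀ {w x} → w ∈ X → x ∈ D → x - w ∈ N

  -- Take z = z₀ + 2w and replace x by x + 2w: then z - x becomes z₀ - x, which is why `N` does not
  -- depend on w. The halves of z₀ + 2w are w + D.
  critical⇒shifts : (A : Subset G p) (B : Subset G q) (S : Subset G r) (X : Subset G s) (z₀ : Carrier G) →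
    0# G ∈ X →
    (∀ {w} → w ∈ X → Critical A B (_∈ halves S (z₀ + (w + w))) (z₀ + (w + w))) →
    CriticalShifts A (reflect z₀ B) (halves S z₀) X
  critical⇒shifts A B S X z₀ 0∈X critical = record
    { 0∈X   = 0∈X
    ; cover = λ {w} x w∈X → [ inj₁ , (λ x∈B → inj₂ (Subset.resp B (≈N w x) x∈B)) ]′
        (cover (critical w∈X) (x + (w + w)))
    ; meet  = λ {w} {x} w∈X x∈A x∈N → Subset.resp S
        (solve (z₀ ∷ w ∷ x ∷ []) (λ z w x →
          ⊟ (z ⊞ (w ⊞ w)) ⊞ ((x ⊞ (w ⊞ w)) ⊞ (x ⊞ (w ⊞ w))) ⊜ ⊟ z ⊞ ((x ⊞ w) ⊞ (x ⊞ w))) ≡.refl)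
        (meet (critical w∈X) x∈A (Subset.resp B (sym (≈N w x)) x∈N))
    ; left  = λ {w} {x} w∈X x∈D → left (critical w∈X) (Subset.resp S (≈D w x) x∈D)
    ; right = λ {w} {x} w∈X x∈D → Subset.resp B
        (solve (z₀ ∷ w ∷ x ∷ []) (λ z w x → (z ⊞ (w ⊞ w)) ⊟⊟ (x ⊞ w) ⊜ z ⊟⊟ (x ⊟⊟ w)) ≡.refl)
        (right (critical w∈X) (Subset.resp S (≈D w x) x∈D))
    }
    where
    open Critical
    ≈N : ∀ w x → (z₀ + (w + w)) - (x + (w + w)) ≈ z₀ - x
    ≈N w x = solve (z₀ ∷ w ∷ x ∷ []) (λ z w x → (z ⊞ (w ⊞ w)) ⊟⊟ (x ⊞ (w ⊞ w)) ⊜ z ⊟⊟ x) ≡.refl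
    ≈D : ∀ w x → - z₀ + (x + x) ≈ - (z₀ + (w + w)) + ((x + w) + (x + w))
    ≈D w x = solve (z₀ ∷ w ∷ x ∷ []) (λ z w x →
      ⊟ z ⊞ (x ⊞ x) ⊜ ⊟ (z ⊞ (w ⊞ w)) ⊞ ((x ⊞ w) ⊞ (x ⊞ w))) ≡.refl

  -- The bound |X| ≤ 2|D| and its equality case.

  module _ (A : Subset G p) (N : Subset G q) (D : Subset G r) (X : Subset G s)
           (shifts : CriticalShifts A N D X) where
    open CriticalShifts shifts
    private
      x+0+0≈x : ∀ x → x + (0# G + 0# G) ≈ x
      x+0+0≈x x = solve (x ∷ []) (λ x → x ⊞ (𝟎 ⊞ 𝟎) ⊜ x) ≡.refl

      x+0≈x : ∀ x → x + 0# G ≈ x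
      x+0≈x x = solve (x ∷ []) (λ x → x ⊞ 𝟎 ⊜ x) ≡.refl

      cover₀ : ∀ x → x ∈ A ⊎ x ∈ N
      cover₀ x = [ inj₁ ∘ Subset.resp A (x+0+0≈x x) , inj₂ ]′ (cover x 0∈X)

    meet₀ : ∀ {x} → x ∈ A → x ∈ N → x ∈ D
    meet₀ {x} x∈A x∈N = Subset.resp D (x+0≈x x) (meet 0∈X (Subset.resp A (sym (x+0+0≈x x)) x∈A) x∈N)

    left₀ : ∀ {x} → x ∈ D → x ∈ A
    left₀ {x} x∈D = Subset.resp A (x+0≈x x) (left 0∈X x∈D)

    right₀ : ∀ {x} → x ∈ D → x ∈ N
    right₀ {x} x∈D = Subset.resp N (solve (x ∷ []) (λ x → x ⊟⊟ 𝟎 ⊜ x) ≡.refl) (right 0∈X x∈D)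

    private
      -- Since d is in `N`, having d + 2w in `A` would let `meet` put the midpoint d + w into `D`.
      exit : ∀ {d w} → d ∈ D → w ∈ X → d + w ∉ D → d + (w + w) ∉ A
      exit d∈D w∈X d+w∉D d+2w∈A = d+w∉D (meet w∈X d+2w∈A (right₀ d∈D))

    -- The four translates d + w + 2w′, d - w + 2w′, d + w and d - w are tested in turn.
    exits-close : ∀ {d v w} → d ∈ D → v ∈ X → w ∈ X → d + v ∉ D → d + w ∉ D → (d + w) - v ∈ D
    exits-close {d} {v} {w} d∈D v∈X w∈X d+v∉D d+w∉D =
      Subset.resp D (solve (d ∷ v ∷ w ∷ []) (λ d v w → (d ⊟⊟ v) ⊞ w ⊜ (d ⊞ w) ⊟⊟ v) ≡.refl)
        (meet w∈X [d-v]+2w∈A (right v∈X d∈D))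
      where
      [d+v]+2w∈A : (d + v) + (w + w) ∈ A
      [d+v]+2w∈A = [ id , (λ d+v∈N → contradiction (meet₀ (left v∈X d∈D) d+v∈N) d+v∉D) ]′
        (cover (d + v) w∈X)
      [d-v]+2w∉N : (d - v) + (w + w) ∉ N
      [d-v]+2w∉N y∈N = exit d∈D w∈X d+w∉D (Subset.resp A
        (solve (d ∷ v ∷ w ∷ []) (λ d v w → ((d ⊟⊟ v) ⊞ (w ⊞ w)) ⊞ v ⊜ d ⊞ (w ⊞ w)) ≡.refl)
        (left₀ (meet v∈X (Subset.resp A
          (solve (d ∷ v ∷ w ∷ []) (λ d v w →
            (d ⊞ v) ⊞ (w ⊞ w) ⊜ ((d ⊟⊟ v) ⊞ (w ⊞ w)) ⊞ (v ⊞ v)) ≡.refl) [d+v]+2w∈A) y∈N)))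
      [d-v]+2w∈A : (d - v) + (w + w) ∈ A
      [d-v]+2w∈A = [ id , (λ y∈N → contradiction y∈N [d-v]+2w∉N) ]′ (cover₀ _)

    -- The shift w puts d + w into `A`, the shift -w puts it into `N`, and `A` and `N` meet in `D`.
    stable : ∀ {d w} → d ∈ D → w ∈ X → - w ∈ X → d + w ∈ D
    stable {d} {w} d∈D w∈X -w∈X = meet₀ (left w∈X d∈D) (Subset.resp N
      (solve (d ∷ w ∷ []) (λ d w → d ⊟⊟ (⊟ w) ⊜ d ⊞ w) ≡.refl) (right -w∈X d∈D))

    private
      inside≤ : ∀ d → ∣ X ∩ shift d D ∣ ℕ.≤ ∣ D ∣
      inside≤ d = ℕ.≤-trans (card-mono (X ∩ shift d D) (shift d D) (λ _ → proj₂))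
        (ℕ.≤-reflexive (card-shift d D))

      -- Fix one element v of the set as a base point; by `exits-close`, w ↦ d + w - v is an
      -- injection into `D`.
      outside≤ : ∀ {d} → d ∈ D → ∣ X ∖ shift d D ∣ ℕ.≤ ∣ D ∣
      outside≤ {d} d∈D with 1 ℕ.≤? ∣ X ∖ shift d D ∣
      ... | no  ∣out∣≱1 = ℕ.≤-trans (ℕ.≤-pred (ℕ.≰⇒> ∣out∣≱1)) ℕ.z≤n
      ... | yes ∣out∣≥1 = let v , v∈X , d+v∉D = card>0⇒nonempty (X ∖ shift d D) ∣out∣≥1 in
        card-injection (X ∖ shift d D) D (λ w → (d + w) - v)
          (λ (w∈X , d+w∉D) → exits-close d∈D v∈X w∈X d+v∉D d+w∉D)
          (λ {w} {w′} _ _ eq → trans (sym (cancel v w)) (trans (+-congʳ eq) (cancel v w′)))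
        where
        cancel : ∀ v w → ((d + w) - v) + (v - d) ≈ w
        cancel v w = solve (d ∷ v ∷ w ∷ []) (λ d v w → ((d ⊞ w) ⊟⊟ v) ⊞ (v ⊟⊟ d) ⊜ w) ≡.refl

    card-shifts≤ : Nonempty D → ∣ X ∣ ℕ.≤ 2 ℕ.* ∣ D ∣
    card-shifts≤ (d , d∈D) = begin
      ∣ X ∣                                          ≡⟨ card-split X (shift d D) ⟩
      ∣ X ∩ shift d D ∣ ℕ.+ ∣ X ∖ shift d D ∣        ≤⟨ ℕ.+-mono-≤ (inside≤ d) (outside≤ d∈D) ⟩
      ∣ D ∣ ℕ.+ ∣ D ∣                                ≡⟨ ≡.cong (∣ D ∣ ℕ.+_) (ℕ.+-identityʳ _) ⟨
      2 ℕ.* ∣ D ∣                                    ∎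
      where open ℕ.≤-Reasoning

    module _ (extremal : ∣ X ∣ ≡ 2 ℕ.* ∣ D ∣) where
      private
        total : ∀ d → ∣ D ∣ ℕ.+ ∣ D ∣ ≡ ∣ X ∩ shift d D ∣ ℕ.+ ∣ X ∖ shift d D ∣
        total d = ≡.trans (≡.cong (∣ D ∣ ℕ.+_) (≡.sym (ℕ.+-identityʳ _)))
          (≡.trans (≡.sym extremal) (card-split X (shift d D)))

      -- The outer piece has at most |D| of the 2|D| elements of `X`, so the inner piece fills the
      -- whole translate D - d.
      differences⊆X : ∀ {d e} → d ∈ D → e ∈ D → e - d ∈ X
      differences⊆X {d} {e} d∈D e∈D = card-≤⇒⊇ (X ∩ shift d D) (shift d D) (λ _ → proj₂)
        (ℕ.≤-trans (ℕ.≤-reflexive (card-shift d D)) (ℕ.+-cancelʳ-≤ (∣ D ∣) _ _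
          (ℕ.≤-trans (ℕ.≤-reflexive (total d)) (ℕ.+-monoʳ-≤ _ (outside≤ d∈D)))))
        (e - d) (Subset.resp D (solve (d ∷ e ∷ []) (λ d e → e ⊜ d ⊞ (e ⊟⊟ d)) ≡.refl) e∈D)
        .proj₁

      difference-stable : ∀ {d e f} → d ∈ D → e ∈ D → f ∈ D → f + (e - d) ∈ D
      difference-stable {d} {e} d∈D e∈D f∈D = stable f∈D (differences⊆X d∈D e∈D)
        (Subset.resp X (solve (d ∷ e ∷ []) (λ d e → d ⊟⊟ e ⊜ ⊟ (e ⊟⊟ d)) ≡.refl) (differences⊆X e∈D d∈D))

      -- At most |D| of the 2|D| elements of `X` carry d into `D`. For d = 0 the element found here
      -- becomes the b of the pair structure.
      exit-exists : ∀ {d} → d ∈ D → ∃ λ w → w ∈ X × d + w ∉ D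
      exit-exists {d} d∈D = card>0⇒nonempty (X ∖ shift d D)
        (ℕ.≤-trans (nonempty⇒card>0 D (d , d∈D)) (ℕ.+-cancelˡ-≤ (∣ D ∣) _ _
          (ℕ.≤-trans (ℕ.≤-reflexive (total d)) (ℕ.+-monoˡ-≤ _ (inside≤ d)))))

-- Parity, cyclic subgroups, and the subgroup K + ⟨2b⟩.

parity : ∀ n → (∃ λ k → n ≡ k ℕ.+ k) ⊎ (∃ λ k → n ≡ suc (k ℕ.+ k))
parity zero = inj₁ (0 , ≡.refl)
parity (suc n) with parity n
... | inj₁ (k , n≡2k)   = inj₂ (k , ≡.cong suc n≡2k)
... | inj₂ (k , n≡1+2k) = inj₁ (suc k , ≡.trans (≡.cong suc n≡1+2k) (≡.cong suc (≡.sym (ℕ.+-suc k k))))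

2∣k+k : ∀ k → 2 ∣ k ℕ.+ k
2∣k+k k = divides k (≡.trans (≡.cong (k ℕ.+_) (≡.sym (ℕ.+-identityʳ k))) (ℕ.*-comm 2 k))

2∤n⇒n≡1+2k : ∀ n → 2 ∤ n → ∃ λ k → n ≡ suc (k ℕ.+ k)
2∤n⇒n≡1+2k n 2∤n with parity n
... | inj₁ (k , ≡.refl) = contradiction (2∣k+k k) 2∤n
... | inj₂ odd          = odd

2∤1+2k : ∀ k → 2 ∤ suc (k ℕ.+ k)
2∤1+2k k 2∣1+2k with ∣m+n∣m⇒∣n {m = k ℕ.+ k} (≡.subst (2 ∣_) (≡.sym (ℕ.+-comm (k ℕ.+ k) 1)) 2∣1+2k) (2∣k+k k)
... | divides zero    ()
... | divides (suc q) ()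

module _ {G : FiniteAbelianGroup c ℓ} where
  open FiniteAbelianGroup G
    using (_≈_; _+_; -_; _-_; _≟_; elements; complete; setoid; sym; trans; refl
          ; +-cong; +-congˡ; +-congʳ; +-identityʳ; -‿cong; abelianGroup; monoid; commutativeMonoid
          ; _·_; _·ᶻ_)
  open MonoidMult monoid using (×-congˡ; ×-congʳ; ×-homo-+; ×-assocˡ)
  open CommutativeMonoidMult commutativeMonoid using (×-distrib-+)
  open AbelianGroupProperties abelianGroup using (∙-cancelˡ; inverseʳ-unique)
  open AbelianGroupSolver abelianGroup using (solve)

  cyclic : Carrier G → Subset G ℓ
  cyclic g = ⟨ g ⟩

  IsOrder : Carrier G → ℕ → Set ℓ
  IsOrder g n = 0 ℕ.< n × n · g ≈ 0# G × (∀ {i} → i ℕ.< n → i · g ≈ 0# G → i ≡ 0)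

  ·-difference : ∀ g {i j} → i ℕ.≤ j → i · g ≈ j · g → (j ℕ.∸ i) · g ≈ 0# G
  ·-difference g {i} {j} i≤j eq = sym (∙-cancelˡ (i · g) _ _ (trans (+-identityʳ _) (trans eq
    (trans (×-congˡ (≡.sym (ℕ.m+[n∸m]≡n i≤j))) (×-homo-+ g i (j ℕ.∸ i))))))

  ·-zeroʳ : ∀ n → n · 0# G ≈ 0# G
  ·-zeroʳ zero    = refl
  ·-zeroʳ (suc n) = trans (+-congˡ (·-zeroʳ n)) (+-identityʳ _)

  private
    some-period : ∀ g → ∃ λ n → 0 ℕ.< n × n · g ≈ 0# G
    some-period g
      with i , j , i<j , eq ← Fin.pigeonhole (ℕ.n<1+n (length elements)) (λ i → Any.index (complete (toℕ i · g)))
      = toℕ j ℕ.∸ toℕ i , ℕ.m<n⇒0<n∸m i<j ,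
        ·-difference g (ℕ.<⇒≤ i<j) (Membership.index-injective setoid (complete _) (complete _) eq)

    least-period : ∀ g n → 0 ℕ.< n × n · g ≈ 0# G → ∃ (IsOrder g)
    least-period g = <-rec _ λ n smaller (0<n , ng≈0) → go n smaller 0<n ng≈0
      (ℕ.anyUpTo? (λ i → (1 ℕ.≤? i) ×-dec ((i · g) ≟ 0# G)) n)
      where
      go : ∀ n → (∀ {i} → i ℕ.< n → 0 ℕ.< i × i · g ≈ 0# G → ∃ (IsOrder g)) → 0 ℕ.< n → n · g ≈ 0# G →
        Dec (∃ λ i → i ℕ.< n × 0 ℕ.< i × i · g ≈ 0# G) → ∃ (IsOrder g)
      go n smaller 0<n ng≈0 (yes (i , i<n , rest)) = smaller i<n rest
      go n smaller 0<n ng≈0 (no none) = n , 0<n , ng≈0 , minimal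
        where
        minimal : ∀ {i} → i ℕ.< n → i · g ≈ 0# G → i ≡ 0
        minimal {zero}  _   _    = ≡.refl
        minimal {suc i} i<n ig≈0 = contradiction (suc i , i<n , ℕ.s≤s ℕ.z≤n , ig≈0) none

  module _ (g : Carrier G) {n : ℕ} (ord : IsOrder g n) where
    private
      0<n  = proj₁ ord
      ng≈0 = proj₁ (proj₂ ord)

    order-injective : ∀ {i j} → i ℕ.< n → j ℕ.< n → i · g ≈ j · g → i ≡ j
    order-injective {i} {j} i<n j<n eq = ℕ.≤-antisym (≤-of j i i<n (sym eq)) (≤-of i j j<n eq)
      where
      ≤-of : ∀ i j → j ℕ.< n → i · g ≈ j · g → j ℕ.≤ i
      ≤-of i j j<n eq with ℕ.≤-total j i
      ... | inj₁ j≤i = j≤i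
      ... | inj₂ i≤j = ℕ.m∸n≡0⇒m≤n (proj₂ (proj₂ ord) (ℕ.≤-<-trans (ℕ.m∸n≤m j i) j<n) (·-difference g i≤j eq))

    private
      remainder : ∀ i → ∃ λ j → j ℕ.< n × i · g ≈ j · g
      remainder i = i ℕ.% n , m%n<n i n , (begin
        i · g                                   ≈⟨ ×-congˡ (m≡m%n+[m/n]*n i n) ⟩
        (i ℕ.% n ℕ.+ i ℕ./ n ℕ.* n) · g         ≈⟨ ×-homo-+ g (i ℕ.% n) _ ⟩
        (i ℕ.% n) · g + (i ℕ./ n ℕ.* n) · g     ≈⟨ +-congˡ (×-assocˡ g (i ℕ./ n) n) ⟨
        (i ℕ.% n) · g + (i ℕ./ n) · (n · g)     ≈⟨ +-congˡ (trans (×-congʳ (i ℕ./ n) ng≈0) (·-zeroʳ (i ℕ./ n))) ⟩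
        (i ℕ.% n) · g + 0# G                    ≈⟨ +-identityʳ _ ⟩
        (i ℕ.% n) · g                           ∎)
        where
        instance _ = ℕ.>-nonZero 0<n
        open SetoidReasoning setoid

      negation : ∀ {j} → j ℕ.< n → ∃ λ k → k ℕ.< n × - (j · g) ≈ k · g
      negation {j} j<n = let k , k<n , eq = remainder (n ℕ.∸ j) in k , k<n , trans
        (sym (inverseʳ-unique (j · g) ((n ℕ.∸ j) · g) (trans (sym (×-homo-+ g j (n ℕ.∸ j)))
          (trans (×-congˡ (ℕ.m+[n∸m]≡n (ℕ.<⇒≤ j<n))) ng≈0)))) eq

      below-order : ∀ i → ∃ λ j → j ℕ.< n × i ·ᶻ g ≈ j · g
      below-order (ℤ.+ i)    = remainder i
      below-order ℤ.-[1+ i ] =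
        let j , j<n , eq = remainder (suc i) ; k , k<n , eq′ = negation j<n in k , k<n , trans (-‿cong eq) eq′

    order-representatives : Representatives _≈_ (cyclic g) n
    order-representatives = record
      { at           = λ i → toℕ i · g
      ; at∈          = λ i → ℤ.+ toℕ i , refl
      ; at-injective = λ {i} {j} eq → Fin.toℕ-injective (order-injective (Fin.toℕ<n i) (Fin.toℕ<n j) eq)
      ; at-onto      = λ (i , ig≈x) → let j , j<n , eq = below-order i in
          Fin.fromℕ< j<n , trans (sym ig≈x) (trans eq (×-congˡ (≡.sym (Fin.toℕ-fromℕ< j<n))))
      }

  cyclic-order : ∀ g → IsOrder g (∣ cyclic g ∣)
  cyclic-order g =
    let n , 0<n , ng≈0 = some-period g ; m , ord = least-period g n (0<n , ng≈0) in
    ≡.subst (IsOrder g) (≡.sym (card-unique (cyclic g) (order-representatives g ord))) ord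

  cyclic-onto : ∀ g {x} → x ∈ cyclic g → ∃ λ i → i ℕ.< ∣ cyclic g ∣ × x ≈ i · g
  cyclic-onto g x∈⟨g⟩ = let i , eq = at-onto (order-representatives g (cyclic-order g)) x∈⟨g⟩ in
    toℕ i , Fin.toℕ<n i , eq

  ·∈⟨_⟩ : ∀ g i → i · g ∈ cyclic g
  ·∈⟨ g ⟩ i = ℤ.+ i , refl

  +-·-inverse : ∀ g {i} → i ℕ.≤ ∣ cyclic g ∣ → - (i · g) ≈ (∣ cyclic g ∣ ℕ.∸ i) · g
  +-·-inverse g {i} i≤d = sym (inverseʳ-unique _ _ (trans (sym (×-homo-+ g i _))
    (trans (×-congˡ (ℕ.m+[n∸m]≡n i≤d)) (proj₁ (proj₂ (cyclic-order g))))))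

  cyclic-isSubgroup : ∀ g → IsSubgroup (cyclic g)
  cyclic-isSubgroup g = record
    { 0∈       = ℤ.+ 0 , refl
    ; +-closed = λ x∈ y∈ → let i , _ , x≈ig = cyclic-onto g x∈ ; j , _ , y≈jg = cyclic-onto g y∈ in
        ℤ.+ (i ℕ.+ j) , trans (×-homo-+ g i j) (sym (+-cong x≈ig y≈jg))
    ; -‿closed = λ x∈ → let i , i<d , x≈ig = cyclic-onto g x∈ in
        ℤ.+ (∣ cyclic g ∣ ℕ.∸ i) , trans (sym (+-·-inverse g (ℕ.<⇒≤ i<d))) (-‿cong (sym x≈ig))
    }

  K-isSubgroup : IsSubgroup (K G)
  K-isSubgroup = record
    { 0∈       = +-identityʳ _
    ; +-closed = λ {x} {y} 2x≈0 2y≈0 → trans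
        (solve (x ∷ y ∷ []) (λ x y → (x ⊞ y) ⊞ (x ⊞ y) ⊜ (x ⊞ x) ⊞ (y ⊞ y)) ≡.refl)
        (trans (+-cong 2x≈0 2y≈0) (+-identityʳ _))
    ; -‿closed = λ {x} 2x≈0 → trans
        (solve (x ∷ []) (λ x → (⊟ x) ⊞ (⊟ x) ⊜ ⊟ (x ⊞ x)) ≡.refl)
        (trans (-‿cong 2x≈0) (solve [] (⊟ 𝟎 ⊜ 𝟎) ≡.refl))
    }

  ⊕-isSubgroup : {U : Subset G p} {V : Subset G q} → IsSubgroup U → IsSubgroup V → IsSubgroup (U ⊕ V)
  ⊕-isSubgroup U≤G V≤G = record
    { 0∈       = 0# G , 0# G , U.0∈ , V.0∈ , +-identityʳ _
    ; +-closed = λ {x} {y} (u , v , u∈U , v∈V , eq) (u′ , v′ , u′∈U , v′∈V , eq′) →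
        u + u′ , v + v′ , U.+-closed u∈U u′∈U , V.+-closed v∈V v′∈V ,
        trans (solve (u ∷ u′ ∷ v ∷ v′ ∷ [])
          (λ u u′ v v′ → (u ⊞ u′) ⊞ (v ⊞ v′) ⊜ (u ⊞ v) ⊞ (u′ ⊞ v′)) ≡.refl) (+-cong eq eq′)
    ; -‿closed = λ (u , v , u∈U , v∈V , eq) → - u , - v , U.-‿closed u∈U , V.-‿closed v∈V ,
        trans (solve (u ∷ v ∷ []) (λ u v → ⊟ u ⊞ ⊟ v ⊜ ⊟ (u ⊞ v)) ≡.refl) (-‿cong eq)
    }
    where
    module U = IsSubgroup U≤G
    module V = IsSubgroup V≤G

  module _ {U : Subset G p} (U≤G : IsSubgroup U) where
    open IsSubgroup U≤G

    -‿∈ : ∀ {x y} → x ∈ U → y ∈ U → x - y ∈ U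
    -‿∈ x∈U y∈U = +-closed x∈U (-‿closed y∈U)

    cancel-∈ʳ : ∀ {x y} → x ∈ U → y + x ∈ U → y ∈ U
    cancel-∈ʳ {x} {y} x∈U y+x∈U = Subset.resp U
      (solve (x ∷ y ∷ []) (λ x y → (y ⊞ x) ⊟⊟ x ⊜ y) ≡.refl) (-‿∈ y+x∈U x∈U)

    ·-∈ : ∀ {x} n → x ∈ U → n · x ∈ U
    ·-∈ zero    x∈U = 0∈
    ·-∈ (suc n) x∈U = +-closed x∈U (·-∈ n x∈U)

  ∈-⊕ˡ : {U : Subset G p} {V : Subset G q} → IsSubgroup V → ∀ {x} → x ∈ U → x ∈ U ⊕ V
  ∈-⊕ˡ V≤G {x} x∈U = x , 0# G , x∈U , IsSubgroup.0∈ V≤G , +-identityʳ x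

  ∈-⊕ʳ : {U : Subset G p} {V : Subset G q} → IsSubgroup U → ∀ {x} → x ∈ V → x ∈ U ⊕ V
  ∈-⊕ʳ U≤G {x} x∈V = 0# G , x , IsSubgroup.0∈ U≤G , x∈V , solve (x ∷ []) (λ x → 𝟎 ⊞ x ⊜ x) ≡.refl

  ∈-coset⁺ : (U : Subset G p) → ∀ {x y} → y - x ∈ U → y ∈ ｛ x ｝ ⊕ U
  ∈-coset⁺ U {x} {y} y-x∈U = x , y - x , refl , y-x∈U , solve (x ∷ y ∷ []) (λ x y → x ⊞ (y ⊟⊟ x) ⊜ y) ≡.refl

  ∈-coset⁻ : (U : Subset G p) → ∀ {x y} → y ∈ ｛ x ｝ ⊕ U → y - x ∈ U
  ∈-coset⁻ U {x} {y} (a , u , x≈a , u∈U , a+u≈y) = Subset.resp U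
    (trans (solve (a ∷ u ∷ []) (λ a u → u ⊜ (a ⊞ u) ⊟⊟ a) ≡.refl) (+-cong a+u≈y (-‿cong (sym x≈a)))) u∈U

  card-coset : ∀ x (U : Subset G p) → ∣ ｛ x ｝ ⊕ U ∣ ≡ ∣ U ∣
  card-coset x U = ≡.trans
    (card-cong (｛ x ｝ ⊕ U) (shift (- x) U)
      ( (λ y y∈ → Subset.resp U (≈-comm y) (∈-coset⁻ U y∈))
      , (λ y y∈ → ∈-coset⁺ U (Subset.resp U (sym (≈-comm y)) y∈)) ))
    (card-shift (- x) U)
    where
    ≈-comm : ∀ y → y - x ≈ - x + y
    ≈-comm y = solve (x ∷ y ∷ []) (λ x y → y ⊟⊟ x ⊜ ⊟ x ⊞ y) ≡.refl

  module Doubling (b : Carrier G) where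
    H : Subset G ℓ
    H = cyclic (b + b)

    d : ℕ
    d = ∣ H ∣

    KH : Subset G _
    KH = K G ⊕ H

    K≤G : IsSubgroup (K G)
    K≤G = K-isSubgroup

    H≤G : IsSubgroup H
    H≤G = cyclic-isSubgroup (b + b)

    KH≤G : IsSubgroup KH
    KH≤G = ⊕-isSubgroup K≤G H≤G

    module K  = IsSubgroup K≤G
    module H  = IsSubgroup H≤G
    module KH = IsSubgroup KH≤G

    K⊆KH : ∀ {x} → x ∈ K G → x ∈ KH
    K⊆KH = ∈-⊕ˡ {U = K G} {V = H} H≤G

    H⊆KH : ∀ {x} → x ∈ H → x ∈ KH
    H⊆KH = ∈-⊕ʳ {U = K G} {V = H} K≤G

    H-onto : ∀ {h} → h ∈ H → ∃ λ i → i ℕ.< d × h ≈ i · (b + b)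
    H-onto = cyclic-onto (b + b)

    multiple∈H : ∀ i → i · (b + b) ∈ H
    multiple∈H = ·∈⟨ b + b ⟩

    0<d : 0 ℕ.< d
    0<d = proj₁ (cyclic-order (b + b))

    d·2b≈0 : d · (b + b) ≈ 0# G
    d·2b≈0 = proj₁ (proj₂ (cyclic-order (b + b)))

    ·2b-injective : ∀ {i j} → i ℕ.< d → j ℕ.< d → i · (b + b) ≈ j · (b + b) → i ≡ j
    ·2b-injective = order-injective (b + b) (cyclic-order (b + b))

    ·-double : ∀ i → i · (b + b) ≈ (i ℕ.+ i) · b
    ·-double i = trans (×-distrib-+ b b i) (sym (×-homo-+ b i i))

    ·b∈K⇒≡0 : ∀ {i} → i ℕ.< d → i · b ∈ K G → i ≡ 0
    ·b∈K⇒≡0 {i} i<d ib∈K = proj₂ (proj₂ (cyclic-order (b + b))) i<d (trans (×-distrib-+ b b i) ib∈K)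

    ·b∉K : ∀ {i} → 0 ℕ.< i → i ℕ.< d → i · b ∉ K G
    ·b∉K 0<i i<d ib∈K = ℕ.<⇒≢ 0<i (≡.sym (·b∈K⇒≡0 i<d ib∈K))

    d·b∈K : d · b ∈ K G
    d·b∈K = trans (sym (×-distrib-+ b b d)) d·2b≈0

    ·b-≢ : ∀ {i j} → i ℕ.< d → j ℕ.< d → i · b - j · b ∈ K G → i ≡ j
    ·b-≢ {i} {j} i<d j<d ib-jb∈K = ·2b-injective i<d j<d (begin
      i · (b + b)                                      ≈⟨ ×-distrib-+ b b i ⟩
      i · b + i · b                                    ≈⟨ solve (i · b ∷ j · b ∷ [])
        (λ x y → x ⊞ x ⊜ ((x ⊟⊟ y) ⊞ (x ⊟⊟ y)) ⊞ (y ⊞ y)) ≡.refl ⟩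
      ((i · b - j · b) + (i · b - j · b)) + (j · b + j · b)
                                                       ≈⟨ +-congʳ ib-jb∈K ⟩
      0# G + (j · b + j · b)                           ≈⟨ solve (j · b ∷ []) (λ y → 𝟎 ⊞ (y ⊞ y) ⊜ y ⊞ y) ≡.refl ⟩
      j · b + j · b                                    ≈⟨ ×-distrib-+ b b j ⟨
      j · (b + b)                                      ∎)
      where open SetoidReasoning setoid

    KH-onto : ∀ {x} → x ∈ KH → ∃₂ λ κ i → κ ∈ K G × i ℕ.< d × x ≈ κ + (i ℕ.+ i) · b
    KH-onto (κ , h , κ∈K , h∈H , κ+h≈x) = let i , i<d , h≈ = H-onto h∈H in
      κ , i , κ∈K , i<d , trans (sym κ+h≈x) (+-congˡ (trans h≈ (·-double i)))

    module _ (d-odd : 2 ∤ d) where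
      -- With d = 2e + 1, b = d·b - e·2b, and d·b is in `K G` because its double is d·2b = 0.
      b∈KH : b ∈ KH
      b∈KH = let e , d≡1+2e = 2∤n⇒n≡1+2k d d-odd in Subset.resp KH
        (begin
          d · b - e · (b + b)                    ≈⟨ +-cong (×-congˡ d≡1+2e) (-‿cong (·-double e)) ⟩
          (b + (e ℕ.+ e) · b) - (e ℕ.+ e) · b    ≈⟨ solve (b ∷ (e ℕ.+ e) · b ∷ [])
                                                    (λ b x → (b ⊞ x) ⊟⊟ x ⊜ b) ≡.refl ⟩
          b                                      ∎)
        (-‿∈ KH≤G (K⊆KH d·b∈K) (H⊆KH (multiple∈H e)))
        where open SetoidReasoning setoid

      -- If 2x = i·2b, then x - i·b is in `K G`, and i·b is in `KH` because b is. Thus `KH` is the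
      -- full preimage of `H` under doubling.
      double∈H⇒∈KH : ∀ {x} → x + x ∈ H → x ∈ KH
      double∈H⇒∈KH {x} 2x∈H = let i , _ , 2x≈ = H-onto 2x∈H in Subset.resp KH
        (solve (x ∷ i · b ∷ []) (λ x y → (x ⊟⊟ y) ⊞ y ⊜ x) ≡.refl)
        (KH.+-closed (K⊆KH (trans
          (solve (x ∷ i · b ∷ []) (λ x y → (x ⊟⊟ y) ⊞ (x ⊟⊟ y) ⊜ (x ⊞ x) ⊟⊟ (y ⊞ y)) ≡.refl)
          (trans (+-congʳ (trans 2x≈ (×-distrib-+ b b i)))
            (solve (i · b ∷ []) (λ y → (y ⊞ y) ⊟⊟ (y ⊞ y) ⊜ 𝟎) ≡.refl))))
          (·-∈ KH≤G i b∈KH))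

      card-KH : ∣ KH ∣ ≡ d ℕ.* ∣ K G ∣
      card-KH = ≡.trans (card-cong KH (affinePreimage (0# G) H) (to , from))
        (card-affinePreimage (0# G) H λ t∈H → let i , _ , t≈ = H-onto t∈H in
          i · b , trans (0+ _) (sym (trans t≈ (×-distrib-+ b b i))))
        where
        0+ : ∀ x → 0# G + x ≈ x
        0+ x = solve (x ∷ []) (λ x → 𝟎 ⊞ x ⊜ x) ≡.refl
        to : KH ⊆ affinePreimage (0# G) H
        to x (κ , h , κ∈K , h∈H , κ+h≈x) = Subset.resp H
          (trans (trans (sym (0+ (h + h))) (+-congʳ (sym κ∈K)))
            (trans (solve (κ ∷ h ∷ []) (λ κ h → (κ ⊞ κ) ⊞ (h ⊞ h) ⊜ 𝟎 ⊞ ((κ ⊞ h) ⊞ (κ ⊞ h))) ≡.refl)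
              (+-congˡ (+-cong κ+h≈x κ+h≈x))))
          (H.+-closed h∈H h∈H)
        from : affinePreimage (0# G) H ⊆ KH
        from x 2x∈H = double∈H⇒∈KH (Subset.resp H (0+ (x + x)) 2x∈H)

-- A view of an index in three consecutive blocks; matching on it replaces case distinctions at the
-- thresholds k and k + u.
data Third {k u v : ℕ} : Fin (k ℕ.+ (u ℕ.+ v)) → Set where
  first  : (i : Fin k) → Third (i ↑ˡ (u ℕ.+ v))
  second : (i : Fin u) → Third (k ↑ʳ (i ↑ˡ v))
  third  : (i : Fin v) → Third (k ↑ʳ (u ↑ʳ i))

third? : ∀ k u v i → Third {k} {u} {v} i
third? k u v i with splitAt k i in eq
... | inj₁ j = ≡.subst (Third {k} {u} {v}) (Fin.splitAt⁻¹-↑ˡ eq) (first j)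
... | inj₂ j with splitAt u j in eq′
...   | inj₁ j′ = ≡.subst (Third {k} {u} {v})
  (≡.trans (≡.cong (k ↑ʳ_) (Fin.splitAt⁻¹-↑ˡ eq′)) (Fin.splitAt⁻¹-↑ʳ eq)) (second j′)
...   | inj₂ j′ = ≡.subst (Third {k} {u} {v})
  (≡.trans (≡.cong (k ↑ʳ_) (Fin.splitAt⁻¹-↑ʳ eq′)) (Fin.splitAt⁻¹-↑ʳ eq)) (third j′)

-- Sets with the critical sums 0 and 2b: multiples of b, and stability elsewhere.

module _ {G : FiniteAbelianGroup c ℓ} where
  open FiniteAbelianGroup G
    using (_≈_; _+_; -_; _-_; sym; trans; refl; +-congˡ; +-congʳ; +-comm; +-identityˡ; +-identityʳ
          ; -‿cong; abelianGroup; monoid; _·_)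
  open MonoidMult monoid using (×-congˡ; ×-homo-+)
  open AbelianGroupSolver abelianGroup using (solve)

  -- Transfers each one-sided statement about `A` to `B`. The reflection x ↦ z - x that exchanges
  -- the two sides also moves `D`, hence the symmetry required of `D`.
  critical-swap : {A : Subset G p} {B : Subset G q} (D : Subset G r) {z : Carrier G} →
    (∀ {x} → x ∈ D → z - x ∈ D) → Critical A B (_∈ D) z → Critical B A (_∈ D) z
  critical-swap {A = A} {B} D {z} D-symmetric critical = record
    { cover = λ x → [ inj₂ , inj₁ ∘ Subset.resp B (involutive x) ]′ (cover (z - x))
    ; meet  = λ {x} x∈B z-x∈A → Subset.resp D (involutive x)
        (D-symmetric (meet z-x∈A (Subset.resp B (sym (involutive x)) x∈B)))
    ; left  = λ {x} x∈D → Subset.resp B (involutive x) (right (D-symmetric x∈D))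
    ; right = λ x∈D → left (D-symmetric x∈D)
    }
    where
    open Critical critical
    involutive : ∀ x → z - (z - x) ≈ x
    involutive x = solve (z ∷ x ∷ []) (λ z x → z ⊟⊟ (z ⊟⊟ x) ⊜ x) ≡.refl

  module Multiples (b : Carrier G) where
    open Doubling {G = G} b public

    E₀ E : Subset G _
    E₀ = ｛_｝ {G = G} (0# G) ∪ oddMultiples {G = G} b d
    E  = E₀ ⊕ K G

    K⊆E : ∀ {κ} → κ ∈ K G → κ ∈ E
    K⊆E {κ} κ∈K = 0# G , κ , inj₁ refl , κ∈K , +-identityˡ κ

    odd∈E : ∀ {j κ} → j ℕ.≤ d ℕ.∸ 2 → 2 ∤ j → κ ∈ K G → j · b + κ ∈ E
    odd∈E {j} j≤d-2 2∤j κ∈K = _ , _ , inj₂ (j , j≤d-2 , 2∤j , refl) , κ∈K , refl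

    -- Modulo K, an even multiple of b past d·b is an odd one below it.
    wrap∈E : 2 ∤ d → ∀ {i κ} → i ℕ.< d → d ℕ.< i ℕ.+ i → κ ∈ K G → κ + (i ℕ.+ i) · b ∈ E
    wrap∈E d-odd {i} {κ} i<d d<2i κ∈K = Subset.resp E eq
      (odd∈E {i ℕ.+ i ℕ.∸ d} j≤d-2 2∤j (K.+-closed κ∈K d·b∈K))
      where
      d+j≡2i : d ℕ.+ (i ℕ.+ i ℕ.∸ d) ≡ i ℕ.+ i
      d+j≡2i = ℕ.m+[n∸m]≡n (ℕ.<⇒≤ d<2i)
      2∤j : 2 ∤ (i ℕ.+ i ℕ.∸ d)
      2∤j 2∣j = d-odd (∣m+n∣m⇒∣n (≡.subst (2 ∣_) (≡.trans (≡.sym d+j≡2i) (ℕ.+-comm d _)) (2∣k+k i)) 2∣j)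
      j≤d-2 : i ℕ.+ i ℕ.∸ d ℕ.≤ d ℕ.∸ 2
      j≤d-2 = begin
        i ℕ.+ i ℕ.∸ d                   ≡⟨ ≡.cong (λ k → k ℕ.∸ 1 ℕ.∸ d) (ℕ.+-suc i i) ⟨
        suc i ℕ.+ suc i ℕ.∸ 2 ℕ.∸ d     ≤⟨ ℕ.∸-monoˡ-≤ d (ℕ.∸-monoˡ-≤ 2 (ℕ.+-mono-≤ i<d i<d)) ⟩
        d ℕ.+ d ℕ.∸ 2 ℕ.∸ d             ≡⟨ ℕ.∸-+-assoc (d ℕ.+ d) 2 d ⟩
        d ℕ.+ d ℕ.∸ (2 ℕ.+ d)           ≡⟨ ≡.cong (d ℕ.+ d ℕ.∸_) (ℕ.+-comm 2 d) ⟩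
        d ℕ.+ d ℕ.∸ (d ℕ.+ 2)           ≡⟨ ℕ.∸-+-assoc (d ℕ.+ d) d 2 ⟨
        d ℕ.+ d ℕ.∸ d ℕ.∸ 2             ≡⟨ ≡.cong (ℕ._∸ 2) (ℕ.m+n∸n≡m d d) ⟩
        d ℕ.∸ 2                         ∎
        where open ℕ.≤-Reasoning
      eq : (i ℕ.+ i ℕ.∸ d) · b + (κ + d · b) ≈ κ + (i ℕ.+ i) · b
      eq = trans
        (solve ((i ℕ.+ i ℕ.∸ d) · b ∷ κ ∷ d · b ∷ []) (λ x κ y → x ⊞ (κ ⊞ y) ⊜ κ ⊞ (y ⊞ x)) ≡.refl)
        (+-congˡ (trans (sym (×-homo-+ b d (i ℕ.+ i ℕ.∸ d))) (×-congˡ d+j≡2i)))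

    E⊆KH : 2 ∤ d → ∀ {x} → x ∈ E → x ∈ KH
    E⊆KH d-odd (e , κ , e∈ , κ∈K , e+κ≈x) = Subset.resp KH e+κ≈x (KH.+-closed (e∈KH e∈) (K⊆KH κ∈K))
      where
      e∈KH : ∀ {e} → e ∈ E₀ → e ∈ KH
      e∈KH (inj₁ 0≈e)                = Subset.resp KH 0≈e KH.0∈
      e∈KH (inj₂ (j , _ , _ , jb≈e)) = Subset.resp KH jb≈e (·-∈ KH≤G j (b∈KH d-odd))

    -- Modulo `K G` the multiples j·b with j < d are distinct, and 2i is neither 0 nor odd. For odd
    -- d, this and `wrap∈E` settle membership in `E` for every non-zero even multiple.
    even∉E : ∀ {i κ} → 0 ℕ.< i → i ℕ.+ i ℕ.< d → κ ∈ K G → κ + (i ℕ.+ i) · b ∉ E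
    even∉E {i} {κ} 0<i 2i<d κ∈K (e , κ′ , e∈ , κ′∈K , e+κ′≈x) = go e∈
      where
      2ib-e∈K : (i ℕ.+ i) · b - e ∈ K G
      2ib-e∈K = Subset.resp (K G)
        (trans (solve (e ∷ κ ∷ κ′ ∷ []) (λ e κ κ′ → κ′ ⊟⊟ κ ⊜ ((e ⊞ κ′) ⊟⊟ κ) ⊟⊟ e) ≡.refl)
          (+-congʳ (trans (+-congʳ e+κ′≈x)
            (solve (κ ∷ (i ℕ.+ i) · b ∷ []) (λ κ y → (κ ⊞ y) ⊟⊟ κ ⊜ y) ≡.refl))))
        (-‿∈ K≤G κ′∈K κ∈K)
      go : e ∉ E₀
      go (inj₁ 0≈e) = ·b∉K (ℕ.<-≤-trans 0<i (ℕ.m≤m+n i i)) 2i<d (Subset.resp (K G)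
        (trans (+-congˡ (-‿cong (sym 0≈e))) (solve ((i ℕ.+ i) · b ∷ []) (λ x → x ⊟⊟ 𝟎 ⊜ x) ≡.refl)) 2ib-e∈K)
      go (inj₂ (j , j≤d-2 , 2∤j , jb≈e)) = 2∤j (≡.subst (2 ∣_) (·b-≢ 2i<d
        (ℕ.≤-<-trans j≤d-2 (ℕ.∸-monoʳ-< {o = 0} (ℕ.s≤s ℕ.z≤n)
          (ℕ.≤-trans (ℕ.≤-trans (ℕ.+-mono-≤ 0<i 0<i) (ℕ.n≤1+n _)) 2i<d)))
        (Subset.resp (K G) (+-congˡ (-‿cong (sym jb≈e))) 2ib-e∈K)) (2∣k+k i))

  module OneSide (A : Subset G p) (B : Subset G q) (b : Carrier G)
                 (critical₀ : Critical A B (_∈ K G) (0# G))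
                 (critical₁ : Critical A B (_∈ shift (- b) (K G)) (b + b))
                 (b∉K : b ∉ K G) where
    open Multiples b
    private
      module C₀ = Critical critical₀
      module C₁ = Critical critical₁

    -- The element -x = 2b - (x + 2b) is tested by both critical sums: by 0 against x, and by 2b
    -- against x + 2b.
    leave : ∀ {x} → x ∉ A → x + b ∉ K G → x + (b + b) ∉ A
    leave {x} x∉A x+b∉K x+2b∈A with C₀.cover x
    ... | inj₁ x∈A  = x∉A x∈A
    ... | inj₂ -x∈B = x+b∉K (Subset.resp (K G)
      (solve (b ∷ x ∷ []) (λ b x → ⊟ b ⊞ (x ⊞ (b ⊞ b)) ⊜ x ⊞ b) ≡.refl)
      (C₁.meet x+2b∈A (Subset.resp B
        (solve (b ∷ x ∷ []) (λ b x → 𝟎 ⊟⊟ x ⊜ (b ⊞ b) ⊟⊟ (x ⊞ (b ⊞ b))) ≡.refl) -x∈B)))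

    stay : ∀ {x} → x ∈ A → x ∉ K G → x + (b + b) ∈ A
    stay {x} x∈A x∉K with C₁.cover (x + (b + b))
    ... | inj₁ x+2b∈A = x+2b∈A
    ... | inj₂ -x∈B = contradiction (C₀.meet x∈A (Subset.resp B
      (solve (b ∷ x ∷ []) (λ b x → (b ⊞ b) ⊟⊟ (x ⊞ (b ⊞ b)) ⊜ 𝟎 ⊟⊟ x) ≡.refl) -x∈B)) x∉K

    private
      suc+suc : ∀ κ n → κ + (suc n ℕ.+ suc n) · b ≈ (κ + (n ℕ.+ n) · b) + (b + b)
      suc+suc κ n = trans (+-congˡ (×-congˡ (≡.cong suc (ℕ.+-suc n n))))
        (solve (κ ∷ b ∷ (n ℕ.+ n) · b ∷ []) (λ κ b x → κ ⊞ (b ⊞ (b ⊞ x)) ⊜ (κ ⊞ x) ⊞ (b ⊞ b)) ≡.refl)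

    -- The walk from 2b + K goes on as long as the midpoints, odd multiples of b below d, stay
    -- outside `K G`. The bound includes an even multiple equal to d, the case that `d-odd` refutes.
    even∉A : ∀ {κ} j → suc j ℕ.+ suc j ℕ.≤ d → κ ∈ K G → κ + (suc j ℕ.+ suc j) · b ∉ A
    -- As κ is in `K G`, -κ = 2b - (κ + 2b) is in `B`; so κ + 2b in `A` would lie in b + K, which
    -- gives b in `K G`.
    even∉A {κ} zero _ κ∈K x∈A = b∉K (cancel-∈ʳ K≤G κ∈K (Subset.resp (K G)
      (solve (b ∷ κ ∷ []) (λ b κ → ⊟ b ⊞ (κ ⊞ (b ⊞ (b ⊞ 𝟎))) ⊜ b ⊞ κ) ≡.refl)
      (C₁.meet x∈A (Subset.resp B
        (solve (b ∷ κ ∷ []) (λ b κ → 𝟎 ⊟⊟ κ ⊜ (b ⊞ b) ⊟⊟ (κ ⊞ (b ⊞ (b ⊞ 𝟎)))) ≡.refl)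
        (C₀.right κ∈K)))))
    even∉A {κ} (suc j) 2j≤d κ∈K x∈A =
      leave (even∉A j (ℕ.≤-trans (ℕ.n≤1+n _) (ℕ.<⇒≤ 2j+1<d)) κ∈K)
        (λ y∈K → ·b∉K (ℕ.s≤s ℕ.z≤n) 2j+1<d (cancel-∈ʳ K≤G κ∈K (Subset.resp (K G)
          (solve (b ∷ κ ∷ (suc j ℕ.+ suc j) · b ∷ []) (λ b κ x → (κ ⊞ x) ⊞ b ⊜ (b ⊞ x) ⊞ κ) ≡.refl) y∈K)))
        (Subset.resp A (suc+suc κ (suc j)) x∈A)
      where
      2j+1<d : suc (suc j ℕ.+ suc j) ℕ.< d
      2j+1<d = ℕ.≤-trans (ℕ.≤-reflexive (≡.cong suc (≡.sym (ℕ.+-suc (suc j) (suc j))))) 2j≤d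

    odd∈A : ∀ {κ} j → suc (j ℕ.+ j) ℕ.≤ d → κ ∈ K G → κ + suc (j ℕ.+ j) · b ∈ A
    odd∈A {κ} zero    _      κ∈K = C₁.left (Subset.resp (K G)
      (solve (b ∷ κ ∷ []) (λ b κ → κ ⊜ ⊟ b ⊞ (κ ⊞ (b ⊞ 𝟎))) ≡.refl) κ∈K)
    odd∈A {κ} (suc j) 2j+1≤d κ∈K = Subset.resp A
      (trans (solve (b ∷ κ ∷ (j ℕ.+ j) · b ∷ [])
        (λ b κ x → (κ ⊞ (b ⊞ x)) ⊞ (b ⊞ b) ⊜ (b ⊞ κ ⊞ x) ⊞ (b ⊞ b)) ≡.refl)
        (trans (sym (suc+suc (b + κ) j))
          (solve (b ∷ κ ∷ (suc j ℕ.+ suc j) · b ∷ []) (λ b κ x → (b ⊞ κ) ⊞ x ⊜ κ ⊞ (b ⊞ x)) ≡.refl)))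
      (stay (odd∈A j (ℕ.<⇒≤ 2j+1<d) κ∈K) (λ x∈K → ·b∉K (ℕ.s≤s ℕ.z≤n) 2j+1<d
        (cancel-∈ʳ K≤G κ∈K (Subset.resp (K G) (+-comm κ _) x∈K))))
      where
      2j+1<d : suc (j ℕ.+ j) ℕ.< d
      2j+1<d = ℕ.≤-trans (ℕ.≤-reflexive (≡.cong suc (≡.sym (ℕ.+-suc j j)))) (ℕ.≤-trans (ℕ.n≤1+n _) 2j+1≤d)

    -- d·b lies in `K G`, hence in `A`, whereas for even d the walk along even multiples excludes it
    -- from `A`.
    d-odd : 2 ∤ d
    d-odd with parity d
    ... | inj₁ (zero  , d≡0)  = contradiction (≡.sym d≡0) (ℕ.<⇒≢ 0<d)
    ... | inj₁ (suc j , d≡2j) = contradiction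
      (C₀.left (Subset.resp (K G) (trans (×-congˡ d≡2j) (sym (+-identityˡ _))) d·b∈K))
      (even∉A j (ℕ.≤-reflexive (≡.sym d≡2j)) K.0∈)
    ... | inj₂ (e , d≡1+2e)   = ≡.subst (2 ∤_) (≡.sym d≡1+2e) (2∤1+2k e)

    1<d : 1 ℕ.< d
    1<d = ℕ.≤∧≢⇒< 0<d λ 1≡d → b∉K (Subset.resp (K G)
      (trans (×-congˡ (≡.sym 1≡d)) (+-identityʳ b)) d·b∈K)

    E⊆A : ∀ {x} → x ∈ E → x ∈ A
    E⊆A (e , κ , e∈ , κ∈K , e+κ≈x) = Subset.resp A e+κ≈x (e+κ∈A e∈)
      where
      e+κ∈A : e ∈ E₀ → e + κ ∈ A
      e+κ∈A (inj₁ 0≈e) = Subset.resp A (trans (sym (+-identityˡ κ)) (+-congʳ 0≈e)) (C₀.left κ∈K)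
      e+κ∈A (inj₂ (j , j≤d-2 , 2∤j , jb≈e)) = let k , j≡1+2k = 2∤n⇒n≡1+2k j 2∤j in
        Subset.resp A (trans (+-comm κ _) (+-congʳ (trans (×-congˡ (≡.sym j≡1+2k)) jb≈e)))
          (odd∈A k (ℕ.≤-trans (ℕ.≤-reflexive (≡.sym j≡1+2k)) (ℕ.≤-trans j≤d-2 (ℕ.m∸n≤m d 2))) κ∈K)

    A∩KH⊆E : ∀ {x} → x ∈ A → x ∈ KH → x ∈ E
    A∩KH⊆E {x} x∈A x∈KH = let κ , i , κ∈K , i<d , x≈ = KH-onto x∈KH in go i κ∈K i<d x≈
      where
      go : ∀ {κ} i → κ ∈ K G → i ℕ.< d → x ≈ κ + (i ℕ.+ i) · b → x ∈ E
      go zero    κ∈K _   x≈ = Subset.resp E (trans (sym (+-identityʳ _)) (sym x≈)) (K⊆E κ∈K)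
      go (suc i) κ∈K i<d x≈ =
        [ (λ 2i≤d → contradiction (Subset.resp A x≈ x∈A) (even∉A i 2i≤d κ∈K))
        , (λ d<2i → Subset.resp E (sym x≈) (wrap∈E d-odd i<d d<2i κ∈K))
        ]′ (ℕ.≤-<-connex (suc i ℕ.+ suc i) d)

    -- Starting outside `KH`, steps of 2b never meet `K G`, so `stay` applies each time.
    outside-stable : ∀ {x h} → x ∉ KH → x ∈ A → h ∈ H → x + h ∈ A
    outside-stable {x} {h} x∉KH x∈A h∈H =
      let i , _ , h≈ = H-onto h∈H in Subset.resp A (+-congˡ (sym h≈)) (go i)
      where
      go : ∀ i → x + i · (b + b) ∈ A
      go zero    = Subset.resp A (sym (+-identityʳ x)) x∈A
      go (suc i) = Subset.resp A
        (solve (x ∷ b ∷ i · (b + b) ∷ []) (λ x b y → (x ⊞ y) ⊞ (b ⊞ b) ⊜ x ⊞ ((b ⊞ b) ⊞ y)) ≡.refl)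
        (stay (go i) λ y∈K → x∉KH (cancel-∈ʳ KH≤G (H⊆KH (multiple∈H i)) (K⊆KH y∈K)))

    outside-cover : ∀ {x} → x ∉ A → - x ∈ B
    outside-cover {x} x∉A with C₀.cover x
    ... | inj₁ x∈A  = contradiction x∈A x∉A
    ... | inj₂ -x∈B = Subset.resp B (+-identityˡ _) -x∈B

    outside-disjoint : ∀ {x} → x ∉ KH → x ∈ A → - x ∉ B
    outside-disjoint x∉KH x∈A -x∈B = x∉KH (K⊆KH (C₀.meet x∈A (Subset.resp B (sym (+-identityˡ _)) -x∈B)))

-- Pairs of opposite cosets of H, and the shape of A and B.

module _ {G : FiniteAbelianGroup c ℓ} where
  open FiniteAbelianGroup G
    using (_≈_; _+_; -_; _-_; sym; trans; refl; +-congʳ; +-identityˡ; -‿cong; abelianGroup)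
  open AbelianGroupSolver abelianGroup using (solve)

  negate : Subset G p → Subset G p
  negate U = preimage {G = G} {G} (record { to = -_ ; cong = -‿cong }) U

  module Pairing (A : Subset G p) (B : Subset G q) (b : Carrier G)
                 (critical₀ : Critical A B (_∈ K G) (0# G))
                 (critical₁ : Critical A B (_∈ shift (- b) (K G)) (b + b))
                 (b∉K : b ∉ K G) where
    open Multiples {G = G} b
    private
      module A = OneSide A B b critical₀ critical₁ b∉K
      module B = OneSide B A b
        (critical-swap (K G) (λ {x} x∈K → Subset.resp (K G) (sym (+-identityˡ (- x))) (K.-‿closed x∈K)) critical₀)
        (critical-swap (shift (- b) (K G))
          (λ {x} x-b∈K → Subset.resp (K G)
            (solve (b ∷ x ∷ []) (λ b x → ⊟ (⊟ b ⊞ x) ⊜ ⊟ b ⊞ ((b ⊞ b) ⊟⊟ x)) ≡.refl)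
            (K.-‿closed x-b∈K)) critical₁)
        b∉K

    infix 4 _~_ _~?_

    -- Congruence up to sign modulo `H`; its classes outside `KH` are the unions of x + H and -x + H
    -- in the decomposition.
    _~_ : Carrier G → Carrier G → Set ℓ
    x ~ y = x - y ∈ H ⊎ x + y ∈ H

    ~-sym : Binary.Symmetric _~_
    ~-sym {x} {y} (inj₁ x-y∈H) = inj₁ (Subset.resp H
      (solve (x ∷ y ∷ []) (λ x y → ⊟ (x ⊟⊟ y) ⊜ y ⊟⊟ x) ≡.refl) (H.-‿closed x-y∈H))
    ~-sym {x} {y} (inj₂ x+y∈H) = inj₂ (Subset.resp H
      (solve (x ∷ y ∷ []) (λ x y → x ⊞ y ⊜ y ⊞ x) ≡.refl) x+y∈H)

    ~-trans : Binary.Transitive _~_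
    ~-trans {x} {y} {z} (inj₁ x-y∈H) (inj₁ y-z∈H) = inj₁ (Subset.resp H
      (solve (x ∷ y ∷ z ∷ []) (λ x y z → (x ⊟⊟ y) ⊞ (y ⊟⊟ z) ⊜ x ⊟⊟ z) ≡.refl) (H.+-closed x-y∈H y-z∈H))
    ~-trans {x} {y} {z} (inj₁ x-y∈H) (inj₂ y+z∈H) = inj₂ (Subset.resp H
      (solve (x ∷ y ∷ z ∷ []) (λ x y z → (x ⊟⊟ y) ⊞ (y ⊞ z) ⊜ x ⊞ z) ≡.refl) (H.+-closed x-y∈H y+z∈H))
    ~-trans {x} {y} {z} (inj₂ x+y∈H) (inj₁ y-z∈H) = inj₂ (Subset.resp H
      (solve (x ∷ y ∷ z ∷ []) (λ x y z → (x ⊞ y) ⊟⊟ (y ⊟⊟ z) ⊜ x ⊞ z) ≡.refl) (-‿∈ H≤G x+y∈H y-z∈H))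
    ~-trans {x} {y} {z} (inj₂ x+y∈H) (inj₂ y+z∈H) = inj₁ (Subset.resp H
      (solve (x ∷ y ∷ z ∷ []) (λ x y z → (x ⊞ y) ⊟⊟ (y ⊞ z) ⊜ x ⊟⊟ z) ≡.refl) (-‿∈ H≤G x+y∈H y+z∈H))

    ≈⇒~ : ∀ {x y} → x ≈ y → x ~ y
    ≈⇒~ {x} {y} x≈y = inj₁ (Subset.resp H
      (trans (solve (y ∷ []) (λ y → 𝟎 ⊜ y ⊟⊟ y) ≡.refl) (+-congʳ (sym x≈y))) H.0∈)

    ~-isEquivalence : IsEquivalence _~_
    ~-isEquivalence = record { refl = ≈⇒~ refl ; sym = ~-sym ; trans = ~-trans }

    _~?_ : Binary.Decidable _~_
    x ~? y = Subset.dec H (x - y) ⊎-dec Subset.dec H (x + y)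

    transversal : ∀ {r} (U : Subset G r) → ∃ (Representatives _~_ U)
    transversal U = _ , representatives ~-isEquivalence _~?_ ≈⇒~ U

    -‿∉KH : ∀ {x} → x ∉ KH → - x ∉ KH
    -‿∉KH {x} x∉KH -x∈KH = x∉KH (Subset.resp KH (solve (x ∷ []) (λ x → ⊟ (⊟ x) ⊜ x) ≡.refl) (KH.-‿closed -x∈KH))

    along : ∀ {x y} → x ∉ KH → x - y ∈ H → x ∈ A → y ∈ A
    along {x} {y} x∉KH x-y∈H x∈A = Subset.resp A
      (solve (x ∷ y ∷ []) (λ x y → x ⊞ (⊟ (x ⊟⊟ y)) ⊜ y) ≡.refl)
      (A.outside-stable x∉KH x∈A (H.-‿closed x-y∈H))

    across : ∀ {x y} → x ∉ KH → x + y ∈ H → x ∈ A → - y ∈ A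
    across {x} {y} x∉KH x+y∈H = along x∉KH (Subset.resp H
      (solve (x ∷ y ∷ []) (λ x y → x ⊞ y ⊜ x ⊟⊟ (⊟ y)) ≡.refl) x+y∈H)

    along- : ∀ {x y} → x ∉ KH → x - y ∈ H → - x ∈ A → - y ∈ A
    along- {x} {y} x∉KH x-y∈H = along (-‿∉KH x∉KH) (Subset.resp H
      (solve (x ∷ y ∷ []) (λ x y → ⊟ (x ⊟⊟ y) ⊜ (⊟ x) ⊟⊟ (⊟ y)) ≡.refl) (H.-‿closed x-y∈H))

    -- Outside `KH`, `B` is the complement of -A. So `One` lies in both sets, `Both` in `A` only and
    -- `Neither` in `B` only. An x with only -x in `A` is left out; its class is represented through
    -- -x.
    One Both Neither : Subset G _
    One     = (A ∖ negate A) ∖ KH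
    Both    = (A ∩ negate A) ∖ KH
    Neither = (∁ A ∖ negate A) ∖ KH

    Both≁Neither : ∀ {x y} → x ∈ Both → y ∈ Neither → ¬ (x ~ y)
    Both≁Neither ((x∈A , _) , x∉KH) ((y∉A , _) , _)  (inj₁ x-y∈H) = y∉A (along x∉KH x-y∈H x∈A)
    Both≁Neither ((x∈A , _) , x∉KH) ((_ , -y∉A) , _) (inj₂ x+y∈H) = -y∉A (across x∉KH x+y∈H x∈A)

    One≁Both∪Neither : ∀ {x y} → x ∈ One → y ∈ Both ∪ Neither → ¬ (x ~ y)
    One≁Both∪Neither {x} {y} ((x∈A , -x∉A) , x∉KH) (inj₁ ((y∈A , -y∈A) , y∉KH)) x~y = case (~-sym x~y)
      where
      case : ¬ (y ~ x)
      case (inj₁ y-x∈H) = -x∉A (along- y∉KH y-x∈H -y∈A)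
      case (inj₂ y+x∈H) = -x∉A (across y∉KH y+x∈H y∈A)
    One≁Both∪Neither ((x∈A , _) , x∉KH) (inj₂ ((y∉A , _) , _))  (inj₁ x-y∈H) = y∉A (along x∉KH x-y∈H x∈A)
    One≁Both∪Neither ((x∈A , _) , x∉KH) (inj₂ ((_ , -y∉A) , _)) (inj₂ x+y∈H) = -y∉A (across x∉KH x+y∈H x∈A)

    module Sorted {k u v : ℕ} (one : Representatives _~_ One k)
                  (both : Representatives _~_ Both u) (neither : Representatives _~_ Neither v) where
      l pairCount : ℕ
      l         = k ℕ.+ u
      pairCount = k ℕ.+ (u ℕ.+ v)

      pairs : Representatives _~_ (One ∪ (Both ∪ Neither)) pairCount
      pairs = disjoint-representatives {_~_ = _~_} ~-sym One≁Both∪Neither one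
        (disjoint-representatives {_~_ = _~_} ~-sym Both≁Neither both neither)

      x : Fin pairCount → Carrier G
      x = at pairs

      at-both : Fin u ⊎ Fin v → Carrier G
      at-both = [ at both , at neither ]′

      at-pairs : Fin k ⊎ Fin (u ℕ.+ v) → Carrier G
      at-pairs = [ at one , at-both ∘ splitAt u ]′

      x-first : ∀ i → x (i ↑ˡ (u ℕ.+ v)) ≡ at one i
      x-first i = ≡.cong at-pairs (Fin.splitAt-↑ˡ k i _)

      x-second : ∀ i → x (k ↑ʳ (i ↑ˡ v)) ≡ at both i
      x-second i = ≡.trans (≡.cong at-pairs (Fin.splitAt-↑ʳ k _ (i ↑ˡ v)))
        (≡.cong at-both (Fin.splitAt-↑ˡ u i v))

      x-third : ∀ i → x (k ↑ʳ (u ↑ʳ i)) ≡ at neither i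
      x-third i = ≡.trans (≡.cong at-pairs (Fin.splitAt-↑ʳ k _ (u ↑ʳ i)))
        (≡.cong at-both (Fin.splitAt-↑ʳ u v i))

      first<k : (i : Fin k) → toℕ (i ↑ˡ (u ℕ.+ v)) ℕ.< k
      first<k i = ≡.subst (ℕ._< k) (≡.sym (Fin.toℕ-↑ˡ i _)) (Fin.toℕ<n i)

      k≤second : (i : Fin u) → k ℕ.≤ toℕ (k ↑ʳ (i ↑ˡ v))
      k≤second i = ≡.subst (k ℕ.≤_) (≡.sym (Fin.toℕ-↑ʳ k (i ↑ˡ v))) (ℕ.m≤m+n k _)

      second<l : (i : Fin u) → toℕ (k ↑ʳ (i ↑ˡ v)) ℕ.< l
      second<l i = ≡.subst (ℕ._< l)
        (≡.sym (≡.trans (Fin.toℕ-↑ʳ k (i ↑ˡ v)) (≡.cong (k ℕ.+_) (Fin.toℕ-↑ˡ i v)))) (ℕ.+-monoʳ-< k (Fin.toℕ<n i))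

      l≤third : (i : Fin v) → l ℕ.≤ toℕ (k ↑ʳ (u ↑ʳ i))
      l≤third i = ≡.subst (l ℕ.≤_)
        (≡.sym (≡.trans (Fin.toℕ-↑ʳ k (u ↑ʳ i)) (≡.cong (k ℕ.+_) (Fin.toℕ-↑ʳ u i)))) (ℕ.+-monoʳ-≤ k (ℕ.m≤m+n u _))

      k≤l : k ℕ.≤ l
      k≤l = ℕ.m≤m+n k u

      l≤m : l ℕ.≤ pairCount
      l≤m = ℕ.+-monoʳ-≤ k (ℕ.m≤m+n u v)

      x∈One : ∀ i → toℕ i ℕ.< k → x i ∈ One
      x∈One i = go (third? k u v i)
        where
        go : ∀ {i} → Third i → toℕ i ℕ.< k → x i ∈ One
        go (first i)  _   = ≡.subst (_∈ One) (≡.sym (x-first i)) (at∈ one i)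
        go (second i) i<k = contradiction (k≤second i) (ℕ.<⇒≱ i<k)
        go (third i)  i<k = contradiction (ℕ.≤-trans k≤l (l≤third i)) (ℕ.<⇒≱ i<k)

      x∈Both : ∀ i → k ℕ.≤ toℕ i → toℕ i ℕ.< l → x i ∈ Both
      x∈Both i = go (third? k u v i)
        where
        go : ∀ {i} → Third i → k ℕ.≤ toℕ i → toℕ i ℕ.< l → x i ∈ Both
        go (first i)  k≤i _   = contradiction k≤i (ℕ.<⇒≱ (first<k i))
        go (second i) _   _   = ≡.subst (_∈ Both) (≡.sym (x-second i)) (at∈ both i)
        go (third i)  _   i<l = contradiction (l≤third i) (ℕ.<⇒≱ i<l)

      x∈Neither : ∀ i → l ℕ.≤ toℕ i → x i ∈ Neither
      x∈Neither i = go (third? k u v i)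
        where
        go : ∀ {i} → Third i → l ℕ.≤ toℕ i → x i ∈ Neither
        go (first i)  l≤i = contradiction (ℕ.≤-trans k≤l l≤i) (ℕ.<⇒≱ (first<k i))
        go (second i) l≤i = contradiction l≤i (ℕ.<⇒≱ (second<l i))
        go (third i)  _   = ≡.subst (_∈ Neither) (≡.sym (x-third i)) (at∈ neither i)

      One-onto : ∀ {y} → y ∈ One → ∃ λ i → toℕ i ℕ.< k × y ~ x i
      One-onto y∈One = let i , y~ = at-onto one y∈One in
        i ↑ˡ (u ℕ.+ v) , first<k i , ≡.subst (_ ~_) (≡.sym (x-first i)) y~

      Both-onto : ∀ {y} → y ∈ Both → ∃ λ i → k ℕ.≤ toℕ i × toℕ i ℕ.< l × y ~ x i
      Both-onto y∈Both = let i , y~ = at-onto both y∈Both in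
        k ↑ʳ (i ↑ˡ v) , k≤second i , second<l i , ≡.subst (_ ~_) (≡.sym (x-second i)) y~

      Neither-onto : ∀ {y} → y ∈ Neither → ∃ λ i → l ℕ.≤ toℕ i × y ~ x i
      Neither-onto y∈Neither = let i , y~ = at-onto neither y∈Neither in
        k ↑ʳ (u ↑ʳ i) , l≤third i , ≡.subst (_ ~_) (≡.sym (x-third i)) y~

      pairs∉KH : ∀ {y} → y ∈ One ∪ (Both ∪ Neither) → y ∉ KH
      pairs∉KH (inj₁ (_ , y∉KH))        = y∉KH
      pairs∉KH (inj₂ (inj₁ (_ , y∉KH))) = y∉KH
      pairs∉KH (inj₂ (inj₂ (_ , y∉KH))) = y∉KH

      x∉KH : ∀ i → x i ∉ KH
      x∉KH i = pairs∉KH (at∈ pairs i)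

      ~-negate : ∀ {x y} → - x ~ y → x ~ y
      ~-negate {x} {y} (inj₁ -x-y∈H) = inj₂ (Subset.resp H
        (solve (x ∷ y ∷ []) (λ x y → ⊟ ((⊟ x) ⊟⊟ y) ⊜ x ⊞ y) ≡.refl) (H.-‿closed -x-y∈H))
      ~-negate {x} {y} (inj₂ -x+y∈H) = inj₁ (Subset.resp H
        (solve (x ∷ y ∷ []) (λ x y → ⊟ ((⊟ x) ⊞ y) ⊜ x ⊟⊟ y) ≡.refl) (H.-‿closed -x+y∈H))

      onto : ∀ {y} → y ∉ KH → ∃ λ i → y ~ x i
      onto {y} y∉KH with Subset.dec A y | Subset.dec A (- y)
      ... | no y∉A  | no -y∉A = at-onto pairs (inj₂ (inj₂ ((y∉A , -y∉A) , y∉KH)))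
      ... | yes y∈A | yes -y∈A = at-onto pairs (inj₂ (inj₁ ((y∈A , -y∈A) , y∉KH)))
      ... | yes y∈A | no -y∉A = at-onto pairs (inj₁ ((y∈A , -y∉A) , y∉KH))
      -- Here y is in none of the three sets, but -y is in `One` and the relation ignores signs.
      ... | no y∉A  | yes -y∈A =
        let i , -y~ = at-onto pairs (inj₁ ((-y∈A , λ ⁻⁻y∈A → y∉A (Subset.resp A
              (solve (y ∷ []) (λ y → ⊟ (⊟ y) ⊜ y) ≡.refl) ⁻⁻y∈A)) , -‿∉KH y∉KH))
        in i , ~-negate -y~

      pair : Fin pairCount → Subset G _
      pair i = (｛ x i ｝ ⊕ H) ∪ (｛ - x i ｝ ⊕ H)

      pair⇒~ : ∀ {y} i → y ∈ pair i → y ~ x i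
      pair⇒~ i (inj₁ y∈) = inj₁ (∈-coset⁻ H y∈)
      pair⇒~ {y} i (inj₂ y∈) = inj₂ (Subset.resp H
        (solve (y ∷ x i ∷ []) (λ y x → y ⊟⊟ (⊟ x) ⊜ y ⊞ x) ≡.refl) (∈-coset⁻ H y∈))

      ~⇒pair : ∀ {y} i → y ~ x i → y ∈ pair i
      ~⇒pair i (inj₁ y-x∈H) = inj₁ (∈-coset⁺ H y-x∈H)
      ~⇒pair {y} i (inj₂ y+x∈H) = inj₂ (∈-coset⁺ H (Subset.resp H
        (solve (y ∷ x i ∷ []) (λ y x → y ⊞ x ⊜ y ⊟⊟ (⊟ x)) ≡.refl) y+x∈H))

      ~⇒∉KH : ∀ {y} i → y ~ x i → y ∉ KH
      ~⇒∉KH {y} i (inj₁ y-x∈H) y∈KH = x∉KH i (Subset.resp KH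
        (solve (y ∷ x i ∷ []) (λ y x → y ⊟⊟ (y ⊟⊟ x) ⊜ x) ≡.refl) (-‿∈ KH≤G y∈KH (H⊆KH y-x∈H)))
      ~⇒∉KH {y} i (inj₂ y+x∈H) y∈KH = x∉KH i (Subset.resp KH
        (solve (y ∷ x i ∷ []) (λ y x → (y ⊞ x) ⊟⊟ y ⊜ x) ≡.refl) (-‿∈ KH≤G (H⊆KH y+x∈H) y∈KH))

      cover : ∁ KH ≐ ⋃ pair
      cover = (λ y y∉KH → let i , y~ = onto y∉KH in i , ~⇒pair i y~)
            , (λ y (i , y∈) → ~⇒∉KH i (pair⇒~ i y∈))

      -- A common element of x + H and -x + H would give 2x in `H`, hence x in `KH`; this uses that
      -- d is odd.
      card-pair : ∀ i → ∣ pair i ∣ ≡ d ℕ.+ d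
      card-pair i = ≡.trans
        (card-disjoint-∪ (｛ x i ｝ ⊕ H) (｛ - x i ｝ ⊕ H) λ y y∈ y∈′ → x∉KH i (double∈H⇒∈KH A.d-odd
          (Subset.resp H (solve (y ∷ x i ∷ []) (λ y x → (y ⊟⊟ (⊟ x)) ⊟⊟ (y ⊟⊟ x) ⊜ x ⊞ x) ≡.refl)
            (-‿∈ H≤G (∈-coset⁻ H y∈′) (∈-coset⁻ H y∈)))))
        (≡.cong₂ ℕ._+_ (card-coset (x i) H) (card-coset (- x i) H))

      card-outside : ∣ ∁ KH ∣ ≡ pairCount ℕ.* (d ℕ.+ d)
      card-outside = ≡.trans (card-cong (∁ KH) (⋃ pair) cover)
        (card-⋃-const pair (λ i j i≢j y y∈ y∈′ →
          i≢j (at-injective pairs (~-trans (~-sym (pair⇒~ i y∈)) (pair⇒~ j y∈′)))) card-pair)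

      m-eq : d ℕ.* (2 ℕ.* pairCount ℕ.+ ∣ K G ∣) ≡ order G
      m-eq = ≡.trans
        (solveℕ 3 (λ d m κ → d :* (con 2 :* m :+ κ) := d :* κ :+ m :* (d :+ d)) ≡.refl d pairCount (∣ K G ∣))
        (≡.trans (≡.cong₂ ℕ._+_ (≡.sym (card-KH A.d-odd)) (≡.sym card-outside)) (≡.sym (card-∁ KH)))
        where open ℕSolver.+-*-Solver renaming (solve to solveℕ)

      Q R : Subset G _
      Q = (select x (λ i → toℕ i ℕ.<? k)
           ∪ select x (λ i → (k ℕ.≤? toℕ i) ×-dec (toℕ i ℕ.<? l))
           ∪ select (λ i → - x i) (λ i → (k ℕ.≤? toℕ i) ×-dec (toℕ i ℕ.<? l))) ⊕ H
      R = (select x (λ i → toℕ i ℕ.<? k)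
           ∪ select x (λ i → l ℕ.≤? toℕ i)
           ∪ select (λ i → - x i) (λ i → l ℕ.≤? toℕ i)) ⊕ H

      Q⊆A : ∀ {y} → y ∈ Q → y ∈ A
      Q⊆A (a , h , a∈ , h∈H , a+h≈y) = Subset.resp A a+h≈y (go a∈)
        where
        go : _ → a + h ∈ A
        go (inj₁ (i , i<k , xᵢ≈a)) = let (x∈A , _) , x∉KH = x∈One i i<k in
          Subset.resp A (+-congʳ xᵢ≈a) (A.outside-stable x∉KH x∈A h∈H)
        go (inj₂ (inj₁ (i , (k≤i , i<l) , xᵢ≈a))) = let (x∈A , _) , x∉KH = x∈Both i k≤i i<l in
          Subset.resp A (+-congʳ xᵢ≈a) (A.outside-stable x∉KH x∈A h∈H)
        go (inj₂ (inj₂ (i , (k≤i , i<l) , -xᵢ≈a))) = let (_ , -x∈A) , x∉KH = x∈Both i k≤i i<l in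
          Subset.resp A (+-congʳ -xᵢ≈a) (A.outside-stable (-‿∉KH x∉KH) -x∈A h∈H)

      R⊆B : ∀ {y} → y ∈ R → y ∈ B
      R⊆B (a , h , a∈ , h∈H , a+h≈y) = Subset.resp B a+h≈y (go a∈)
        where
        x∈B : ∀ {x} → - x ∉ A → x ∈ B
        x∈B {x} -x∉A = Subset.resp B (solve (x ∷ []) (λ x → ⊟ (⊟ x) ⊜ x) ≡.refl) (A.outside-cover -x∉A)
        go : _ → a + h ∈ B
        go (inj₁ (i , i<k , xᵢ≈a)) = let (_ , -x∉A) , x∉KH = x∈One i i<k in
          Subset.resp B (+-congʳ xᵢ≈a) (B.outside-stable x∉KH (x∈B -x∉A) h∈H)
        go (inj₂ (inj₁ (i , l≤i , xᵢ≈a))) = let (_ , -x∉A) , x∉KH = x∈Neither i l≤i in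
          Subset.resp B (+-congʳ xᵢ≈a) (B.outside-stable x∉KH (x∈B -x∉A) h∈H)
        go (inj₂ (inj₂ (i , l≤i , -xᵢ≈a))) = let (x∉A , _) , x∉KH = x∈Neither i l≤i in
          Subset.resp B (+-congʳ -xᵢ≈a) (B.outside-stable (-‿∉KH x∉KH) (A.outside-cover x∉A) h∈H)

      private
        to-translate : ∀ y z → z + (y - z) ≈ y
        to-translate y z = solve (y ∷ z ∷ []) (λ y z → z ⊞ (y ⊟⊟ z) ⊜ y) ≡.refl

        to-translate- : ∀ y z → - z + (y + z) ≈ y
        to-translate- y z = solve (y ∷ z ∷ []) (λ y z → ⊟ z ⊞ (y ⊞ z) ⊜ y) ≡.refl

        -- The sign is forced: y + x i in `H` would put - x i into `A`. This is why x₁ to x_k occur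
        -- without ± in `Q` and `R`.
        One⇒coset : ∀ {y} → y ∈ One → ∃ λ i → toℕ i ℕ.< k × y - x i ∈ H
        One⇒coset {y} y∈One = let i , i<k , y~ = One-onto y∈One in i , i<k , go i i<k y~
          where
          go : ∀ i → toℕ i ℕ.< k → y ~ x i → y - x i ∈ H
          go i i<k (inj₁ y-x∈H) = y-x∈H
          go i i<k (inj₂ y+x∈H) = contradiction
            (across (proj₂ y∈One) y+x∈H (proj₁ (proj₁ y∈One))) (proj₂ (proj₁ (x∈One i i<k)))

        One⊆Q : ∀ {y} → y ∈ One → y ∈ Q
        One⊆Q {y} y∈One = let i , i<k , y-x∈H = One⇒coset y∈One in
          x i , y - x i , inj₁ (i , i<k , refl) , y-x∈H , to-translate y (x i)

        One⊆R : ∀ {y} → y ∈ One → y ∈ R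
        One⊆R {y} y∈One = let i , i<k , y-x∈H = One⇒coset y∈One in
          x i , y - x i , inj₁ (i , i<k , refl) , y-x∈H , to-translate y (x i)

        Both⊆Q : ∀ {y} → y ∈ Both → y ∈ Q
        Both⊆Q {y} y∈Both = let i , k≤i , i<l , y~ = Both-onto y∈Both in go i (k≤i , i<l) y~
          where
          go : ∀ i → k ℕ.≤ toℕ i × toℕ i ℕ.< l → y ~ x i → y ∈ Q
          go i bounds (inj₁ y-x∈H) =
            x i , y - x i , inj₂ (inj₁ (i , bounds , refl)) , y-x∈H , to-translate y (x i)
          go i bounds (inj₂ y+x∈H) =
            - x i , y + x i , inj₂ (inj₂ (i , bounds , refl)) , y+x∈H , to-translate- y (x i)

        Neither⊆R : ∀ {y} → y ∈ Neither → y ∈ R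
        Neither⊆R {y} y∈Neither = let i , l≤i , y~ = Neither-onto y∈Neither in go i l≤i y~
          where
          go : ∀ i → l ℕ.≤ toℕ i → y ~ x i → y ∈ R
          go i l≤i (inj₁ y-x∈H) =
            x i , y - x i , inj₂ (inj₁ (i , l≤i , refl)) , y-x∈H , to-translate y (x i)
          go i l≤i (inj₂ y+x∈H) =
            - x i , y + x i , inj₂ (inj₂ (i , l≤i , refl)) , y+x∈H , to-translate- y (x i)

      A⊆E∪Q : A ⊆ E ∪ Q
      A⊆E∪Q y y∈A with Subset.dec KH y | Subset.dec A (- y)
      ... | yes y∈KH | _        = inj₁ (A.A∩KH⊆E y∈A y∈KH)
      ... | no  y∉KH | yes -y∈A = inj₂ (Both⊆Q ((y∈A , -y∈A) , y∉KH))
      ... | no  y∉KH | no  -y∉A = inj₂ (One⊆Q ((y∈A , -y∉A) , y∉KH))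

      B⊆E∪R : B ⊆ E ∪ R
      B⊆E∪R y y∈B with Subset.dec KH y | Subset.dec A y
      ... | yes y∈KH | _       = inj₁ (B.A∩KH⊆E y∈B y∈KH)
      ... | no  y∉KH | yes y∈A = inj₂ (One⊆R ((y∈A , B.outside-disjoint y∉KH y∈B) , y∉KH))
      ... | no  y∉KH | no  y∉A = inj₂ (Neither⊆R ((y∉A , B.outside-disjoint y∉KH y∈B) , y∉KH))

      pairStructure : PairStructure G A B
      pairStructure = record
        { b          = b
        ; b∈A′       = b∈A
        ; b∈B′       = b∈B
        ; d-odd      = A.d-odd
        ; 1<d        = A.1<d
        ; k          = k
        ; l          = l
        ; m          = pairCount
        ; k≤l        = k≤l
        ; l≤m        = l≤m
        ; m-eq       = m-eq
        ; x          = x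
        ; x-distinct = λ i j eq → at-injective pairs (≈⇒~ eq)
        ; x∉K+H      = x∉KH
        ; cover      = cover
        ; A′-eq      = A⊆E∪Q , (λ { y (inj₁ y∈E) → A.E⊆A y∈E ; y (inj₂ y∈Q) → Q⊆A y∈Q })
        ; B′-eq      = B⊆E∪R , (λ { y (inj₁ y∈E) → B.E⊆A y∈E ; y (inj₂ y∈R) → R⊆B y∈R })
        }
        where
        b∈shift : b ∈ shift (- b) (K G)
        b∈shift = Subset.resp (K G) (solve (b ∷ []) (λ b → 𝟎 ⊜ ⊟ b ⊞ b) ≡.refl) K.0∈
        b∈A : b ∈ A
        b∈A = Critical.left critical₁ b∈shift
        b∈B : b ∈ B
        b∈B = Subset.resp B (solve (b ∷ []) (λ b → (b ⊞ b) ⊟⊟ b ⊜ b) ≡.refl) (Critical.right critical₁ b∈shift)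

    pairStructure : PairStructure G A B
    pairStructure = Sorted.pairStructure (proj₂ (transversal One)) (proj₂ (transversal Both))
      (proj₂ (transversal Neither))

-- Rigidity of critical sums when K is small.

module _ {G : FiniteAbelianGroup c ℓ} where
  open FiniteAbelianGroup G
    using (_≈_; _+_; -_; _-_; sym; trans; +-cong; +-congˡ; +-congʳ; +-identityˡ; +-identityʳ
          ; -‿cong; abelianGroup; monoid; _·_)
  open MonoidMult monoid using (×-congˡ; ×-homo-+)
  open AbelianGroupProperties abelianGroup using (∙-cancelˡ)
  open AbelianGroupSolver abelianGroup using (solve)

  -- The starting point is an arbitrary `σ`, not the structure built above, because the final
  -- conclusions are claimed for every choice of b and of the x i.
  module Rigidity (A : Subset G p) (B : Subset G q) (σ : PairStructure G A B) where
    open PairStructure σ using (b; d-odd; 1<d; x; x∉K+H; A′-eq; B′-eq; Q; R)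
    open Multiples {G = G} b

    coset-outside : ∀ {y h} → y ∉ KH → h ∈ H → y + h ∉ KH
    coset-outside y∉KH h∈H y+h∈KH = y∉KH (cancel-∈ʳ KH≤G (H⊆KH h∈H) y+h∈KH)

    x≈⇒∉KH : ∀ {i y} → x i ≈ y → y ∉ KH
    x≈⇒∉KH xᵢ≈y y∈KH = x∉K+H _ (Subset.resp KH (sym xᵢ≈y) y∈KH)

    -x≈⇒∉KH : ∀ {i y} → - x i ≈ y → y ∉ KH
    -x≈⇒∉KH {i} -xᵢ≈y y∈KH = x∉K+H i (Subset.resp KH
      (trans (-‿cong (sym -xᵢ≈y)) (solve (x i ∷ []) (λ x → ⊟ (⊟ x) ⊜ x) ≡.refl)) (KH.-‿closed y∈KH))

    Q∉KH : ∀ {y} → y ∈ Q → y ∉ KH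
    Q∉KH (a , h , a∈ , h∈H , a+h≈y) y∈KH =
      coset-outside (go a∈) h∈H (Subset.resp KH (sym a+h≈y) y∈KH)
      where
      go : _ → a ∉ KH
      go (inj₁ (_ , _ , xᵢ≈a))         = x≈⇒∉KH xᵢ≈a
      go (inj₂ (inj₁ (_ , _ , xᵢ≈a)))  = x≈⇒∉KH xᵢ≈a
      go (inj₂ (inj₂ (_ , _ , -xᵢ≈a))) = -x≈⇒∉KH -xᵢ≈a

    R∉KH : ∀ {y} → y ∈ R → y ∉ KH
    R∉KH (a , h , a∈ , h∈H , a+h≈y) y∈KH =
      coset-outside (go a∈) h∈H (Subset.resp KH (sym a+h≈y) y∈KH)
      where
      go : _ → a ∉ KH
      go (inj₁ (_ , _ , xᵢ≈a))         = x≈⇒∉KH xᵢ≈a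
      go (inj₂ (inj₁ (_ , _ , xᵢ≈a)))  = x≈⇒∉KH xᵢ≈a
      go (inj₂ (inj₂ (_ , _ , -xᵢ≈a))) = -x≈⇒∉KH -xᵢ≈a

    Q-stable : ∀ {y h} → y ∈ Q → h ∈ H → y + h ∈ Q
    Q-stable {h = h} (a , h′ , a∈ , h′∈H , a+h′≈y) h∈H = a , h′ + h , a∈ , H.+-closed h′∈H h∈H ,
      trans (solve (a ∷ h′ ∷ h ∷ []) (λ a h′ h → a ⊞ (h′ ⊞ h) ⊜ (a ⊞ h′) ⊞ h) ≡.refl) (+-congʳ a+h′≈y)

    E⊆A : ∀ {y} → y ∈ E → y ∈ A
    E⊆A y∈E = proj₂ A′-eq _ (inj₁ y∈E)

    E⊆B : ∀ {y} → y ∈ E → y ∈ B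
    E⊆B y∈E = proj₂ B′-eq _ (inj₁ y∈E)

    A∩KH⊆E : ∀ {y} → y ∈ A → y ∈ KH → y ∈ E
    A∩KH⊆E y∈A y∈KH = [ id , (λ y∈Q → contradiction y∈KH (Q∉KH y∈Q)) ]′ (proj₁ A′-eq _ y∈A)

    B∩KH⊆E : ∀ {y} → y ∈ B → y ∈ KH → y ∈ E
    B∩KH⊆E y∈B y∈KH = [ id , (λ y∈R → contradiction y∈KH (R∉KH y∈R)) ]′ (proj₁ B′-eq _ y∈B)

    outside-stable : ∀ {y h} → y ∉ KH → y ∈ A → h ∈ H → y + h ∈ A
    outside-stable y∉KH y∈A h∈H =
      [ (λ y∈E → contradiction (E⊆KH d-odd y∈E) y∉KH)
      , (λ y∈Q → proj₂ A′-eq _ (inj₂ (Q-stable y∈Q h∈H))) ]′ (proj₁ A′-eq _ y∈A)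

    e : ℕ
    e = proj₁ (2∤n⇒n≡1+2k d d-odd)

    d≡1+2e : d ≡ suc (e ℕ.+ e)
    d≡1+2e = proj₂ (2∤n⇒n≡1+2k d d-odd)

    0<e : 0 ℕ.< e
    0<e = ℕ.n≢0⇒n>0 λ e≡0 → ℕ.<⇒≢ 1<d (≡.sym (≡.trans d≡1+2e (≡.cong (λ e → suc (e ℕ.+ e)) e≡0)))

    half≡1+e : (d ℕ.+ 1) ℕ./ 2 ≡ suc e
    half≡1+e = ≡.trans (≡.cong (ℕ._/ 2) (≡.trans (≡.cong (ℕ._+ 1) d≡1+2e)
      (solveℕ 1 (λ e → con 1 :+ (e :+ e) :+ con 1 := (con 1 :+ e) :* con 2) ≡.refl e))) (m*n/n≡m (suc e) 2)
      where open ℕSolver.+-*-Solver renaming (solve to solveℕ)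

    small∉E : ∀ {i κ} → 0 ℕ.< i → i ℕ.≤ e → κ ∈ K G → κ + (i ℕ.+ i) · b ∉ E
    small∉E 0<i i≤e = even∉E 0<i
      (ℕ.≤-trans (ℕ.s≤s (ℕ.+-mono-≤ i≤e i≤e)) (ℕ.≤-reflexive (≡.sym d≡1+2e)))

    even∈KH : ∀ {i κ} → κ ∈ K G → κ + (i ℕ.+ i) · b ∈ KH
    even∈KH {i} κ∈K = KH.+-closed (K⊆KH κ∈K) (H⊆KH (Subset.resp H (·-double i) (multiple∈H i)))

    -- The value i = d, where the multiple is 0, is included so that the range has e + 1 = (d+1)/2
    -- members.
    large∈E : ∀ {i} → e ℕ.< i → i ℕ.≤ d → i · (b + b) ∈ E
    large∈E {i} e<i i≤d = [ below , at-order ]′ (ℕ.m≤n⇒m<n∨m≡n i≤d)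
      where
      d<2i : d ℕ.< i ℕ.+ i
      d<2i = ℕ.≤-trans (ℕ.≤-reflexive (≡.trans (≡.cong suc d≡1+2e) (≡.cong suc (≡.sym (ℕ.+-suc e e)))))
        (ℕ.+-mono-≤ e<i e<i)
      below : i ℕ.< d → i · (b + b) ∈ E
      below i<d = Subset.resp E (trans (+-identityˡ _) (sym (·-double i))) (wrap∈E d-odd i<d d<2i K.0∈)
      at-order : i ≡ d → i · (b + b) ∈ E
      at-order i≡d = K⊆E (Subset.resp (K G) (sym (trans (×-congˡ i≡d) d·2b≈0)) K.0∈)

    module _ (D : Subset G r) (z : Carrier G) (critical : Critical A B (_∈ D) z)
             (D≤K : ∣ D ∣ ℕ.≤ ∣ K G ∣) (K<half : ∣ K G ∣ ℕ.< (d ℕ.+ 1) ℕ./ 2) where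
      open Critical critical

      -- Suppose z is outside `KH`. If z is in `A`, so is its coset modulo `H`; subtracting the e +
      -- 1 multiples of 2b from `large∈E`, which lie in `B`, gives e + 1 elements of `D`, too many.
      -- If z is not in `A`, then neither z - 2b is in `A` nor 2b in `B`, against `cover`.
      z∈KH : z ∈ KH
      z∈KH = decidable-stable (Subset.dec KH z) λ z∉KH → case z∉KH (Subset.dec A z)
        where
        inside : z ∉ KH → z ∈ A → suc e ℕ.≤ ∣ D ∣
        inside z∉KH z∈A = card-≥ {A = D} f f∈D f-injective
          where
          f : Fin (suc e) → Carrier G
          f i = z - (suc e ℕ.+ toℕ i) · (b + b)
          f∈D : ∀ i → f i ∈ D
          f∈D i = meet (outside-stable z∉KH z∈A (H.-‿closed (multiple∈H (suc e ℕ.+ toℕ i))))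
            (Subset.resp B (solve (z ∷ (suc e ℕ.+ toℕ i) · (b + b) ∷ []) (λ z y → y ⊜ z ⊟⊟ (z ⊟⊟ y)) ≡.refl)
              (E⊆B (large∈E {suc e ℕ.+ toℕ i} (ℕ.s≤s (ℕ.m≤m+n e _))
                (ℕ.≤-trans (ℕ.+-monoʳ-≤ (suc e) (ℕ.≤-pred (Fin.toℕ<n i))) (ℕ.≤-reflexive (≡.sym d≡1+2e))))))
          bound : ∀ (i : Fin (suc e)) → toℕ i ℕ.< d
          bound i = ℕ.≤-trans (Fin.toℕ<n i) (ℕ.≤-trans (ℕ.s≤s (ℕ.m≤m+n e e)) (ℕ.≤-reflexive (≡.sym d≡1+2e)))
          f-injective : ∀ {i j} → f i ≈ f j → i ≡ j
          f-injective {i} {j} eq = Fin.toℕ-injective (·2b-injective (bound i) (bound j)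
            (∙-cancelˡ (suc e · (b + b)) _ _ (trans (sym (×-homo-+ (b + b) (suc e) (toℕ i)))
              (trans (trans (recover _) (trans (+-congˡ (-‿cong eq)) (sym (recover _))))
                (×-homo-+ (b + b) (suc e) (toℕ j))))))
            where
            recover : ∀ y → y ≈ z - (z - y)
            recover y = solve (z ∷ y ∷ []) (λ z y → y ⊜ z ⊟⊟ (z ⊟⊟ y)) ≡.refl
        2b : Carrier G
        2b = (1 ℕ.+ 1) · b
        0+2b∈KH : 0# G + 2b ∈ KH
        0+2b∈KH = even∈KH {1} K.0∈
        2b∉B : 0# G + 2b ∉ B
        2b∉B y∈B = small∉E {1} (ℕ.s≤s ℕ.z≤n) 0<e K.0∈ (B∩KH⊆E y∈B 0+2b∈KH)
        2b∈H : 0# G + 2b ∈ H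
        2b∈H = Subset.resp H (sym (trans (+-identityˡ _) (sym (·-double 1)))) (multiple∈H 1)
        case : z ∉ KH → ¬ Dec (z ∈ A)
        case z∉KH (yes z∈A) = ℕ.<⇒≱ (ℕ.≤-trans K<half (ℕ.≤-reflexive half≡1+e))
          (ℕ.≤-trans (inside z∉KH z∈A) D≤K)
        case z∉KH (no z∉A) = [ back , (λ y∈B → 2b∉B (Subset.resp B
          (solve (z ∷ (0# G + 2b) ∷ []) (λ z y → z ⊟⊟ (z ⊟⊟ y) ⊜ y) ≡.refl) y∈B)) ]′ (cover (z - (0# G + 2b)))
          where
          back : z - (0# G + 2b) ∉ A
          back y∈A = z∉A (Subset.resp A (solve (z ∷ (0# G + 2b) ∷ []) (λ z y → (z ⊟⊟ y) ⊞ y ⊜ z) ≡.refl)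
            (outside-stable (coset-outside z∉KH (H.-‿closed 2b∈H)) y∈A 2b∈H))

      -- The element 2i·b is not in `A`, and z - 2i·b = κ + 2(j-i)·b is not in `B`, so z cannot
      -- satisfy `cover` at 2i·b.
      no-gap : ∀ {κ j} i → κ ∈ K G → z ≈ κ + (j ℕ.+ j) · b → i ℕ.≤ j →
        ¬ ((0 ℕ.< i × i ℕ.≤ e) × (0 ℕ.< j ℕ.∸ i × j ℕ.∸ i ℕ.≤ e))
      no-gap {κ} {j} i κ∈K z≈ i≤j ((0<i , i≤e) , (0<j-i , j-i≤e)) = [ inA , inB ]′ (cover (0# G + (i ℕ.+ i) · b))
        where
        inA : 0# G + (i ℕ.+ i) · b ∉ A
        inA y∈A = small∉E 0<i i≤e K.0∈ (A∩KH⊆E y∈A (even∈KH {i} K.0∈))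
        difference : (j ℕ.+ j) · b ≈ (i ℕ.+ i) · b + (j ℕ.∸ i ℕ.+ (j ℕ.∸ i)) · b
        difference = trans (sym (·-double j)) (trans (×-congˡ (≡.sym (ℕ.m+[n∸m]≡n i≤j)))
          (trans (×-homo-+ (b + b) i (j ℕ.∸ i)) (+-cong (·-double i) (·-double (j ℕ.∸ i)))))
        inB : z - (0# G + (i ℕ.+ i) · b) ∉ B
        inB y∈B = small∉E 0<j-i j-i≤e κ∈K (B∩KH⊆E (Subset.resp B
          (trans (+-congʳ (trans z≈ (+-congˡ difference)))
            (solve (κ ∷ (i ℕ.+ i) · b ∷ (j ℕ.∸ i ℕ.+ (j ℕ.∸ i)) · b ∷ [])
              (λ κ x y → (κ ⊞ (x ⊞ y)) ⊟⊟ (𝟎 ⊞ x) ⊜ κ ⊞ y) ≡.refl)) y∈B) (even∈KH {j ℕ.∸ i} κ∈K))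

      Rigid : Set _
      Rigid = (z ∈ K G × D ≐ K G) ⊎ (z - (b + b) ∈ K G × D ≐ shift (- b) (K G))

      -- With z = κ + 2j·b and j < d = 2e + 1, each j from 2 to 2e is a sum of two numbers from 1 to
      -- e and is excluded by `no-gap`. For j = 0 or 1 the set `E` already provides |K| elements of
      -- `D`, which is all of it.
      rigid : Rigid
      rigid = let κ , j , κ∈K , j<d , z≈ = KH-onto z∈KH in go j κ∈K j<d z≈
        where
        result : z ∈ K G ⊎ z - (b + b) ∈ K G → Rigid
        result (inj₁ z∈K) = inj₁ (z∈K , card-≤⇒⊇ (K G) D K⊆D D≤K , K⊆D)
          where
          K⊆D : K G ⊆ D
          K⊆D y y∈K = meet (E⊆A (K⊆E y∈K)) (E⊆B (K⊆E (-‿∈ K≤G z∈K y∈K)))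
        result (inj₂ z-2b∈K) = inj₂ (z-2b∈K , card-≤⇒⊇ (shift (- b) (K G)) D b+K⊆D
          (ℕ.≤-trans D≤K (ℕ.≤-reflexive (≡.sym (card-shift (- b) (K G))))) , b+K⊆D)
          where
          b+K∈E : ∀ {κ} → κ ∈ K G → 1 · b + κ ∈ E
          b+K∈E = odd∈E (ℕ.≤-trans 0<e e≤d-2) (2∤1+2k 0)
            where
            open ℕ.≤-Reasoning
            e≤d-2 : e ℕ.≤ d ℕ.∸ 2
            e≤d-2 = begin
              e                        ≡⟨ ℕ.m+n∸n≡m e 1 ⟨
              e ℕ.+ 1 ℕ.∸ 1            ≤⟨ ℕ.∸-monoˡ-≤ 1 (ℕ.+-monoʳ-≤ e 0<e) ⟩
              e ℕ.+ e ℕ.∸ 1            ≡⟨ ≡.cong (ℕ._∸ 2) d≡1+2e ⟨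
              d ℕ.∸ 2                  ∎
          b+K⊆D : shift (- b) (K G) ⊆ D
          b+K⊆D y y-b∈K = meet
            (E⊆A (Subset.resp E (solve (b ∷ y ∷ []) (λ b y → (b ⊞ 𝟎) ⊞ (⊟ b ⊞ y) ⊜ y) ≡.refl) (b+K∈E y-b∈K)))
            (E⊆B (Subset.resp E (solve (b ∷ y ∷ z ∷ [])
              (λ b y z → (b ⊞ 𝟎) ⊞ ((z ⊟⊟ (b ⊞ b)) ⊟⊟ (⊟ b ⊞ y)) ⊜ z ⊟⊟ y) ≡.refl)
              (b+K∈E (-‿∈ K≤G z-2b∈K y-b∈K))))
        go : ∀ {κ} j → κ ∈ K G → j ℕ.< d → z ≈ κ + (j ℕ.+ j) · b → Rigid
        go {κ} 0 κ∈K _ z≈ = result (inj₁ (Subset.resp (K G) (sym (trans z≈ (+-identityʳ κ))) κ∈K))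
        go {κ} 1 κ∈K _ z≈ = result (inj₂ (Subset.resp (K G) (sym (trans (+-congʳ z≈)
          (solve (κ ∷ b ∷ []) (λ κ b → (κ ⊞ (b ⊞ (b ⊞ 𝟎))) ⊟⊟ (b ⊞ b) ⊜ κ) ≡.refl))) κ∈K))
        -- The index is split off as 1 plus the rest while that rest is at most e, and as e plus the
        -- rest beyond that.
        go {κ} (suc (suc j)) κ∈K j<d z≈ = [ low , high ]′ (ℕ.≤-<-connex (suc j) e)
          where
          low : suc j ℕ.≤ e → Rigid
          low j+1≤e = contradiction ((ℕ.s≤s ℕ.z≤n , 0<e) , (ℕ.s≤s ℕ.z≤n , j+1≤e))
            (no-gap 1 κ∈K z≈ (ℕ.s≤s ℕ.z≤n))
          high : e ℕ.< suc j → Rigid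
          high e<j+1 = contradiction
            ( (0<e , ℕ.≤-refl)
            , ( ℕ.m<n⇒0<n∸m (ℕ.m<n⇒m<1+n e<j+1)
              , ℕ.≤-trans (ℕ.∸-monoˡ-≤ e (ℕ.≤-pred (ℕ.≤-trans j<d (ℕ.≤-reflexive d≡1+2e))))
                  (ℕ.≤-reflexive (ℕ.m+n∸n≡m e e)) ) )
            (no-gap e κ∈K z≈ (ℕ.<⇒≤ (ℕ.m<n⇒m<1+n e<j+1)))

-- The classes of S modulo 2·G, and equality in each of them.

module Parts {t : ℕ} {G : FiniteAbelianGroup c ℓ} (S : Subset G p) (Sᵢ : Fin t → Subset G q)
             (decomposition : IsDecompositionMod2G S Sᵢ) where
  open FiniteAbelianGroup G
    using (_≈_; _+_; -_; _-_; sym; trans; refl; +-cong; +-congʳ; abelianGroup)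
  open AbelianGroupSolver abelianGroup using (solve)
  open IsDecompositionMod2G decomposition public using (nonempty)
  open IsDecompositionMod2G decomposition using (coset; intersection; exhaustive; distinct)

  private
    ∈-coset⇒ : ∀ {g x} → x ∈ coset g → ∃ λ w → x ≈ g + (w + w)
    ∈-coset⇒ (a , h , g≈a , (w , _ , 2w≈h) , a+h≈x) =
      w , trans (sym a+h≈x) (+-cong (sym g≈a) (sym 2w≈h))

    ⇒∈-coset : ∀ {g x} w → x ≈ g + (w + w) → x ∈ coset g
    ⇒∈-coset {g} w x≈ = g , w + w , refl , (w , tt , refl) , sym x≈

  Sᵢ⊆S : ∀ i {x} → x ∈ Sᵢ i → x ∈ S
  Sᵢ⊆S i x∈Sᵢ = proj₁ (proj₁ (proj₂ (intersection i)) _ x∈Sᵢ)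

  part : ∀ {x} → x ∈ S → ∃ λ i → x ∈ Sᵢ i
  part {x} x∈S = let i , _ , ⊇ = exhaustive x (x , x∈S , x∈coset) in i , ⊇ x (x∈S , x∈coset)
    where
    x∈coset : x ∈ coset x
    x∈coset = ⇒∈-coset (0# G) (solve (x ∷ []) (λ x → x ⊜ x ⊞ (𝟎 ⊞ 𝟎)) ≡.refl)

  congruent : ∀ i {x y} → x ∈ Sᵢ i → y ∈ Sᵢ i → ∃ λ w → y ≈ x + (w + w)
  congruent i x∈ y∈ = from-intersection (intersection i) x∈ y∈
    where
    from-intersection : (∃ λ g → Sᵢ i ≐ S ∩ coset g) →
      ∀ {x y} → x ∈ Sᵢ i → y ∈ Sᵢ i → ∃ λ w → y ≈ x + (w + w)
    from-intersection (g , ⊆S∩ , _) {x} {y} x∈ y∈ =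
      let w , x≈ = ∈-coset⇒ (proj₂ (⊆S∩ x x∈))
          v , y≈ = ∈-coset⇒ (proj₂ (⊆S∩ y y∈))
      in v - w , trans y≈ (trans (solve (g ∷ v ∷ w ∷ [])
        (λ g v w → g ⊞ (v ⊞ v) ⊜ (g ⊞ (w ⊞ w)) ⊞ ((v ⊟⊟ w) ⊞ (v ⊟⊟ w))) ≡.refl) (+-congʳ (sym x≈)))

  absorb : ∀ i {x y} w → x ∈ Sᵢ i → y ∈ S → y ≈ x + (w + w) → y ∈ Sᵢ i
  absorb i w x∈ y∈S y≈ = from-intersection (intersection i) x∈ y∈S w y≈
    where
    from-intersection : (∃ λ g → Sᵢ i ≐ S ∩ coset g) →
      ∀ {x y} → x ∈ Sᵢ i → y ∈ S → ∀ w → y ≈ x + (w + w) → y ∈ Sᵢ i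
    from-intersection (g , ⊆S∩ , ⊇S∩) {x} {y} x∈ y∈S w y≈ =
      let v , x≈ = ∈-coset⇒ (proj₂ (⊆S∩ x x∈)) in
      ⊇S∩ y (y∈S , ⇒∈-coset (v + w) (trans y≈ (trans (+-congʳ x≈) (solve (g ∷ v ∷ w ∷ [])
        (λ g v w → (g ⊞ (v ⊞ v)) ⊞ (w ⊞ w) ⊜ g ⊞ ((v ⊞ w) ⊞ (v ⊞ w))) ≡.refl))))

  part-unique : ∀ {i j x} → x ∈ Sᵢ i → x ∈ Sᵢ j → i ≡ j
  part-unique {i} {j} {x} x∈Sᵢ x∈Sⱼ = decidable-stable (i Fin.≟ j) λ i≢j →
    distinct i j i≢j (included i j x∈Sᵢ x∈Sⱼ , included j i x∈Sⱼ x∈Sᵢ)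
    where
    included : ∀ i j → x ∈ Sᵢ i → x ∈ Sᵢ j → Sᵢ i ⊆ Sᵢ j
    included i j x∈Sᵢ x∈Sⱼ y y∈Sᵢ = let w , y≈ = congruent i x∈Sᵢ y∈Sᵢ in absorb j w x∈Sⱼ (Sᵢ⊆S i y∈Sᵢ) y≈

  card-parts : ∣ S ∣ ≡ ∣ ⋃ Sᵢ ∣
  card-parts = card-cong S (⋃ Sᵢ) ((λ _ → part) , (λ _ (i , x∈Sᵢ) → Sᵢ⊆S i x∈Sᵢ))

module Extremal {G : FiniteAbelianGroup c ℓ} (A : Subset G p) (B : Subset G q) (S : Subset G r)
                (large : ∣ A ∣ ℕ.+ ∣ B ∣ ≡ order G ℕ.+ maxL S)
                (0∈S : 0# G ∈ S) (0∉ : 0# G ∉ A ∧[ S ] B)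
                (small : ∣ A ∧[ S ] B ∣ ℕ.+ 2 ℕ.* ∣ S ∣ ≡ order G)
                {t : ℕ} (Sᵢ : Fin t → Subset G s) (decomposition : IsDecompositionMod2G S Sᵢ) where
  open FiniteAbelianGroup G
    using (_≈_; _+_; -_; _-_; sym; trans; +-congˡ; +-congʳ; +-identityˡ; -‿cong; abelianGroup)
  open AbelianGroupSolver abelianGroup using (solve)
  open Parts {G = G} S Sᵢ decomposition public

  Missing : Subset G _
  Missing = ∁ (A ∧[ S ] B)

  Missingᵢ : Fin t → Subset G _
  Missingᵢ i = ∁ (A ∧[ Sᵢ i ] B)

  Missingᵢ⊆Missing : ∀ i {z} → z ∈ Missingᵢ i → z ∈ Missing
  Missingᵢ⊆Missing i z∉ (a , b , a∈A , b∈B , a-b∉S , eq) =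
    z∉ (a , b , a∈A , b∈B , a-b∉S ∘ Sᵢ⊆S i , eq)

  critical : ∀ {z} → z ∈ Missing → Critical A B (_∈ halves S z) z
  critical = unrepresented⇒critical A B S large

  card-halves : ∀ {z} → z ∈ Missing → ∣ halves S z ∣ ≡ maxL S
  card-halves = card-halves≡maxL A B S large

  0∈halves : ∀ {s} (S′ : Subset G s) → 0# G ∈ S′ → 0# G ∈ halves S′ (0# G)
  0∈halves S′ = Subset.resp S′ (solve [] (𝟎 ⊜ ⊟ 𝟎 ⊞ (𝟎 ⊞ 𝟎)) ≡.refl)

  maxL>0 : 0 ℕ.< maxL S
  maxL>0 = ≡.subst (0 ℕ.<_) (card-halves 0∉) (nonempty⇒card>0 (halves S (0# G)) (0# G , 0∈halves S 0∈S))

  halves-nonempty : ∀ {z} → z ∈ Missing → Nonempty (halves S z)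
  halves-nonempty {z} z∈ = card>0⇒nonempty (halves S z) (≡.subst (0 ℕ.<_) (≡.sym (card-halves z∈)) maxL>0)

  difference≈ : ∀ x z → x - (z - x) ≈ - z + (x + x)
  difference≈ x z = solve (x ∷ z ∷ []) (λ x z → x ⊟⊟ (z ⊟⊟ x) ⊜ ⊟ z ⊞ (x ⊞ x)) ≡.refl

  sum≈ : ∀ x z → x + (z - x) ≈ z
  sum≈ x z = solve (x ∷ z ∷ []) (λ x z → x ⊞ (z ⊟⊟ x) ⊜ z) ≡.refl

  -- The pair x, z - x represents z in A + B; as z is missing for `Sᵢ i`, the difference of the pair
  -- must lie in `Sᵢ i`.
  halves⇒halvesᵢ : ∀ i {z} → z ∈ Missingᵢ i → ∀ {x} → x ∈ halves S z → x ∈ halves (Sᵢ i) z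
  halves⇒halvesᵢ i {z} z∉ {x} x∈D = decidable-stable (Subset.dec (halves (Sᵢ i) z) x) λ x∉Dᵢ →
    z∉ (x , z - x , left x∈D , right x∈D ,
        (λ x-[z-x]∈ → x∉Dᵢ (Subset.resp (Sᵢ i) (difference≈ x z) x-[z-x]∈)) , sum≈ x z)
    where open Critical (critical (Missingᵢ⊆Missing i z∉))

  halvesᵢ⇒halves : ∀ i {z x} → x ∈ halves (Sᵢ i) z → x ∈ halves S z
  halvesᵢ⇒halves i = Sᵢ⊆S i

  criticalᵢ : ∀ i {z} → z ∈ Missingᵢ i → Critical A B (_∈ halves (Sᵢ i) z) z
  criticalᵢ i {z} z∈ = record
    { cover = cover
    ; meet  = λ x∈A z-x∈B → halves⇒halvesᵢ i z∈ (meet x∈A z-x∈B)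
    ; left  = λ {x} x∈D → left (halvesᵢ⇒halves i {z} {x} x∈D)
    ; right = λ {x} x∈D → right (halvesᵢ⇒halves i {z} {x} x∈D)
    }
    where open Critical (critical (Missingᵢ⊆Missing i z∈))

  halvesᵢ-nonempty : ∀ i {z} → z ∈ Missingᵢ i → Nonempty (halves (Sᵢ i) z)
  halvesᵢ-nonempty i z∈ = let x , x∈D = halves-nonempty (Missingᵢ⊆Missing i z∈) in x , halves⇒halvesᵢ i z∈ x∈D

  -- A pair (a, z - a) from A and B has 2a - z in `S`, and all values 2a - z for one z are congruent
  -- modulo `2·G`. One half in the class i therefore forces all of them into it.
  missing-part : ∀ i {z x} → z ∈ Missing → x ∈ halves (Sᵢ i) z → z ∈ Missingᵢ i
  missing-part i {z} {x} z∈ x∈Dᵢ (a , b , a∈A , b∈B , a-b∉Sᵢ , a+b≈z) = a-b∉Sᵢ (Subset.resp (Sᵢ i)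
    (trans (+-congʳ (-‿cong (sym a+b≈z))) (solve (a ∷ b ∷ []) (λ a b → ⊟ (a ⊞ b) ⊞ (a ⊞ a) ⊜ a ⊟⊟ b) ≡.refl))
    (absorb i (a - x) x∈Dᵢ (meet a∈A (Subset.resp B
      (trans (solve (a ∷ b ∷ []) (λ a b → b ⊜ (a ⊞ b) ⊟⊟ a) ≡.refl) (+-congʳ a+b≈z)) b∈B))
      (solve (a ∷ x ∷ z ∷ []) (λ a x z → ⊟ z ⊞ (a ⊞ a) ⊜ (⊟ z ⊞ (x ⊞ x)) ⊞ ((a ⊟⊟ x) ⊞ (a ⊟⊟ x))) ≡.refl)))
    where open Critical (critical z∈)

  missing⇒part : ∀ {z} → z ∈ Missing → ∃ λ i → z ∈ Missingᵢ i
  missing⇒part z∈ = let x , x∈D = halves-nonempty z∈ ; i , x∈Dᵢ = part x∈D in i , missing-part i z∈ x∈Dᵢ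

  -- Since D_z is never empty, a missing z equals x + (z - x) for some x in D_z, and so it lies in A
  -- + B.
  exceptions≐Missing : exceptions A B S ≐ Missing
  exceptions≐Missing = (λ _ → proj₂) , λ z z∈ →
    let x , x∈D = halves-nonempty z∈ in
    (x , z - x , Critical.left (critical z∈) x∈D , Critical.right (critical z∈) x∈D , sum≈ x z) , z∈

  Missing≐⋃ : Missing ≐ ⋃ Missingᵢ
  Missing≐⋃ = (λ _ → missing⇒part) , (λ _ (i , z∈) → Missingᵢ⊆Missing i z∈)

  Missingᵢ-disjoint : ∀ i j → i ≢ j → Disjoint (Missingᵢ i) (Missingᵢ j)
  Missingᵢ-disjoint i j i≢j z z∈ᵢ z∈ⱼ = let x , x∈D = halves-nonempty (Missingᵢ⊆Missing i z∈ᵢ) in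
    i≢j (part-unique (halves⇒halvesᵢ i z∈ᵢ x∈D) (halves⇒halvesᵢ j z∈ⱼ x∈D))

  card-halvesᵢ≡maxL : ∀ i {z} → z ∈ Missingᵢ i → ∣ halves (Sᵢ i) z ∣ ≡ maxL S
  card-halvesᵢ≡maxL i {z} z∈ = ≡.trans (card-cong (halves (Sᵢ i) z) (halves S z)
    ((λ x → halvesᵢ⇒halves i {z} {x}) , (λ _ → halves⇒halvesᵢ i z∈))) (card-halves (Missingᵢ⊆Missing i z∈))

  halvesᵢ-onto : ∀ i {z} → z ∈ Missingᵢ i → ∀ {u} → u ∈ Sᵢ i → ∃ λ x → - z + (x + x) ≈ u
  halvesᵢ-onto i {z} z∈ u∈Sᵢ = let x , x∈D = halvesᵢ-nonempty i z∈ ; w , u≈ = congruent i x∈D u∈Sᵢ in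
    x + w , trans (solve (z ∷ x ∷ w ∷ [])
      (λ z x w → ⊟ z ⊞ ((x ⊞ w) ⊞ (x ⊞ w)) ⊜ (⊟ z ⊞ (x ⊞ x)) ⊞ (w ⊞ w)) ≡.refl) (sym u≈)

  card-halvesᵢ : ∀ i {z} → z ∈ Missingᵢ i → ∣ halves (Sᵢ i) z ∣ ≡ ∣ Sᵢ i ∣ ℕ.* ∣ K G ∣
  card-halvesᵢ i {z} z∈ = card-affinePreimage (- z) (Sᵢ i) (halvesᵢ-onto i z∈)

  module _ (i : Fin t) (z₀ : Carrier G) (z₀∈ : z₀ ∈ Missingᵢ i) where
    X : Subset G _
    X = affinePreimage z₀ (Missingᵢ i)

    shifts : CriticalShifts A (reflect z₀ B) (halves (Sᵢ i) z₀) X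
    shifts = critical⇒shifts A B (Sᵢ i) X z₀
      (Subset.resp (Missingᵢ i) (solve (z₀ ∷ []) (λ z → z ⊜ z ⊞ (𝟎 ⊞ 𝟎)) ≡.refl) z₀∈) (criticalᵢ i)

    -- Any z missing for the same class has the form z₀ + 2w: take a half x of z and a half y of z₀
    -- with 2y - z₀ = 2x - z, and let w = x - y.
    card-X : ∣ X ∣ ≡ ∣ Missingᵢ i ∣ ℕ.* ∣ K G ∣
    card-X = card-affinePreimage z₀ (Missingᵢ i) λ {z} z∈ →
      let x , x∈D = halvesᵢ-nonempty i z∈ ; y , -z₀+2y≈ = halvesᵢ-onto i z₀∈ x∈D in
      x - y , trans (trans
        (solve (z₀ ∷ z ∷ x ∷ y ∷ []) (λ z₀ z x y →
          z₀ ⊞ ((x ⊟⊟ y) ⊞ (x ⊟⊟ y)) ⊜ (x ⊞ x) ⊟⊟ (⊟ z₀ ⊞ (y ⊞ y))) ≡.refl)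
        (+-congˡ (-‿cong -z₀+2y≈)))
        (solve (z ∷ x ∷ []) (λ z x → (x ⊞ x) ⊟⊟ (⊟ z ⊞ (x ⊞ x)) ⊜ z) ≡.refl)

  K>0 : 0 ℕ.< ∣ K G ∣
  K>0 = nonempty⇒card>0 (K G) (0# G , +-identityˡ _)

  card-Missingᵢ≤ : ∀ i → ∣ Missingᵢ i ∣ ℕ.≤ 2 ℕ.* ∣ Sᵢ i ∣
  card-Missingᵢ≤ i = case (1 ℕ.≤? ∣ Missingᵢ i ∣)
    where
    case : Dec (1 ℕ.≤ ∣ Missingᵢ i ∣) → ∣ Missingᵢ i ∣ ℕ.≤ 2 ℕ.* ∣ Sᵢ i ∣
    case (no  empty) = ℕ.≤-trans (ℕ.≤-pred (ℕ.≰⇒> empty)) ℕ.z≤n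
    case (yes inhabited) = let z₀ , z₀∈ = card>0⇒nonempty (Missingᵢ i) inhabited in
      ℕ.*-cancelʳ-≤ _ _ (∣ K G ∣) {{ℕ.>-nonZero K>0}} (begin
        ∣ Missingᵢ i ∣ ℕ.* ∣ K G ∣          ≡⟨ card-X i z₀ z₀∈ ⟨
        ∣ X i z₀ z₀∈ ∣                      ≤⟨ card-shifts≤ A (reflect z₀ B) (halves (Sᵢ i) z₀) (X i z₀ z₀∈)
                                                (shifts i z₀ z₀∈) (halvesᵢ-nonempty i z₀∈) ⟩
        2 ℕ.* ∣ halves (Sᵢ i) z₀ ∣          ≡⟨ ≡.cong (2 ℕ.*_) (card-halvesᵢ i z₀∈) ⟩
        2 ℕ.* (∣ Sᵢ i ∣ ℕ.* ∣ K G ∣)        ≡⟨ ℕ.*-assoc 2 (∣ Sᵢ i ∣) _ ⟨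
        2 ℕ.* ∣ Sᵢ i ∣ ℕ.* ∣ K G ∣          ∎)
      where open ℕ.≤-Reasoning

  card-Missing : ∣ Missing ∣ ≡ 2 ℕ.* ∣ S ∣
  card-Missing = ℕ.+-cancelˡ-≡ (∣ A ∧[ S ] B ∣) _ _ (≡.trans (≡.sym (card-∁ (A ∧[ S ] B))) (≡.sym small))

  card-Missingᵢ : ∀ i → ∣ Missingᵢ i ∣ ≡ 2 ℕ.* ∣ Sᵢ i ∣
  card-Missingᵢ = card-⋃-≡ 2 Missingᵢ Sᵢ Missingᵢ-disjoint
    (λ i j i≢j x x∈Sᵢ x∈Sⱼ → i≢j (part-unique x∈Sᵢ x∈Sⱼ)) card-Missingᵢ≤
    (ℕ.≤-reflexive (≡.trans (≡.cong (2 ℕ.*_) (≡.sym card-parts))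
      (≡.trans (≡.sym card-Missing) (card-cong Missing (⋃ Missingᵢ) Missing≐⋃))))

  Missingᵢ-nonempty : ∀ i → Nonempty (Missingᵢ i)
  Missingᵢ-nonempty i = card>0⇒nonempty (Missingᵢ i) (≡.subst (0 ℕ.<_) (≡.sym (card-Missingᵢ i))
    (ℕ.≤-trans (nonempty⇒card>0 (Sᵢ i) (nonempty i)) (ℕ.m≤m+n _ _)))

  card-part : ∀ i → ∣ Sᵢ i ∣ ℕ.* ∣ K G ∣ ≡ maxL S
  card-part i = let z , z∈ = Missingᵢ-nonempty i in
    ≡.trans (≡.sym (card-halvesᵢ i z∈)) (card-halvesᵢ≡maxL i z∈)

  card-sumset : ∀ i → ∣ A ∧[ Sᵢ i ] B ∣ ℕ.+ 2 ℕ.* ∣ Sᵢ i ∣ ≡ order G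
  card-sumset i = ≡.trans
    (≡.cong (∣ A ∧[ Sᵢ i ] B ∣ ℕ.+_) (≡.sym (card-Missingᵢ i))) (≡.sym (card-∁ (A ∧[ Sᵢ i ] B)))

  extremal : ∀ i z₀ z₀∈ → ∣ X i z₀ z₀∈ ∣ ≡ 2 ℕ.* ∣ halves (Sᵢ i) z₀ ∣
  extremal i z₀ z₀∈ = begin
    ∣ X i z₀ z₀∈ ∣                      ≡⟨ card-X i z₀ z₀∈ ⟩
    ∣ Missingᵢ i ∣ ℕ.* ∣ K G ∣          ≡⟨ ≡.cong (ℕ._* ∣ K G ∣) (card-Missingᵢ i) ⟩
    2 ℕ.* ∣ Sᵢ i ∣ ℕ.* ∣ K G ∣          ≡⟨ ℕ.*-assoc 2 (∣ Sᵢ i ∣) _ ⟩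
    2 ℕ.* (∣ Sᵢ i ∣ ℕ.* ∣ K G ∣)        ≡⟨ ≡.cong (2 ℕ.*_) (card-halvesᵢ i z₀∈) ⟨
    2 ℕ.* ∣ halves (Sᵢ i) z₀ ∣          ∎
    where open ≡.≡-Reasoning

-- Passage to the quotient by S₁.

module _ {G : FiniteAbelianGroup c ℓ} {U : Subset G p} (U≤G : IsSubgroup U) where
  private Γ = G ⧸ U≤G

  -- Equality in the quotient unfolds to membership in `U`, so the fibre over z is `reflect z U` by
  -- computation.
  card-preimage-π : (V : Subset Γ q) → ∣ preimage {G = G} {Γ} (π U≤G) V ∣ ≡ ∣ V ∣ ℕ.* ∣ U ∣
  card-preimage-π V = card-preimage {G = G} {Γ} (π U≤G) V (∣ U ∣) λ z _ → ≡.trans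
    (card-cong (preimage {G = G} {Γ} (π U≤G) ｛ z ｝) (reflect z U) ((λ _ → id) , (λ _ → id)))
    (card-reflect z U)

module Quotient {G : FiniteAbelianGroup c ℓ} (A : Subset G p) (B : Subset G q) (S : Subset G r)
                (large : ∣ A ∣ ℕ.+ ∣ B ∣ ≡ order G ℕ.+ maxL S)
                (0∈S : 0# G ∈ S) (0∉ : 0# G ∉ A ∧[ S ] B)
                (small : ∣ A ∧[ S ] B ∣ ℕ.+ 2 ℕ.* ∣ S ∣ ≡ order G)
                {t : ℕ} (Sᵢ : Fin t → Subset G s) (decomposition : IsDecompositionMod2G S Sᵢ)
                (i₁ : Fin t) (0∈S₁ : 0# G ∈ Sᵢ i₁) where
  open FiniteAbelianGroup G
    using (_≈_; _+_; -_; _-_; sym; trans; refl; +-cong; +-congˡ; +-congʳ; +-identityˡ; +-identityʳ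
          ; -‿cong; abelianGroup)
  open AbelianGroupSolver abelianGroup using (solve)
  open Extremal {G = G} A B S large 0∈S 0∉ small Sᵢ decomposition

  S₁ : Subset G s
  S₁ = Sᵢ i₁

  D : Subset G s
  D = halves S₁ (0# G)

  0∈D : 0# G ∈ D
  0∈D = 0∈halves S₁ 0∈S₁

  0∈Missing₁ : 0# G ∈ Missingᵢ i₁
  0∈Missing₁ = missing-part i₁ 0∉ 0∈D

  critical₀ : Critical A B (_∈ D) (0# G)
  critical₀ = criticalᵢ i₁ 0∈Missing₁

  private
    X₀ : Subset G _
    X₀ = X i₁ (0# G) 0∈Missing₁

    shifts₀ : CriticalShifts A (reflect (0# G) B) D X₀
    shifts₀ = shifts i₁ (0# G) 0∈Missing₁

    extremal₀ : ∣ X₀ ∣ ≡ 2 ℕ.* ∣ D ∣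
    extremal₀ = extremal i₁ (0# G) 0∈Missing₁

    D-stable : ∀ {d e f} → d ∈ D → e ∈ D → f ∈ D → f + (e - d) ∈ D
    D-stable = difference-stable A (reflect (0# G) B) D X₀ shifts₀ extremal₀

    D⊆X₀ : ∀ {x} → x ∈ D → x ∈ X₀
    D⊆X₀ {x} x∈D = Subset.resp X₀ (solve (x ∷ []) (λ x → x ⊟⊟ 𝟎 ⊜ x) ≡.refl)
      (differences⊆X A (reflect (0# G) B) D X₀ shifts₀ extremal₀ 0∈D x∈D)

  +∈D : ∀ {x y} → x ∈ D → y ∈ D → x + y ∈ D
  +∈D {x} {y} x∈D y∈D = Subset.resp D (solve (x ∷ y ∷ []) (λ x y → x ⊞ (y ⊟⊟ 𝟎) ⊜ x ⊞ y) ≡.refl)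
    (D-stable 0∈D y∈D x∈D)

  -∈D : ∀ {x} → x ∈ D → - x ∈ D
  -∈D {x} x∈D = Subset.resp D (solve (x ∷ []) (λ x → 𝟎 ⊞ (𝟎 ⊟⊟ x) ⊜ ⊟ x) ≡.refl) (D-stable x∈D 0∈D 0∈D)

  D⇒double∈S₁ : ∀ {x} → x ∈ D → x + x ∈ S₁
  D⇒double∈S₁ {x} = Subset.resp S₁ (solve (x ∷ []) (λ x → ⊟ 𝟎 ⊞ (x ⊞ x) ⊜ x ⊞ x) ≡.refl)

  double∈S₁⇒D : ∀ {x} → x + x ∈ S₁ → x ∈ D
  double∈S₁⇒D {x} = Subset.resp S₁ (solve (x ∷ []) (λ x → x ⊞ x ⊜ ⊟ 𝟎 ⊞ (x ⊞ x)) ≡.refl)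

  S₁⇒double : ∀ {u} → u ∈ S₁ → ∃ λ x → x ∈ D × u ≈ x + x
  S₁⇒double {u} u∈S₁ = let x , eq = halvesᵢ-onto i₁ 0∈Missing₁ u∈S₁ in
    x , Subset.resp S₁ (sym eq) u∈S₁ ,
    trans (sym eq) (solve (x ∷ []) (λ x → ⊟ 𝟎 ⊞ (x ⊞ x) ⊜ x ⊞ x) ≡.refl)

  -- `D` is a coset that contains 0, hence a subgroup, and `S₁` is its image under doubling: a class
  -- modulo `2·G` that contains 0 consists of doubles.
  S₁≤G : IsSubgroup (Sᵢ i₁)
  S₁≤G = record
    { 0∈       = 0∈S₁
    ; +-closed = λ u∈S₁ v∈S₁ →
        let x , x∈D , u≈2x = S₁⇒double u∈S₁ ; y , y∈D , v≈2y = S₁⇒double v∈S₁ in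
        Subset.resp S₁ (trans (solve (x ∷ y ∷ []) (λ x y → (x ⊞ y) ⊞ (x ⊞ y) ⊜ (x ⊞ x) ⊞ (y ⊞ y)) ≡.refl)
          (sym (+-cong u≈2x v≈2y))) (D⇒double∈S₁ (+∈D x∈D y∈D))
    ; -‿closed = λ u∈S₁ → let x , x∈D , u≈2x = S₁⇒double u∈S₁ in
        Subset.resp S₁ (trans (solve (x ∷ []) (λ x → ⊟ x ⊞ ⊟ x ⊜ ⊟ (x ⊞ x)) ≡.refl)
          (sym (-‿cong u≈2x))) (D⇒double∈S₁ (-∈D x∈D))
    }

  module S₁ = IsSubgroup S₁≤G

  Γ : FiniteAbelianGroup c s
  Γ = G ⧸ S₁≤G

  module Γ = FiniteAbelianGroup Γ

  private
    N : Subset G q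
    N = reflect (0# G) B

    -- As y is in `X₀`, either x + 2y is in `A` or x is in `N`. In the second case x is in `D`, so x
    -- + y is too, and the shift by y carries it into `A`.
    A+double : ∀ {x y} → x ∈ A → y ∈ D → x + (y + y) ∈ A
    A+double {x} {y} x∈A y∈D = [ id , in-N ]′ (CriticalShifts.cover shifts₀ x (D⊆X₀ y∈D))
      where
      in-N : x ∈ N → x + (y + y) ∈ A
      in-N x∈N = Subset.resp A (solve (x ∷ y ∷ []) (λ x y → (x ⊞ y) ⊞ y ⊜ x ⊞ (y ⊞ y)) ≡.refl)
        (CriticalShifts.left shifts₀ (D⊆X₀ y∈D) (+∈D (Critical.meet critical₀ x∈A x∈N) y∈D))

    N+double : ∀ {x y} → x ∈ N → y ∈ D → x + (y + y) ∈ N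
    N+double {x} {y} x∈N y∈D = [ in-A , id ]′ (Critical.cover critical₀ (x + (y + y)))
      where
      in-A : x + (y + y) ∈ A → x + (y + y) ∈ N
      in-A x+2y∈A = Critical.right critical₀ (+∈D (Critical.meet critical₀ x∈A x∈N) (+∈D y∈D y∈D))
        where
        x∈A : x ∈ A
        x∈A = Subset.resp A (solve (x ∷ y ∷ []) (λ x y → (x ⊞ (y ⊞ y)) ⊞ (⊟ y ⊞ ⊟ y) ⊜ x) ≡.refl)
          (A+double x+2y∈A (-∈D y∈D))

  A-periodic : ∀ {x y} → x Γ.≈ y → x ∈ A → y ∈ A
  A-periodic {x} {y} x~y x∈A = let w , w∈D , x-y≈2w = S₁⇒double x~y in
    Subset.resp A (trans (solve (x ∷ w ∷ []) (λ x w → x ⊞ (⊟ w ⊞ ⊟ w) ⊜ x ⊟⊟ (w ⊞ w)) ≡.refl)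
      (trans (+-congˡ (-‿cong (sym x-y≈2w))) (solve (x ∷ y ∷ []) (λ x y → x ⊟⊟ (x ⊟⊟ y) ⊜ y) ≡.refl)))
      (A+double x∈A (-∈D w∈D))

  B-periodic : ∀ {x y} → x Γ.≈ y → x ∈ B → y ∈ B
  B-periodic {x} {y} x~y x∈B = let w , w∈D , x-y≈2w = S₁⇒double x~y in
    Subset.resp B (trans (+-congˡ (-‿cong (+-congˡ (sym x-y≈2w))))
      (solve (x ∷ y ∷ []) (λ x y → 𝟎 ⊟⊟ (⊟ x ⊞ (x ⊟⊟ y)) ⊜ y) ≡.refl))
      (N+double (Subset.resp B (solve (x ∷ []) (λ x → x ⊜ 𝟎 ⊟⊟ (⊟ x)) ≡.refl) x∈B) w∈D)

  A′ : Subset Γ _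
  A′ = image (π S₁≤G) A

  B′ : Subset Γ _
  B′ = image (π S₁≤G) B

  ⇒A′ : ∀ {x} → x ∈ A → x ∈ A′
  ⇒A′ x∈A = _ , x∈A , Γ.refl

  ⇒B′ : ∀ {x} → x ∈ B → x ∈ B′
  ⇒B′ x∈B = _ , x∈B , Γ.refl

  A′⇒ : ∀ {x} → x ∈ A′ → x ∈ A
  A′⇒ (_ , y∈A , y~x) = A-periodic y~x y∈A

  B′⇒ : ∀ {x} → x ∈ B′ → x ∈ B
  B′⇒ (_ , y∈B , y~x) = B-periodic y~x y∈B

  critical-π : ∀ {p q} {D : Pred (Carrier G) p} {D′ : Pred (Carrier G) q} {z z′} → z ≈ z′ →
    (∀ {x} → D x → D′ x) → (∀ {x} → D′ x → D x) → Critical A B D z → Critical {G = Γ} A′ B′ D′ z′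
  critical-π z≈z′ D⇒D′ D′⇒D critical = record
    { cover = λ x → [ inj₁ ∘ ⇒A′ , inj₂ ∘ ⇒B′ ∘ Subset.resp B (+-congʳ z≈z′) ]′ (cover x)
    ; meet  = λ x∈A z-x∈B → D⇒D′ (meet (A′⇒ x∈A) (Subset.resp B (+-congʳ (sym z≈z′)) (B′⇒ z-x∈B)))
    ; left  = λ x∈D → ⇒A′ (left (D′⇒D x∈D))
    ; right = λ x∈D → ⇒B′ (Subset.resp B (+-congʳ z≈z′) (right (D′⇒D x∈D)))
    }
    where open Critical critical

  double∈S₁⇒K : ∀ {x} → x + x ∈ S₁ → x ∈ K Γ
  double∈S₁⇒K {x} = Subset.resp S₁ (solve (x ∷ []) (λ x → x ⊞ x ⊜ (x ⊞ x) ⊟⊟ 𝟎) ≡.refl)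

  K⇒double∈S₁ : ∀ {x} → x ∈ K Γ → x + x ∈ S₁
  K⇒double∈S₁ {x} = Subset.resp S₁ (solve (x ∷ []) (λ x → (x ⊞ x) ⊟⊟ 𝟎 ⊜ x ⊞ x) ≡.refl)

  -- Take b in `X₀` but not in `D`: then 2b is missing for `S₁`, and b is not in `K Γ` because `D`
  -- modulo `S₁` is `K Γ`.
  pairStructure : PairStructure (G ⧸ S₁≤G) (image (π S₁≤G) A) (image (π S₁≤G) B)
  pairStructure = from-exit (exit-exists A N D X₀ shifts₀ extremal₀ 0∈D)
    where
    from-exit : (∃ λ w → w ∈ X₀ × 0# G + w ∉ D) → PairStructure Γ A′ B′
    from-exit (b , b∈X₀ , 0+b∉D) = Pairing.pairStructure {G = Γ} A′ B′ b critical₀-π critical₁-π b∉K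
      where
      b+K : Subset Γ s
      b+K = shift {G = Γ} (Γ.- b) (K Γ)
      critical₀-π : Critical {G = Γ} A′ B′ (_∈ K Γ) (0# Γ)
      critical₀-π = critical-π refl (λ {x} x∈D → double∈S₁⇒K (D⇒double∈S₁ {x} x∈D))
        (λ {x} x∈K → double∈S₁⇒D {x} (K⇒double∈S₁ {x} x∈K)) critical₀
      critical₁-π : Critical {G = Γ} A′ B′ (_∈ b+K) (b Γ.+ b)
      critical₁-π = critical-π (+-identityˡ (b + b))
        (λ {x} → Subset.resp S₁ (solve (b ∷ x ∷ [])
          (λ b x → ⊟ (𝟎 ⊞ (b ⊞ b)) ⊞ (x ⊞ x) ⊜ ((⊟ b ⊞ x) ⊞ (⊟ b ⊞ x)) ⊟⊟ 𝟎) ≡.refl))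
        (λ {x} → Subset.resp S₁ (solve (b ∷ x ∷ [])
          (λ b x → ((⊟ b ⊞ x) ⊞ (⊟ b ⊞ x)) ⊟⊟ 𝟎 ⊜ ⊟ (𝟎 ⊞ (b ⊞ b)) ⊞ (x ⊞ x)) ≡.refl))
        (criticalᵢ i₁ {0# G + (b + b)} b∈X₀)
      b∉K : b ∉ K Γ
      b∉K b∈K = 0+b∉D (Subset.resp D (sym (+-identityˡ b)) (double∈S₁⇒D {b} (K⇒double∈S₁ {b} b∈K)))

  -- Consequences of |K(Γ)| < (d+1)/2.

  module Uniform (σ : PairStructure (G ⧸ S₁≤G) (image (π S₁≤G) A) (image (π S₁≤G) B))
                 (K<half : ∣ K (G ⧸ S₁≤G) ∣ ℕ.< (PairStructure.d σ ℕ.+ 1) ℕ./ 2) where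
    open PairStructure σ using (b; Q; R)
    private
      module Rigid = Rigidity {G = Γ} A′ B′ σ
      module M = Multiples {G = Γ} b
      KΓ : Subset Γ s
      KΓ = K Γ
      b+KΓ : Subset Γ s
      b+KΓ = shift (- b) KΓ

    -- Invariance under `S₁` is drawn from D_z = A ∩ (z - B), where both sets are unions of cosets,
    -- and not from the condition 2x - z ∈ S.
    halvesΓ : ∀ {z} → z ∈ Missing → Subset Γ r
    halvesΓ {z} z∈ = record
      { Mem  = λ x → x ∈ halves S z
      ; resp = λ {x} {y} x~y x∈D → meet (A-periodic x~y (left x∈D))
          (B-periodic (Subset.resp S₁
            (solve (x ∷ y ∷ z ∷ []) (λ x y z → ⊟ (x ⊟⊟ y) ⊜ (z ⊟⊟ x) ⊟⊟ (z ⊟⊟ y)) ≡.refl)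
            (S₁.-‿closed x~y)) (right x∈D))
      ; dec  = Subset.dec (halves S z)
      }
      where open Critical (critical z∈)

    card-halvesΓ : ∀ {z} (z∈ : z ∈ Missing) → ∣ halvesΓ z∈ ∣ ≡ ∣ KΓ ∣
    card-halvesΓ {z} z∈ = ℕ.*-cancelʳ-≡ _ _ (∣ S₁ ∣) {{ℕ.>-nonZero (nonempty⇒card>0 S₁ (0# G , 0∈S₁))}} (begin
      ∣ halvesΓ z∈ ∣ ℕ.* ∣ S₁ ∣                         ≡⟨ card-preimage-π S₁≤G (halvesΓ z∈) ⟨
      ∣ preimage {G = G} {Γ} (π S₁≤G) (halvesΓ z∈) ∣    ≡⟨ card-cong (preimage {G = G} {Γ} (π S₁≤G) (halvesΓ z∈))
                                                            (halves S z) ((λ _ → id) , (λ _ → id)) ⟩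
      ∣ halves S z ∣                                    ≡⟨ card-halves z∈ ⟩
      maxL S                                            ≡⟨ card-halvesᵢ≡maxL i₁ 0∈Missing₁ ⟨
      ∣ D ∣                                             ≡⟨ card-cong D (preimage {G = G} {Γ} (π S₁≤G) KΓ)
                                                            ( (λ x x∈D → double∈S₁⇒K (D⇒double∈S₁ {x} x∈D))
                                                            , (λ x x∈K → double∈S₁⇒D {x} (K⇒double∈S₁ {x} x∈K)) ) ⟩
      ∣ preimage {G = G} {Γ} (π S₁≤G) KΓ ∣              ≡⟨ card-preimage-π S₁≤G KΓ ⟩
      ∣ KΓ ∣ ℕ.* ∣ S₁ ∣                                 ∎)
      where open ≡.≡-Reasoning

    rigid : ∀ {z} (z∈ : z ∈ Missing) →
      (z ∈ KΓ × halvesΓ z∈ ≐ KΓ) ⊎ (z - (b + b) ∈ KΓ × halvesΓ z∈ ≐ b+KΓ)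
    rigid {z} z∈ = Rigid.rigid (halvesΓ z∈) z (critical-π refl id id (critical z∈))
      (ℕ.≤-reflexive (card-halvesΓ z∈)) K<half

    -- `ζ` serves two purposes: `Sᵢ i` is its coset modulo `S₁`, which yields the cosets in `Y`, and
    -- z is `ζ` or `ζ` + 2b, which yields the exceptions.
    record Located (i : Fin t) (z : Carrier G) : Set (c ⊔ ℓ ⊔ s) where
      field
        ζ        : Carrier G
        ζ≈       : ζ ≈ z ⊎ ζ ≈ z - (b + b)
        double∈  : ζ + ζ ∈ S₁
        part⇒    : ∀ {u} → u ∈ Sᵢ i → u - ζ ∈ S₁
        ⇒part    : ∀ {u} → u - ζ ∈ S₁ → u ∈ Sᵢ i

    -- In both cases the elements of the part are 2x - z = 2(x - β) - ζ, with β = 0 or b.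
    located : ∀ i {z} → z ∈ Missingᵢ i → Located i z
    located i {z} z∈ᵢ = go (rigid z∈)
      where
      z∈ : z ∈ Missing
      z∈ = Missingᵢ⊆Missing i z∈ᵢ
      locate : ∀ β → z - (β + β) ∈ KΓ → (z - (β + β) ≈ z ⊎ z - (β + β) ≈ z - (b + b)) →
        (∀ {x} → x ∈ halves S z → - β + x ∈ KΓ) → (∀ {x} → - β + x ∈ KΓ → x ∈ halves S z) → Located i z
      locate β ζ∈K ζ≈ halves⇒ ⇒halves = record
        { ζ       = z - (β + β)
        ; ζ≈      = ζ≈
        ; double∈ = K⇒double∈S₁ {z - (β + β)} ζ∈K
        ; part⇒   = λ {u} u∈Sᵢ → let x , 2x-z≈u = halvesᵢ-onto i z∈ᵢ u∈Sᵢ in Subset.resp S₁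
            (trans (solve (x ∷ β ∷ z ∷ []) (λ x β z →
              ((⊟ β ⊞ x) ⊞ (⊟ β ⊞ x)) ⊟⊟ ((z ⊟⊟ (β ⊞ β)) ⊞ (z ⊟⊟ (β ⊞ β)))
                ⊜ (⊟ z ⊞ (x ⊞ x)) ⊟⊟ (z ⊟⊟ (β ⊞ β))) ≡.refl)
              (+-congʳ 2x-z≈u))
            (-‿∈ S₁≤G (K⇒double∈S₁ { - β + x} (halves⇒ (Subset.resp S (sym 2x-z≈u) (Sᵢ⊆S i u∈Sᵢ))))
              (K⇒double∈S₁ {z - (β + β)} ζ∈K))
        ; ⇒part   = λ {u} u-ζ∈S₁ → let w , w∈D , u-ζ≈2w = S₁⇒double u-ζ∈S₁
                                       x = β + ((z - (β + β)) + w) in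
            Subset.resp (Sᵢ i)
              (trans (solve (β ∷ z ∷ w ∷ []) (λ β z w →
                ⊟ z ⊞ ((β ⊞ ((z ⊟⊟ (β ⊞ β)) ⊞ w)) ⊞ (β ⊞ ((z ⊟⊟ (β ⊞ β)) ⊞ w)))
                  ⊜ (z ⊟⊟ (β ⊞ β)) ⊞ (w ⊞ w)) ≡.refl)
                (trans (+-congˡ (sym u-ζ≈2w))
                  (solve (u ∷ z - (β + β) ∷ []) (λ u ζ → ζ ⊞ (u ⊟⊟ ζ) ⊜ u) ≡.refl)))
              (halves⇒halvesᵢ i z∈ᵢ (⇒halves {x} (double∈S₁⇒K (Subset.resp S₁
                (solve (β ∷ z - (β + β) ∷ w ∷ []) (λ β ζ w →
                  (ζ ⊞ ζ) ⊞ (w ⊞ w) ⊜ (⊟ β ⊞ (β ⊞ (ζ ⊞ w))) ⊞ (⊟ β ⊞ (β ⊞ (ζ ⊞ w)))) ≡.refl)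
                (S₁.+-closed (K⇒double∈S₁ {z - (β + β)} ζ∈K) (D⇒double∈S₁ w∈D))))))
        }
      z-0≈z : z - (0# G + 0# G) ≈ z
      z-0≈z = solve (z ∷ []) (λ z → z ⊟⊟ (𝟎 ⊞ 𝟎) ⊜ z) ≡.refl
      -0+x≈x : ∀ x → - 0# G + x ≈ x
      -0+x≈x x = solve (x ∷ []) (λ x → ⊟ 𝟎 ⊞ x ⊜ x) ≡.refl
      to-Γ : ∀ {x y} → x ≈ y → x Γ.≈ y
      to-Γ = Func.cong (π S₁≤G)
      go : (z ∈ KΓ × halvesΓ z∈ ≐ KΓ) ⊎ (z - (b + b) ∈ KΓ × halvesΓ z∈ ≐ b+KΓ) → Located i z
      go (inj₁ (z∈K , ⊆K , K⊆)) = locate (0# G)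
        (Subset.resp KΓ (to-Γ (sym z-0≈z)) z∈K) (inj₁ z-0≈z)
        (λ {x} x∈ → Subset.resp KΓ (to-Γ (sym (-0+x≈x x))) (⊆K x x∈))
        (λ {x} x∈K → K⊆ x (Subset.resp KΓ (to-Γ (-0+x≈x x)) x∈K))
      go (inj₂ (z-2b∈K , ⊆b+K , b+K⊆)) = locate b z-2b∈K (inj₂ refl) (λ {x} → ⊆b+K x) (λ {x} → b+K⊆ x)

    halves∈KH : ∀ {z x} → z ∈ Missing → x ∈ halves S z → x ∈ M.KH
    halves∈KH {z} {x} z∈ x∈ = go (rigid z∈)
      where
      go : (z ∈ KΓ × halvesΓ z∈ ≐ KΓ) ⊎ (z - (b + b) ∈ KΓ × halvesΓ z∈ ≐ b+KΓ) → x ∈ M.KH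
      go (inj₁ (_ , ⊆K , _))   = M.K⊆KH (⊆K x x∈)
      go (inj₂ (_ , ⊆b+K , _)) = Subset.resp M.KH
        (Func.cong (π S₁≤G) (solve (b ∷ x ∷ []) (λ b x → b ⊞ (⊟ b ⊞ x) ⊜ x) ≡.refl))
        (M.KH.+-closed (M.b∈KH (PairStructure.d-odd σ)) (M.K⊆KH (⊆b+K x x∈)))

    y₀ : Fin t → Carrier G
    y₀ i = proj₁ (nonempty i)

    located₀ : ∀ i → Located i (proj₁ (Missingᵢ-nonempty i))
    located₀ i = located i (proj₂ (Missingᵢ-nonempty i))

    part-congruent : ∀ i {u v} → u ∈ Sᵢ i → v ∈ Sᵢ i → u Γ.≈ v
    part-congruent i {u} {v} u∈Sᵢ v∈Sᵢ = Subset.resp S₁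
      (solve (u ∷ v ∷ ζ ∷ []) (λ u v ζ → (u ⊟⊟ ζ) ⊟⊟ (v ⊟⊟ ζ) ⊜ u ⊟⊟ v) ≡.refl)
      (-‿∈ S₁≤G (part⇒ u∈Sᵢ) (part⇒ v∈Sᵢ))
      where open Located (located₀ i)

    part-absorb : ∀ i {u v} → u ∈ Sᵢ i → u Γ.≈ v → v ∈ Sᵢ i
    part-absorb i {u} {v} u∈Sᵢ u~v = ⇒part (Subset.resp S₁
      (solve (u ∷ v ∷ ζ ∷ []) (λ u v ζ → (u ⊟⊟ ζ) ⊟⊟ (u ⊟⊟ v) ⊜ v ⊟⊟ ζ) ≡.refl)
      (-‿∈ S₁≤G (part⇒ u∈Sᵢ) u~v))
      where open Located (located₀ i)

    part-double : ∀ i {u} → u ∈ Sᵢ i → u + u ∈ S₁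
    part-double i {u} u∈Sᵢ = Subset.resp S₁
      (solve (u ∷ ζ ∷ []) (λ u ζ → (ζ ⊞ ζ) ⊞ ((u ⊟⊟ ζ) ⊞ (u ⊟⊟ ζ)) ⊜ u ⊞ u) ≡.refl)
      (S₁.+-closed double∈ (S₁.+-closed (part⇒ u∈Sᵢ) (part⇒ u∈Sᵢ)))
      where open Located (located₀ i)

    Y : Subset G s
    Y = preimage (double G) S₁

    parts : Representatives Γ._≈_ (⋃ Sᵢ) t
    parts = record
      { at           = y₀
      ; at∈          = λ i → i , proj₂ (nonempty i)
      ; at-injective = λ {i} {j} yᵢ~yⱼ →
          part-unique (part-absorb i (proj₂ (nonempty i)) yᵢ~yⱼ) (proj₂ (nonempty j))
      ; at-onto      = λ (i , u∈Sᵢ) → i , part-congruent i u∈Sᵢ (proj₂ (nonempty i))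
      }

    extension : ∃ (Representatives Γ._≈_ (Y ∖ ⋃ Sᵢ))
    extension = _ , representatives (Setoid.isEquivalence Γ.setoid) Γ._≟_ (Func.cong (π S₁≤G)) (Y ∖ ⋃ Sᵢ)

    r′ : ℕ
    r′ = t ℕ.+ proj₁ extension

    t≤r′ : t ℕ.≤ r′
    t≤r′ = ℕ.m≤m+n t _

    all : Representatives Γ._≈_ (⋃ Sᵢ ∪ (Y ∖ ⋃ Sᵢ)) r′
    all = disjoint-representatives {_~_ = Γ._≈_} Γ.sym
      (λ (i , u∈Sᵢ) (_ , v∉) u~v → v∉ (i , part-absorb i u∈Sᵢ u~v)) parts (proj₂ extension)

    y : Fin r′ → Carrier G
    y = at all

    y-inject : ∀ i → y (inject≤ i t≤r′) ≡ y₀ i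
    y-inject i = ≡.trans
      (≡.cong y (Fin.toℕ-injective (≡.trans (Fin.toℕ-inject≤ i t≤r′) (≡.sym (Fin.toℕ-↑ˡ i (proj₁ extension))))))
      (≡.cong [ y₀ , at (proj₂ extension) ]′ (Fin.splitAt-↑ˡ t i (proj₁ extension)))

    y-inject∈ : ∀ i → y (inject≤ i t≤r′) ∈ Sᵢ i
    y-inject∈ i = ≡.subst (_∈ Sᵢ i) (≡.sym (y-inject i)) (proj₂ (nonempty i))

    Y-cosets : preimage (double G) (Sᵢ i₁) ≐ ⋃ (λ j → ｛ y j ｝ ⊕ Sᵢ i₁)
    Y-cosets = to , from
      where
      listed : ∀ x → x ∈ Y → Dec (x ∈ ⋃ Sᵢ) → ∃ λ j → x Γ.≈ y j
      listed x _   (yes x∈) = at-onto all (inj₁ x∈)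
      listed x x∈Y (no  x∉) = at-onto all (inj₂ (x∈Y , x∉))
      to : Y ⊆ ⋃ (λ j → ｛ y j ｝ ⊕ S₁)
      to x x∈Y = let j , x~yⱼ = listed x x∈Y (Subset.dec (⋃ Sᵢ) x) in j , ∈-coset⁺ S₁ x~yⱼ
      in-Y : ∀ {x} → x ∈ ⋃ Sᵢ ∪ (Y ∖ ⋃ Sᵢ) → x ∈ Y
      in-Y (inj₁ (i , x∈Sᵢ)) = part-double i x∈Sᵢ
      in-Y (inj₂ (x∈Y , _))  = x∈Y
      from : ⋃ (λ j → ｛ y j ｝ ⊕ S₁) ⊆ Y
      from x (j , x∈) = Subset.resp S₁
        (solve (x ∷ y j ∷ []) (λ x y → (y ⊞ y) ⊞ ((x ⊟⊟ y) ⊞ (x ⊟⊟ y)) ⊜ x ⊞ x) ≡.refl)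
        (S₁.+-closed (in-Y (at∈ all j)) (S₁.+-closed (∈-coset⁻ S₁ x∈) (∈-coset⁻ S₁ x∈)))

    y-distinct : ∀ j j′ → j ≢ j′ → ¬ (｛ y j ｝ ⊕ Sᵢ i₁ ≐ ｛ y j′ ｝ ⊕ Sᵢ i₁)
    y-distinct j j′ j≢j′ (⊆ , _) =
      j≢j′ (at-injective all (∈-coset⁻ S₁ (⊆ (y j) (∈-coset⁺ S₁ (Γ.refl {y j})))))

    part-coset : ∀ i → Sᵢ i ≐ ｛ y (inject≤ i t≤r′) ｝ ⊕ Sᵢ i₁
    part-coset i = (λ u u∈Sᵢ → ∈-coset⁺ S₁ (part-congruent i u∈Sᵢ (y-inject∈ i)))
                 , (λ u u∈ → part-absorb i (y-inject∈ i) (Γ.sym {u} (∈-coset⁻ S₁ u∈)))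

    2·S⊆S₁ : 2· S ⊆ Sᵢ i₁
    2·S⊆S₁ v (u , u∈S , 2u≈v) = let i , u∈Sᵢ = part u∈S in Subset.resp S₁ 2u≈v (part-double i u∈Sᵢ)

    module _ (b* : Carrier G) (b*~b : FiniteAbelianGroup._≈_ (G ⧸ S₁≤G) (π S₁≤G ⟨$⟩ b*) (PairStructure.b σ)) where
      T : Subset G _
      T = (｛ 0# G ｝ ∪ ｛ double G ⟨$⟩ b* ｝) ⊕ S

      Missing⊆T : Missing ⊆ T
      Missing⊆T z z∈ = let i , z∈ᵢ = missing⇒part z∈ in go i (located i z∈ᵢ)
        where
        go : ∀ i → Located i z → z ∈ T
        go i loc = case ζ≈
          where
          open Located loc
          ζ∈Sᵢ : ζ ∈ Sᵢ i
          ζ∈Sᵢ = ⇒part (Γ.refl {ζ})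
          case : ζ ≈ z ⊎ ζ ≈ z - (b + b) → z ∈ T
          case (inj₁ ζ≈z)    = 0# G , ζ , inj₁ refl , Sᵢ⊆S i ζ∈Sᵢ , trans (+-identityˡ ζ) ζ≈z
          -- The choice of the lift is harmless: z - 2b and z - 2b* differ by 2(b* - b), an element
          -- of `S₁`.
          case (inj₂ ζ≈z-2b) = b* + b* , z - (b* + b*) , inj₂ refl ,
            Sᵢ⊆S i (part-absorb i ζ∈Sᵢ (Subset.resp S₁
              (trans (solve (z ∷ b ∷ b* ∷ []) (λ z b b* →
                (b* ⊟⊟ b) ⊞ (b* ⊟⊟ b) ⊜ (z ⊟⊟ (b ⊞ b)) ⊟⊟ (z ⊟⊟ (b* ⊞ b*))) ≡.refl) (+-congʳ (sym ζ≈z-2b)))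
              (S₁.+-closed b*~b b*~b))) ,
            sum≈ (b* + b*) z

      -- `T` is covered by two translates of `S`, so it has at most 2|S| elements, the number of
      -- missing sums. The inclusion of the missing sums in `T` is then an equality.
      T-card : ∣ T ∣ ℕ.≤ ∣ Missing ∣
      T-card = begin
        ∣ T ∣                                   ≤⟨ card-mono T (S ∪ shift (- (b* + b*)) S) T⊆ ⟩
        ∣ S ∪ shift (- (b* + b*)) S ∣           ≤⟨ ℕ.m≤m+n _ _ ⟩
        ∣ S ∪ shift (- (b* + b*)) S ∣ ℕ.+ ∣ S ∩ shift (- (b* + b*)) S ∣
                                                ≡⟨ card-∪-∩ S (shift (- (b* + b*)) S) ⟩
        ∣ S ∣ ℕ.+ ∣ shift (- (b* + b*)) S ∣     ≡⟨ ≡.cong (∣ S ∣ ℕ.+_) (card-shift (- (b* + b*)) S) ⟩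
        ∣ S ∣ ℕ.+ ∣ S ∣                         ≡⟨ ≡.cong (∣ S ∣ ℕ.+_) (ℕ.+-identityʳ _) ⟨
        2 ℕ.* ∣ S ∣                             ≡⟨ card-Missing ⟨
        ∣ Missing ∣                             ∎
        where
        open ℕ.≤-Reasoning
        T⊆ : T ⊆ S ∪ shift (- (b* + b*)) S
        T⊆ z (a , u , inj₁ 0≈a , u∈S , a+u≈z) = inj₁ (Subset.resp S
          (trans (sym (+-identityˡ u)) (trans (+-congʳ 0≈a) a+u≈z)) u∈S)
        T⊆ z (a , u , inj₂ 2b≈a , u∈S , a+u≈z) = inj₂ (Subset.resp S
          (trans (solve (u ∷ a ∷ []) (λ u a → u ⊜ ⊟ a ⊞ (a ⊞ u)) ≡.refl) (+-cong (-‿cong (sym 2b≈a)) a+u≈z)) u∈S)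

      exceptions≐T : exceptions A B S ≐ (｛ 0# G ｝ ∪ ｛ double G ⟨$⟩ b* ｝) ⊕ S
      exceptions≐T = (λ z z∈ → Missing⊆T z (proj₁ exceptions≐Missing z z∈))
                   , (λ z z∈T → proj₂ exceptions≐Missing z (card-≤⇒⊇ Missing T Missing⊆T T-card z z∈T))

    -- A common element makes z = q + r a missing sum. Then q lies in A ∩ (z - B) and is a half of
    -- z, hence in `KH`, which `Q` avoids.
    disjoint : Disjoint
      ((｛ 0# (G ⧸ S₁≤G) ｝ ∪ ｛ double (G ⧸ S₁≤G) ⟨$⟩ PairStructure.b σ ｝)
        ⊕ range (λ i → π S₁≤G ⟨$⟩ y (inject≤ i t≤r′)))
      (PairStructure.Q σ ⊕ PairStructure.R σ)
    disjoint x (a , v , a∈ , (i , yᵢ~v) , a+v~x) (q′ , r″ , q∈Q , r∈R , q+r~x) =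
      Rigid.Q∉KH q∈Q (halves∈KH z∈Missing (Critical.meet (critical z∈Missing)
        (A′⇒ (proj₂ (PairStructure.A′-eq σ) _ (inj₂ q∈Q)))
        (Subset.resp B (solve (q′ ∷ r″ ∷ []) (λ q r → r ⊜ (q ⊞ r) ⊟⊟ q) ≡.refl)
          (B′⇒ (proj₂ (PairStructure.B′-eq σ) _ (inj₂ r∈R))))))
      where
      z : Carrier G
      z = q′ + r″
      z-α∈S : ∀ {α} → α Γ.≈ a → z - α ∈ S
      z-α∈S {α} α~a = Sᵢ⊆S i (part-absorb i (y-inject∈ i) (Subset.resp S₁
        (solve (α ∷ a ∷ v ∷ x ∷ z ∷ y (inject≤ i t≤r′) ∷ []) (λ α a v x z y →
          (α ⊟⊟ a) ⊞ ((y ⊟⊟ v) ⊞ (((a ⊞ v) ⊟⊟ x) ⊟⊟ (z ⊟⊟ x))) ⊜ y ⊟⊟ (z ⊟⊟ α)) ≡.refl)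
        (S₁.+-closed α~a (S₁.+-closed yᵢ~v (-‿∈ S₁≤G a+v~x q+r~x)))))
      z∈T : z ∈ T b (Γ.refl {b})
      z∈T = go a∈
        where
        go : _ → z ∈ T b (Γ.refl {b})
        go (inj₁ 0~a)  = 0# G , z - 0# G , inj₁ refl , z-α∈S 0~a , sum≈ (0# G) z
        go (inj₂ 2b~a) = b + b , z - (b + b) , inj₂ refl , z-α∈S 2b~a , sum≈ (b + b) z
      z∈Missing : z ∈ Missing
      z∈Missing = proj₁ exceptions≐Missing z (proj₂ (exceptions≐T b (Γ.refl {b})) z z∈T)

open import Data.Nat.Base using (_+_; _*_; _/_; _<_; _≤_)

theorem23 : ∀ {c ℓ p q r s} (G : FiniteAbelianGroup c ℓ) (A : Subset G p) (B : Subset G q) (S : Subset G r) →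
    Nonempty A → Nonempty B → Nonempty S →
    ∣ A ∣ + ∣ B ∣ ≡ order G + maxL S →
    0# G ∈ A ∩ B ∩ S →
    0# G ∈ exceptions A B S →
    ∣ A ∧[ S ] B ∣ + 2 * ∣ S ∣ ≡ order G →
    ∀ {t} (Sᵢ : Fin t → Subset G s) → IsDecompositionMod2G S Sᵢ →
    ( (∀ i → ∣ Sᵢ i ∣ * ∣ K G ∣ ≡ maxL S)
    × (∀ i → ∣ A ∧[ Sᵢ i ] B ∣ + 2 * ∣ Sᵢ i ∣ ≡ order G)
    × exceptions A B S ≐ ∁ (A ∧[ S ] B)
    × ∁ (A ∧[ S ] B) ≐ ⋃ (λ i → ∁ (A ∧[ Sᵢ i ] B))
    × (∀ i → Nonempty (∁ (A ∧[ Sᵢ i ] B)))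
    × (∀ i j → i ≢ j → Disjoint (∁ (A ∧[ Sᵢ i ] B)) (∁ (A ∧[ Sᵢ j ] B))) )
    ×
    (∀ i₁ → 0# G ∈ Sᵢ i₁ →
    Σ (IsSubgroup (Sᵢ i₁)) λ S₁≤G →
    PairStructure (G ⧸ S₁≤G) (image (π S₁≤G) A) (image (π S₁≤G) B)
    ×
    ((σ : PairStructure (G ⧸ S₁≤G) (image (π S₁≤G) A) (image (π S₁≤G) B)) →
    ∣ K (G ⧸ S₁≤G) ∣ < (PairStructure.d σ + 1) / 2 →
    ∃ λ r → Σ (t ≤ r) λ t≤r → ∃ λ (y : Fin r → Carrier G) →
    preimage (double G) (Sᵢ i₁) ≐ ⋃ (λ j → ｛ y j ｝ ⊕ Sᵢ i₁)
    × (∀ j j′ → j ≢ j′ → ¬ (｛ y j ｝ ⊕ Sᵢ i₁ ≐ ｛ y j′ ｝ ⊕ Sᵢ i₁))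
    × (∀ i → Sᵢ i ≐ ｛ y (inject≤ i t≤r) ｝ ⊕ Sᵢ i₁)
    × 2· S ⊆ Sᵢ i₁
    × (∀ b* → FiniteAbelianGroup._≈_ (G ⧸ S₁≤G) (π S₁≤G ⟨$⟩ b*) (PairStructure.b σ) →
    exceptions A B S ≐ (｛ 0# G ｝ ∪ ｛ double G ⟨$⟩ b* ｝) ⊕ S)
    × Disjoint
    ((｛ 0# (G ⧸ S₁≤G) ｝ ∪ ｛ double (G ⧸ S₁≤G) ⟨$⟩ PairStructure.b σ ｝)
    ⊕ range (λ i → π S₁≤G ⟨$⟩ y (inject≤ i t≤r)))
    (PairStructure.Q σ ⊕ PairStructure.R σ)))
theorem23 G A B S _ _ _ large (_ , _ , 0∈S) (_ , 0∉) small Sᵢ decomposition =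
  ( card-part , card-sumset , exceptions≐Missing , Missing≐⋃ , Missingᵢ-nonempty , Missingᵢ-disjoint )
  , λ i₁ 0∈S₁ →
    let open Quotient {G = G} A B S large 0∈S 0∉ small Sᵢ decomposition i₁ 0∈S₁ in
    S₁≤G , pairStructure , λ σ K<half →
      let open Uniform σ K<half in
      r′ , t≤r′ , y , Y-cosets , y-distinct , part-coset , 2·S⊆S₁ , exceptions≐T , disjoint
  where open Extremal {G = G} A B S large 0∈S 0∉ small Sᵢ decomposition
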